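{- Let $X$ be a finite alphabet with at least two letters and let $k\ge 2$. The quotient-posets of $(\mathcal{R}_k;\leq_{CA})$, of $(\mathcal{A}_k;\leq_{CA})$, and of $(\mathcal{F}_{\mathcal{T}_k};\leq_h)$ are pairwise isomorphic.
   Context: $X^\omega$ is the set of infinite words over $X$ with the Cantor (product) topology; $\bar k=\{0,\dots,k-1\}$. A $k$-partition of $X^\omega$ is a function $L:X^\omega\to\bar k$; its components are $L^{ -1}(i)$, $i<k$. An automaton is $\mathcal{M}=(Q,f,in)$ with finite state set $Q$, transition function $f:Q\times X\to Q$ (extended to words as usual) and initial state $in$. For $\xi\in X^\omega$, $f_{\mathcal M}(\xi)$ is the set of states occurring infinitely often in the run $f(in,\xi\upharpoonright_n)$, $n<\omega$. A Muller acceptor $(\mathcal M,\mathcal F)$ recognises $\{\xi: f_{\mathcal M}(\xi)\in\mathcal F\}$; such sets are the regular $\omega$-languages. $\mathcal M$ is aperiodic if for all states $q$, nonempty words $u$ and $n>0$, $f(q,u^n)=q$ implies $f(q,u)=q$; an $\omega$-language is aperiodic if recognised by a Muller acceptor with aperiodic automaton. $\mathcal{R}_k$ (resp. $\mathcal{A}_k$) is the set of $k$-partitions of $X^\omega$ all of whose components are regular (resp. aperiodic). For $k$-partitions $A,B$, $A\leq_{CA}B$ iff $A=B\circ g$ for some continuous $g:X^\omega\to X^\omega$. For a preorder $Q$, a $Q$-forest is a finite nonempty poset in which every lower cone $\{y:y\le x\}$ is a chain, equipped with a labeling $c$ into $Q$; a $Q$-tree is a $Q$-forest with a least element. For $Q$-forests,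 $(P,c)\leq_h(P',c')$ iff there is a monotone map $\varphi:P\to P'$ with $c(x)\le c'(\varphi(x))$ for all $x\in P$. $\mathcal{T}_k$ is the set of $\bar k$-trees ($\bar k$ ordered as an antichain, i.e. labels must be equal) with $\le_h$; $\mathcal{F}_{\mathcal{T}_k}$ is the set of $\mathcal{T}_k$-forests (forests whose nodes are labeled by elements of $\mathcal{T}_k$, labels compared by $\le_h$), preordered by $\le_h$. -}

module Defs where

open import Data.Fin.Base using (Fin)
open import Data.Fin.Subset using (Subset; _∈_)
open import Data.List.Base using (List; []; foldl; applyUpTo; concat; replicate)
open import Data.Nat.Base using (ℕ; _≤_; _<_)
open import Data.Product.Base using (Σ-syntax; ∃-syntax; _×_; _,_; proj₁)
open import Data.Sum.Base using (_⊎_)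
open import Function.Base using (id; _∘_; _on_)
open import Function.Bundles using (_⇔_)
open import Level using (Level; 0ℓ; _⊔_) renaming (suc to lsuc)
open import Relation.Binary.Bundles using (Preorder; Poset)
open import Relation.Binary.Construct.Interior.Symmetric using (poset)
open import Relation.Binary.Core using (Rel; _Preserves_⟶_)
open import Relation.Binary.Definitions using (Reflexive; Transitive; Minimum)
open import Relation.Binary.Morphism.Structures using (IsOrderIsomorphism)
open import Relation.Binary.PropositionalEquality
  using (_≡_; _≢_; refl; trans)
open import Relation.Binary.PropositionalEquality.Properties
  using () renaming (preorder to ≡-preorder)
open import Relation.Binary.Structures using (IsPartialOrder)
open import Relation.Unary using (Pred)

private
  variable
    a b ℓ₁ ℓ₂ ℓ₃ ℓ₄ : Level
    X : Set
    k : ℕ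

-- The quotient-poset of a preorder (A; ≲) is represented by A with the
-- equivalence "x ≲ y and y ≲ x" as the equality of the poset. Functions
-- between quotients are functions respecting these equalities.
quotientPoset : {A : Set a} (_≲_ : Rel A ℓ₁) →
                Reflexive _≲_ → Transitive _≲_ → Poset a ℓ₁ ℓ₁
quotientPoset _≲_ ≲-refl ≲-trans = poset {R = _≲_} ≲-refl ≲-trans

infix 4 _≅_

_≅_ : Poset a ℓ₁ ℓ₂ → Poset b ℓ₃ ℓ₄ → Set (a ⊔ b ⊔ ℓ₁ ⊔ ℓ₂ ⊔ ℓ₃ ⊔ ℓ₄)
P ≅ Q = ∃[ f ] IsOrderIsomorphism P._≈_ Q._≈_ P._≤_ Q._≤_ f
  where
  module P = Poset P
  module Q = Poset Q

infix 9 _^ω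
infixl 8 _↾_

_^ω : Set → Set
X ^ω = ℕ → X

_↾_ : X ^ω → ℕ → List X
ξ ↾ n = applyUpTo ξ n

-- Continuity for the product topology, via the basic open sets of words
-- with a given prefix.
Continuous : (X ^ω → X ^ω) → Set
Continuous g = ∀ ξ n → ∃[ m ] (∀ η → η ↾ m ≡ ξ ↾ m → g η ↾ n ≡ g ξ ↾ n)

record Automaton (X : Set) : Set where
  field
    size : ℕ
    δ    : Fin size → X → Fin size
    init : Fin size

  State : Set
  State = Fin size

  δ* : State → List X → State
  δ* = foldl δ

  -- The set of states occurring infinitely often in the run on ξ.
  Inf : X ^ω → Pred State 0ℓ
  Inf ξ q = ∀ n → ∃[ m ] (n ≤ m × δ* init (ξ ↾ m) ≡ q)

  Aperiodic : Set
  Aperiodic = ∀ (q : State) (u : List X) (n : ℕ) → u ≢ [] → 0 < n →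
              δ* q (concat (replicate n u)) ≡ q → δ* q u ≡ q

record MullerAcceptor (X : Set) : Set₁ where
  field
    automaton : Automaton X

  open Automaton automaton public

  field
    𝓕 : Pred (Subset size) 0ℓ

  -- Inf ξ ∈ 𝓕, where Inf ξ is a predicate and 𝓕 is a set of elements of the
  -- type Subset size.
  Accepts : Pred (X ^ω) 0ℓ
  Accepts ξ = ∃[ S ] (𝓕 S × (∀ q → q ∈ S ⇔ Inf ξ q))

  Recognises : Pred (X ^ω) 0ℓ → Set
  Recognises L = ∀ ξ → L ξ ⇔ Accepts ξ

RegularLanguage : Pred (X ^ω) 0ℓ → Set₁
RegularLanguage {X} L =
  Σ[ M ∈ MullerAcceptor X ] MullerAcceptor.Recognises M L

AperiodicLanguage : Pred (X ^ω) 0ℓ → Set₁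
AperiodicLanguage {X} L =
  Σ[ M ∈ MullerAcceptor X ]
    (MullerAcceptor.Aperiodic M × MullerAcceptor.Recognises M L)

-- Partitions are arbitrary functions. Without excluded middle, functions with
-- non-clopen components cannot be constructed, so the classical theory of
-- this type needs excluded middle as an explicit hypothesis.
Partition : ℕ → Set → Set
Partition k X = X ^ω → Fin k

component : Partition k X → Fin k → Pred (X ^ω) 0ℓ
component L i ξ = L ξ ≡ i

infix 4 _≤CA_

_≤CA_ : Rel (Partition k X) 0ℓ
A ≤CA B = ∃[ g ] (Continuous g × (∀ ξ → A ξ ≡ B (g ξ)))

≤CA-refl : Reflexive (_≤CA_ {k} {X})
≤CA-refl = id , (λ ξ n → n , λ η eq → eq) , λ ξ → refl

≤CA-trans : Transitive (_≤CA_ {k} {X})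
≤CA-trans (g , g-cont , A≡Bg) (h , h-cont , B≡Ch) =
  h ∘ g
  , (λ ξ n → let m  , hm = h-cont (g ξ) n
                 m′ , gm = g-cont ξ m
             in  m′ , λ η eq → hm (g η) (gm η eq))
  , λ ξ → trans (A≡Bg ξ) (B≡Ch (g ξ))

RegularPartition : ℕ → Set → Set₁
RegularPartition k X =
  Σ[ L ∈ Partition k X ] (∀ i → RegularLanguage (component L i))

AperiodicPartition : ℕ → Set → Set₁
AperiodicPartition k X =
  Σ[ L ∈ Partition k X ] (∀ i → AperiodicLanguage (component L i))

𝓡 : ℕ → Set → Poset (lsuc 0ℓ) 0ℓ 0ℓ
𝓡 k X = quotientPoset {A = RegularPartition k X} (_≤CA_ on proj₁)
          ≤CA-refl
          (λ {A} {B} {C} → ≤CA-trans {k} {X} {proj₁ A} {proj₁ B} {proj₁ C})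

𝓐 : ℕ → Set → Poset (lsuc 0ℓ) 0ℓ 0ℓ
𝓐 k X = quotientPoset {A = AperiodicPartition k X} (_≤CA_ on proj₁)
          ≤CA-refl
          (λ {A} {B} {C} → ≤CA-trans {k} {X} {proj₁ A} {proj₁ B} {proj₁ C})

record Forest (A : Set a) : Set (a ⊔ lsuc 0ℓ) where
  field
    size           : ℕ
    nonEmpty       : 0 < size
    _⊑_            : Rel (Fin size) 0ℓ
    isPartialOrder : IsPartialOrder _≡_ _⊑_
    lowerConeChain : ∀ {x y z} → y ⊑ x → z ⊑ x → y ⊑ z ⊎ z ⊑ y
    label          : Fin size → A

record Tree (A : Set a) : Set (a ⊔ lsuc 0ℓ) where
  field
    forest : Forest A

  open Forest forest public

  field
    root      : Fin size
    rootLeast : Minimum _⊑_ root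

module Homomorphic (Q : Preorder a ℓ₁ ℓ₂) where

  private
    module Q = Preorder Q

  infix 4 _≤ₕ_

  _≤ₕ_ : Rel (Forest Q.Carrier) ℓ₂
  P ≤ₕ P′ = ∃[ φ ] (φ Preserves P._⊑_ ⟶ P′._⊑_
                   × (∀ x → P.label x Q.≲ P′.label (φ x)))
    where
    module P  = Forest P
    module P′ = Forest P′

  ≤ₕ-refl : Reflexive _≤ₕ_
  ≤ₕ-refl = id , id , λ x → Q.refl

  ≤ₕ-trans : Transitive _≤ₕ_
  ≤ₕ-trans (φ , φ-mono , c≤) (ψ , ψ-mono , c′≤) =
    ψ ∘ φ , ψ-mono ∘ φ-mono , λ x → Q.trans (c≤ x) (c′≤ (φ x))

  forestPoset : Poset (a ⊔ lsuc 0ℓ) ℓ₂ ℓ₂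
  forestPoset = quotientPoset _≤ₕ_
                  (λ {P} → ≤ₕ-refl {P})
                  (λ {P} {P′} {P″} → ≤ₕ-trans {P} {P′} {P″})

  treePoset : Poset (a ⊔ lsuc 0ℓ) ℓ₂ ℓ₂
  treePoset = quotientPoset (_≤ₕ_ on Tree.forest)
                (λ {T} → ≤ₕ-refl {Tree.forest T})
                (λ {T} {T′} {T″} →
                   ≤ₕ-trans {Tree.forest T} {Tree.forest T′} {Tree.forest T″})

open Homomorphic public using (forestPoset; treePoset)

-- The labels 0, …, k-1 form an antichain: their preorder is equality.
𝓣 : ℕ → Poset (lsuc 0ℓ) 0ℓ 0ℓ
𝓣 k = treePoset (≡-preorder (Fin k))

𝓕𝓣 : ℕ → Poset (lsuc 0ℓ) 0ℓ 0ℓ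
𝓕𝓣 k = forestPoset (Poset.preorder (𝓣 k))

{-# OPTIONS --safe #-}
module Submission where

-- Call a set of states a loop if it is the set of states visited infinitely
-- often by some run. For an automaton in which this set determines the value
-- of the partition, the maximal loops (the strongly connected components)
-- preordered by reachability, each labelled by the loops below it ordered by
-- reverse inclusion, form a two-level labelled preorder. Its unfolding into
-- increasing chains is a forest of trees, and a monotone map of forests is
-- the same as a simulation of preorders.
--
-- A continuous reduction gives a simulation: a loop D of the first automaton
-- is sent to the set of states which the image of a generic word staying in D
-- visits infinitely often, after a prefix chosen so that this set is least.
-- A simulation gives a reduction: whenever the run closes a loop, the loops
-- that do not contain it are popped from a stack, it is pushed, and the output
-- tours the loop simulating it. From some time on the set of states visited
-- infinitely often stays on the stack, and again and again it is at the top,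
-- so the output settles in the loop simulating this set. Finally, a forest is
-- realised by an aperiodic automaton that jumps between its nodes on commands
-- coded in unary, labelling a loop by the meet of the inner nodes it visits.

open import Defs
open import Axiom.ExcludedMiddle using (ExcludedMiddle)
open import Data.Fin.Base using (Fin; zero; suc; toℕ; combine; remQuot)
open import Data.Fin.Induction using (spo-wellFounded; spo-noetherian)
open import Data.Fin.Properties
  using (_≟_; toℕ<n; toℕ-injective; toℕ-fromℕ<; pigeonhole; remQuot-combine; combine-remQuot)
open import Data.Fin.Subset using (Subset; inside; outside; _∈_; _⊆_; _⊂_; ∣_∣)
open import Data.Fin.Subset.Induction using (⊂-wellFounded; ⊃-wellFounded)
open import Data.Fin.Subset.Properties
  using (⊆-antisym; ⊆-trans; ⊆-refl; ⊆-reflexive; ∣p∣≤n; p⊆q⇒∣p∣≤∣q∣; p⊂q⇒∣p∣<∣q∣)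
open import Data.List.Base
  using (List; []; _∷_; _++_; length; map; lookup; foldl; allFin; concat; concatMap; replicate)
open import Data.List.Membership.Propositional using () renaming (_∈_ to _∈ˡ_)
open import Data.List.Membership.Propositional.Properties
  using (∈-allFin; ∈-map⁺; ∈-++⁺ˡ; ∈-++⁺ʳ; ∈-concatMap⁺)
open import Data.List.NonEmpty.Base using (List⁺; _∷_; toList; head; tail; _⁺++_; _⁺++⁺_; _++⁺_)
open import Data.List.Properties using (foldl-++; ∷-injective)
open import Data.List.Relation.Unary.Any as Any using (here; there; index)
open import Data.List.Relation.Unary.Any.Properties using (lookup-index)
open import Data.Maybe.Base as Maybe using (Maybe; just; nothing)
open import Data.Maybe.Properties using (just-injective)
open import Data.Nat.Base using (ℕ; zero; suc; _+_; _*_; _∸_; _≤_; _<_; z≤n; s≤s; s≤s⁻¹)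
  renaming (_⊔_ to _⊔ⁿ_)
open import Data.Nat.DivMod using (_mod_; [m+kn]%n≡m%n; m<n⇒m%n≡m)
open import Data.Nat.Properties hiding (_≟_)
open import Data.Product.Base using (Σ; Σ-syntax; ∃; ∃-syntax; _×_; _,_; proj₁; proj₂)
open import Data.Sum.Base using (_⊎_; inj₁; inj₂; [_,_]′)
open import Data.Unit.Base using (⊤; tt)
open import Data.Vec.Base using ([]; _∷_; tabulate)
open import Data.Vec.Properties using (lookup⇒[]=; []=⇒lookup; lookup∘tabulate)
open import Function.Base using (id; _∘_; flip)
open import Function.Bundles using (_↔_; _⇔_; mk⇔; Equivalence; Inverse)
open import Induction.WellFounded using (Acc; acc; WellFounded)
open import Level using (Level; 0ℓ; _⊔_) renaming (suc to lsuc)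
open import Relation.Binary.Bundles using (Preorder; Poset)
import Relation.Binary.Construct.NonStrictToStrict as ToStrict
open import Relation.Binary.Core using (Rel)
open import Relation.Binary.PropositionalEquality
open import Relation.Binary.PropositionalEquality.Properties
  using () renaming (preorder to ≡-preorder)
open import Relation.Binary.Structures using (IsPartialOrder)
open import Relation.Nullary using (¬_; yes; no; does; contradiction)
open import Relation.Nullary.Decidable using (dec-true)
open import Relation.Unary using (Pred)

-- One loop may have several images under one and the same reduction, because its image depends on
-- the prefix read before it, so the correspondence between loops has to be relational. Unfolding
-- supplies the missing history: a node of a forest remembers the chain below it, and one image per
-- node can be fixed by recursion. The two levels of `𝓕𝓣` reflect two kinds of change. Inside a
-- strongly connected component a run may go back and forth between loops, so only inclusion matters
-- there; a component that has been left is never entered again, so components are ordered by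
-- reachability. Regular and aperiodic partitions are sent to forests by the same construction, and
-- their difference is absorbed by the realising automaton. Its counters saturate: a monotone map of
-- a finite chain has no proper cycles, which is what aperiodicity asks for, while unary codes let
-- two letters express any number of commands. The reduction built from a simulation only has to be
-- continuous, so the strategy behind it may consult the whole prefix read so far.

private
  variable
    α β γ ℓ ℓ₁ ℓ₂ ℓ₃ ℓ₄ ℓ₅ ℓ₆ : Level

-- Isomorphisms of quotient posets from order embeddings onto representatives

record Equivalence-of-orders (P : Poset α ℓ₁ ℓ₂) (Q : Poset β ℓ₃ ℓ₄) : Set (α ⊔ β ⊔ ℓ₂ ⊔ ℓ₄) where
  private
    module P = Poset P
    module Q = Poset Q
  field
    to     : P.Carrier → Q.Carrier
    mono   : ∀ {x y} → x P.≤ y → to x Q.≤ to y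
    cancel : ∀ {x y} → to x Q.≤ to y → x P.≤ y
    from   : Q.Carrier → P.Carrier
    to-from≤ : ∀ y → to (from y) Q.≤ y
    to-from≥ : ∀ y → y Q.≤ to (from y)

module _ {P : Poset α ℓ₁ ℓ₂} {Q : Poset β ℓ₃ ℓ₄} (E : Equivalence-of-orders P Q) where
  private
    module P = Poset P
    module Q = Poset Q
  open Equivalence-of-orders E

  equivalent⇒≅ : P ≅ Q
  equivalent⇒≅ = to , record
    { isOrderMonomorphism = record
      { isOrderHomomorphism = record { cong = to-cong ; mono = mono }
      ; injective = λ eq → P.antisym (cancel (Q.reflexive eq)) (cancel (Q.reflexive (Q.Eq.sym eq)))
      ; cancel = cancel
      }
    ; surjective = λ y → from y , λ eq → Q.Eq.trans (to-cong eq) (Q.antisym (to-from≤ y) (to-from≥ y))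
    }
    where
    to-cong : ∀ {x y} → x P.≈ y → to x Q.≈ to y
    to-cong eq = Q.antisym (mono (P.reflexive eq)) (mono (P.reflexive (P.Eq.sym eq)))

  module _ {R : Poset γ ℓ₅ ℓ₆} (F : Equivalence-of-orders R Q) where
    private
      module R = Poset R
      module F = Equivalence-of-orders F

    -- Elements are sent to `Q` and pulled back by the preimage choice of the other embedding;
    -- `F.cancel` and `cancel` turn every required inequality into one in `Q`. This compares regular
    -- with aperiodic partitions by way of the forests.
    through-common : Equivalence-of-orders P R
    through-common = record
      { to       = F.from ∘ to
      ; mono     = λ le → F.cancel (Q.trans (F.to-from≤ _) (Q.trans (mono le) (F.to-from≥ _)))
      ; cancel   = λ le → cancel (Q.trans (F.to-from≥ _) (Q.trans (F.mono le) (F.to-from≤ _)))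
      ; from     = from ∘ F.to
      ; to-from≤ = λ y → F.cancel (Q.trans (F.to-from≤ _) (to-from≤ _))
      ; to-from≥ = λ y → F.cancel (Q.trans (to-from≥ _) (F.to-from≥ _))
      }

module _ (em : ExcludedMiddle 0ℓ) where

  private
    variable
      A : Set
      X : Set
      k n : ℕ

  -- Excluded middle turns sets such as `Inf ξ` into finite data, which can be enumerated and which
  -- admit well-founded induction on inclusion.
  ⟦_⟧ : Pred (Fin n) 0ℓ → Subset n
  ⟦ P ⟧ = tabulate (λ q → does (em {P q}))

  ∈⟦⟧⁺ : {P : Pred (Fin n) 0ℓ} {q : Fin n} → P q → q ∈ ⟦ P ⟧
  ∈⟦⟧⁺ {P = P} {q} p = lookup⇒[]= q ⟦ P ⟧
    (trans (lookup∘tabulate (λ q → does (em {P q})) q) (dec-true em p))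

  ∈⟦⟧⁻ : {P : Pred (Fin n) 0ℓ} {q : Fin n} → q ∈ ⟦ P ⟧ → P q
  ∈⟦⟧⁻ {P = P} {q} q∈ with em {P q} in eq
  ... | yes p = p
  ... | no ¬p = contradiction
    (trans (sym ([]=⇒lookup q∈)) (trans (lookup∘tabulate (λ q → does (em {P q})) q) (cong does eq)))
    λ ()

  ¬∀⇒∃¬ : {A : Set} {P : A → Set} → ¬ (∀ x → P x) → ∃[ x ] ¬ P x
  ¬∀⇒∃¬ {P = P} ¬∀ with em {∃[ x ] ¬ P x}
  ... | yes w = w
  ... | no ¬w = contradiction (λ x → by x) ¬∀
    where
    by : ∀ x → P x
    by x with em {P x}
    ... | yes p = p
    ... | no ¬p = contradiction (x , ¬p) ¬w

  -- Simulations of labelled preorders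

  -- A preorder and not a partial order: the carriers below contain witnesses, such as a run that
  -- realises a loop, so distinct elements may be equivalent.
  record Labelled (A : Set α) : Set (lsuc 0ℓ ⊔ α) where
    field
      Carrier : Set
      _≼_     : Rel Carrier 0ℓ
      ≼-refl  : ∀ {x} → x ≼ x
      ≼-trans : ∀ {x y z} → x ≼ y → y ≼ z → x ≼ z
      label   : Carrier → A

  forestLabelled : {A : Set α} → Forest A → Labelled A
  forestLabelled P = record
    { Carrier = Fin P.size
    ; _≼_     = P._⊑_
    ; ≼-refl  = IsPartialOrder.refl P.isPartialOrder
    ; ≼-trans = IsPartialOrder.trans P.isPartialOrder
    ; label   = P.label
    }
    where module P = Forest P

  -- Words of bounded length as nodes of finite forests

  data Word (K : ℕ) : ℕ → Set where
    []  : Word K n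
    _∷_ : Fin K → Word K n → Word K (suc n)

  infixr 5 _∷_

  module _ {K : ℕ} where

    ∣Word∣ : ℕ → ℕ
    ∣Word∣ zero    = 1
    ∣Word∣ (suc n) = suc (K * ∣Word∣ n)

    encode : Word K n → Fin (∣Word∣ n)
    encode {zero}  []      = zero
    encode {suc n} []      = zero
    encode {suc n} (x ∷ w) = suc (combine x (encode w))

    decode  : Fin (∣Word∣ n) → Word K n
    decode× : Fin K × Fin (∣Word∣ n) → Word K (suc n)
    decode {zero}  _       = []
    decode {suc n} zero    = []
    decode {suc n} (suc i) = decode× {n} (remQuot {K} (∣Word∣ n) i)
    decode× (x , i) = x ∷ decode i

    decode-encode : (w : Word K n) → decode (encode w) ≡ w
    decode-encode {zero}  []      = refl
    decode-encode {suc n} []      = refl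
    decode-encode {suc n} (x ∷ w) =
      trans (cong (decode× {n}) (remQuot-combine x (encode w))) (cong (x ∷_) (decode-encode w))

    encode-decode : (i : Fin (∣Word∣ n)) → encode (decode {n} i) ≡ i
    encode-decode {zero}  zero    = refl
    encode-decode {suc n} zero    = refl
    encode-decode {suc n} (suc i) = cong suc
      (trans (cong (combine (proj₁ (remQuot {K} (∣Word∣ n) i))) (encode-decode {n} _))
             (combine-remQuot {K} (∣Word∣ n) i))

    data _⊑ʷ_ : Word K n → Word K n → Set where
      []  : {w : Word K n} → [] ⊑ʷ w
      _∷_ : ∀ x {v w : Word K n} → v ⊑ʷ w → (x ∷ v) ⊑ʷ (x ∷ w)

    ⊑ʷ-refl : {w : Word K n} → w ⊑ʷ w
    ⊑ʷ-refl {w = []}    = []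
    ⊑ʷ-refl {w = x ∷ w} = x ∷ ⊑ʷ-refl

    ⊑ʷ-trans : {u v w : Word K n} → u ⊑ʷ v → v ⊑ʷ w → u ⊑ʷ w
    ⊑ʷ-trans []      _        = []
    ⊑ʷ-trans (x ∷ p) (.x ∷ q) = x ∷ ⊑ʷ-trans p q

    ⊑ʷ-antisym : {v w : Word K n} → v ⊑ʷ w → w ⊑ʷ v → v ≡ w
    ⊑ʷ-antisym []      []       = refl
    ⊑ʷ-antisym (x ∷ p) (.x ∷ q) = cong (x ∷_) (⊑ʷ-antisym p q)

    ⊑ʷ-chain : {u v w : Word K n} → u ⊑ʷ w → v ⊑ʷ w → u ⊑ʷ v ⊎ v ⊑ʷ u
    ⊑ʷ-chain []      _        = inj₁ []
    ⊑ʷ-chain (x ∷ p) []       = inj₂ []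
    ⊑ʷ-chain (x ∷ p) (.x ∷ q) with ⊑ʷ-chain p q
    ... | inj₁ r = inj₁ (x ∷ r)
    ... | inj₂ r = inj₂ (x ∷ r)

    len : Word K n → ℕ
    len []      = 0
    len (x ∷ w) = suc (len w)

    snoc : (w : Word K n) → len w < n → Fin K → Word K n
    snoc {n = suc n} []      lt x = x ∷ []
    snoc {n = suc n} (y ∷ w) lt x = y ∷ snoc w (s≤s⁻¹ lt) x

    ⊑ʷ-snoc : (w : Word K n) (lt : len w < n) (x : Fin K) → w ⊑ʷ snoc w lt x
    ⊑ʷ-snoc {n = suc n} []      lt x = []
    ⊑ʷ-snoc {n = suc n} (y ∷ w) lt x = y ∷ ⊑ʷ-snoc w (s≤s⁻¹ lt) x

    len-snoc : (w : Word K n) (lt : len w < n) (x : Fin K) → len (snoc w lt x) ≡ suc (len w)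
    len-snoc {n = suc n} []      lt x = refl
    len-snoc {n = suc n} (y ∷ w) lt x = cong suc (len-snoc w (s≤s⁻¹ lt) x)

  module Node (s K : ℕ) where
    Node : Set
    Node = Fin s × Word K K

    numNodes : ℕ
    numNodes = s * ∣Word∣ {K} K

    fromNode : Node → Fin numNodes
    fromNode (i , w) = combine i (encode w)

    toNode : Fin numNodes → Node
    toNode j = let i , c = remQuot {s} (∣Word∣ {K} K) j in i , decode c

    toNode-fromNode : ∀ x → toNode (fromNode x) ≡ x
    toNode-fromNode (i , w) =
      trans (cong (λ (i , c) → i , decode c) (remQuot-combine i (encode w)))
            (cong (i ,_) (decode-encode w))

    fromNode-toNode : ∀ j → fromNode (toNode j) ≡ j
    fromNode-toNode j =
      trans (cong (combine (proj₁ (remQuot {s} (∣Word∣ {K} K) j))) (encode-decode {n = K} _))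
            (combine-remQuot {s} (∣Word∣ {K} K) j)

    _⊑ᴺ_ : Node → Node → Set
    (i , v) ⊑ᴺ (j , w) = i ≡ j × v ⊑ʷ w

  -- Simulations, and the monotone maps they induce on forests

  module Simulation (Q : Preorder α ℓ 0ℓ) where

    private module Q = Preorder Q
    open Homomorphic Q using (_≤ₕ_)

    -- An image chosen for `x` never has to be revised on passing to a larger `x′`: `forth`
    -- continues from whichever related pair has been reached.
    record Sim (U V : Labelled Q.Carrier) : Set₁ where
      private
        module U = Labelled U
        module V = Labelled V
      field
        R       : U.Carrier → V.Carrier → Set
        total   : ∀ x → ∃[ y ] R x y
        forth   : ∀ {x y x′} → R x y → x U.≼ x′ → ∃[ y′ ] (y V.≼ y′ × R x′ y′)
        label-≲ : ∀ {x y} → R x y → U.label x Q.≲ V.label y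

    Sim-trans : ∀ {U V W} → Sim U V → Sim V W → Sim U W
    Sim-trans S T = record
      { R       = λ x z → ∃[ y ] (S.R x y × T.R y z)
      ; total   = λ x → let y , r = S.total x; z , t = T.total y in z , y , r , t
      ; forth   = λ (y , r , t) x≼ →
          let y′ , y≼ , r′ = S.forth r x≼
              z′ , z≼ , t′ = T.forth t y≼
          in z′ , z≼ , y′ , r′ , t′
      ; label-≲ = λ (y , r , t) → Q.trans (S.label-≲ r) (T.label-≲ t)
      }
      where
      module S = Sim S
      module T = Sim T

    hom⇒Sim : ∀ {P P′} → P ≤ₕ P′ → Sim (forestLabelled P) (forestLabelled P′)
    hom⇒Sim {P} {P′} (φ , mono , lab) = record
      { R       = λ x y → φ x ≡ y
      ; total   = λ x → φ x , refl
      ; forth   = λ { refl x≼ → _ , mono x≼ , refl }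
      ; label-≲ = λ { refl → lab _ }
      }

    module _ {P : Forest Q.Carrier} {V : Labelled Q.Carrier}
             (S : Sim (forestLabelled P) V) where

      private
        module P = Forest P
        module V = Labelled V
        module S = Sim S
        module PO = IsPartialOrder P.isPartialOrder

        _⊏_ : Fin P.size → Fin P.size → Set
        x ⊏ y = x P.⊑ y × x ≢ y

        ⊏-spo = ToStrict.<-isStrictPartialOrder _≡_ P._⊑_ P.isPartialOrder

        Pred-of : Fin P.size → Set
        Pred-of x = ∃[ y ] (y ⊏ x × (∀ z → z ⊏ x → z P.⊑ y))

        -- The elements strictly below `x` form a finite chain; climbing from `z` as long as
        -- something lies strictly between ends at the greatest of them.
        predecessor : ∀ {x} z → z ⊏ x → Pred-of x
        predecessor {x} z z⊏x = go z (spo-noetherian ⊏-spo z) z⊏x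
          where
          go : ∀ z → Acc (λ u v → v ⊏ u) z → z ⊏ x → Pred-of x
          go z (acc rs) z⊏x with em {∃[ y ] (z ⊏ y × y ⊏ x)}
          ... | yes (y , z⊏y , y⊏x) = go y (rs z⊏y) y⊏x
          ... | no none = z , z⊏x , below
            where
            below : ∀ w → w ⊏ x → w P.⊑ z
            below w w⊏x with P.lowerConeChain (proj₁ w⊏x) (proj₁ z⊏x)
            ... | inj₁ w⊑z = w⊑z
            ... | inj₂ z⊑w with em {z ≡ w}
            ... | yes refl = PO.refl
            ... | no z≢w = contradiction (w , (z⊑w , z≢w) , w⊏x) none

        -- The image of a node is carried over by `forth` from the image of its immediate
        -- predecessor, so that the choices made along each chain fit together; a minimal node takes
        -- its image from `total`.
        image : ∀ x → Acc _⊏_ x → ∃[ v ] S.R x v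
        image x (acc rs) with em {Pred-of x}
        ... | yes (y , y⊏x , _) = let v , _ , r = S.forth (proj₂ (image y (rs y⊏x))) (proj₁ y⊏x) in v , r
        ... | no _ = S.total x

        -- The recursion reaches `y` with an accessibility proof other than `wf y`; monotonicity
        -- compares the two values.
        image-irrelevant : ∀ x (p q : Acc _⊏_ x) → image x p ≡ image x q
        image-irrelevant x (acc rs) (acc rs′) with em {Pred-of x}
        ... | yes (y , y⊏x , _) =
          cong (λ vr → let v , _ , r = S.forth (proj₂ vr) (proj₁ y⊏x) in v , r)
               (image-irrelevant y (rs y⊏x) (rs′ y⊏x))
        ... | no _ = refl

        wf : WellFounded _⊏_
        wf = spo-wellFounded ⊏-spo

        φ : Fin P.size → V.Carrier
        φ x = proj₁ (image x (wf x))

        φ-mono-acc : ∀ {z} x (p : Acc _⊏_ x) → z P.⊑ x → φ z V.≼ proj₁ (image x p)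
        φ-mono-acc {z} x (acc rs) z⊑x with em {z ≡ x}
        ... | yes refl = subst (λ vr → φ z V.≼ proj₁ vr) (image-irrelevant z (wf z) (acc rs)) V.≼-refl
        ... | no z≢x with em {Pred-of x}
        ... | no none = contradiction (predecessor z (z⊑x , z≢x)) none
        ... | yes (y , y⊏x , max) =
          V.≼-trans (φ-mono-acc y (rs y⊏x) (max z (z⊑x , z≢x)))
                    (proj₁ (proj₂ (S.forth (proj₂ (image y (rs y⊏x))) (proj₁ y⊏x))))

      Sim⇒map : ∃[ f ] ((∀ {x y} → x P.⊑ y → f x V.≼ f y) × (∀ x → P.label x Q.≲ V.label (f x)))
      Sim⇒map = φ , (λ {x} {y} x⊑y → φ-mono-acc y (wf y) x⊑y)
                  , (λ x → S.label-≲ (proj₂ (image x (wf x))))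

    Sim⇒hom : ∀ {P P′} → Sim (forestLabelled P) (forestLabelled P′) → P ≤ₕ P′
    Sim⇒hom {P} S = Sim⇒map {P} S

    -- Unfolding a labelled preorder into a forest

    module Unfold (V : Labelled Q.Carrier)
                  (label-resp : ∀ {x y} → Labelled._≼_ V x y → Labelled._≼_ V y x →
                                Labelled.label V x Q.≲ Labelled.label V y)
                  (K : ℕ) (e : Fin K → Labelled.Carrier V)
                  (e-onto : ∀ v → ∃[ i ] (Labelled._≼_ V (e i) v × Labelled._≼_ V v (e i)))
                  (s : ℕ) (start : Fin s → Labelled.Carrier V) (0<s : 0 < s)
                  (start-least : ∀ v → ∃[ i ] Labelled._≼_ V (start i) v) where

      private module V = Labelled V
      open Node s K

      -- Letters that do not lead upwards are ignored, so all words are nodes.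
      eff : ∀ {n} → V.Carrier → Word K n → V.Carrier
      eff v []      = v
      eff v (x ∷ w) with em {v V.≼ e x}
      ... | yes _ = eff (e x) w
      ... | no  _ = eff v w

      eff-inc : ∀ {n} v (w : Word K n) → v V.≼ eff v w
      eff-inc v []      = V.≼-refl
      eff-inc v (x ∷ w) with em {v V.≼ e x}
      ... | yes p = V.≼-trans p (eff-inc (e x) w)
      ... | no  _ = eff-inc v w

      eff-mono : ∀ {n} v {w w′ : Word K n} → w ⊑ʷ w′ → eff v w V.≼ eff v w′
      eff-mono v {w′ = w′} [] = eff-inc v w′
      eff-mono v (x ∷ p) with em {v V.≼ e x}
      ... | yes _ = eff-mono (e x) p
      ... | no  _ = eff-mono v p

      eff-snoc : ∀ {n} v (w : Word K n) (lt : len w < n) x → eff v w V.≼ e x →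
                 eff v (snoc w lt x) ≡ e x
      eff-snoc {suc n} v []      lt x up with em {v V.≼ e x}
      ... | yes _ = refl
      ... | no ¬p = contradiction up ¬p
      eff-snoc {suc n} v (y ∷ w) lt x up with em {v V.≼ e y}
      ... | yes _ = eff-snoc (e y) w (s≤s⁻¹ lt) x up
      ... | no  _ = eff-snoc v w (s≤s⁻¹ lt) x up

      effN : Node → V.Carrier
      effN (i , w) = eff (start i) w

      unfoldedForest : Forest Q.Carrier
      unfoldedForest = record
        { size           = numNodes
        ; nonEmpty       = *-mono-< 0<s (∣Word∣>0 K)
        ; _⊑_            = λ x y → toNode x ⊑ᴺ toNode y
        ; isPartialOrder = record
          { isPreorder = record
            { isEquivalence = isEquivalence
            ; reflexive = λ { refl → refl , ⊑ʷ-refl }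
            ; trans = λ (p , q) (p′ , q′) → trans p p′ , ⊑ʷ-trans q q′
            }
          ; antisym = λ {x} {y} (p , q) (p′ , q′) →
              trans (sym (fromNode-toNode x))
                (trans (cong fromNode (cong₂ _,_ p (⊑ʷ-antisym q q′))) (fromNode-toNode y))
          }
        ; lowerConeChain = λ (p , q) (p′ , q′) → chain (p , q) (p′ , q′)
        ; label          = V.label ∘ effN ∘ toNode
        }
        where
        ∣Word∣>0 : ∀ n → 0 < ∣Word∣ {K} n
        ∣Word∣>0 zero    = s≤s z≤n
        ∣Word∣>0 (suc n) = s≤s z≤n
        chain : ∀ {x y z} → y ⊑ᴺ x → z ⊑ᴺ x → y ⊑ᴺ z ⊎ z ⊑ᴺ y
        chain (p , q) (p′ , q′) with ⊑ʷ-chain q q′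
        ... | inj₁ r = inj₁ (trans p (sym p′) , r)
        ... | inj₂ r = inj₂ (trans p′ (sym p) , r)

      unfolded⇒ : Sim (forestLabelled unfoldedForest) V
      unfolded⇒ = record
        { R       = λ x v → effN (toNode x) ≡ v
        ; total   = λ x → _ , refl
        ; forth   = λ { {x} {_} {y} refl x⊑y → _ , effN-mono {toNode x} {toNode y} x⊑y , refl }
        ; label-≲ = λ { refl → Q.refl }
        }
        where
        effN-mono : ∀ {x y} → x ⊑ᴺ y → effN x V.≼ effN y
        effN-mono (refl , q) = eff-mono _ q

      private
        up : V.Carrier → Subset K
        up v = ⟦ (λ i → v V.≼ e i) ⟧

        rank : V.Carrier → ℕ
        rank v = ∣ up v ∣

        rank-< : ∀ {v v′} → v V.≼ v′ → ¬ v′ V.≼ v → rank v′ < rank v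
        rank-< {v} {v′} v≼v′ v′⋠v =
          -- The representative of `v` itself is above `v` but not above `v′`, so the inclusion of
          -- the upper sets is proper.
          let i , ei≼v , v≼ei = e-onto v
          in p⊂q⇒∣p∣<∣q∣ {p = up v′} {q = up v}
               ( (λ q∈ → ∈⟦⟧⁺ {P = λ i → v V.≼ e i} (V.≼-trans v≼v′ (∈⟦⟧⁻ {P = λ i → v′ V.≼ e i} q∈)))
               , i , ∈⟦⟧⁺ {P = λ i → v V.≼ e i} v≼ei
               , λ i∈ → v′⋠v (V.≼-trans (∈⟦⟧⁻ {P = λ i → v′ V.≼ e i} i∈) ei≼v) )

        -- `rank v` bounds the number of strict steps still possible above `v`. Together with the
        -- letters already used it never exceeds `K`, which is why words of length at most `K`
        -- suffice.
        record Rel⇐ (v : V.Carrier) (x : Node) : Set where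
          constructor rel
          field
            below  : v V.≼ effN x
            above  : effN x V.≼ v
            budget : rank v + len (proj₂ x) ≤ K

        -- A step to an equivalent element keeps the node. Only a strict step appends a letter, and
        -- the drop in `rank` pays for it.
        forth⇐ : ∀ {v x v′} → Rel⇐ v x → v V.≼ v′ → ∃[ y ] (x ⊑ᴺ y × Rel⇐ v′ y)
        forth⇐ {v} {x@(i , w)} {v′} (rel v≼x x≼v bud) v≼v′ with em {v′ V.≼ v}
        ... | yes v′≼v = x , (refl , ⊑ʷ-refl) , rel (V.≼-trans v′≼v v≼x) (V.≼-trans x≼v v≼v′)
                (≤-trans (+-monoˡ-≤ (len w) (p⊆q⇒∣p∣≤ v≼v′)) bud)
          where
          p⊆q⇒∣p∣≤ : ∀ {v v′} → v V.≼ v′ → rank v′ ≤ rank v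
          p⊆q⇒∣p∣≤ {v} {v′} le =
              p⊆q⇒∣p∣≤∣q∣ (λ q∈ → ∈⟦⟧⁺ {P = λ i → v V.≼ e i} (V.≼-trans le (∈⟦⟧⁻ {P = λ i → v′ V.≼ e i} q∈)))
        ... | no v′⋠v =
          let j , ej≼v′ , v′≼ej = e-onto v′
              up′ = V.≼-trans x≼v (V.≼-trans v≼v′ v′≼ej)
              eq  = eff-snoc (start i) w lt j up′
          in (i , snoc w lt j) , (refl , ⊑ʷ-snoc w lt j)
             , rel (subst (v′ V.≼_) (sym eq) v′≼ej) (subst (V._≼ v′) (sym eq) ej≼v′)
                   (subst (λ l → rank v′ + l ≤ K) (sym (len-snoc w lt j))
                     (≤-trans (≤-reflexive (+-suc (rank v′) (len w))) bud′))
          where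
          bud′ : suc (rank v′) + len w ≤ K
          bud′ = ≤-trans (+-monoˡ-≤ (len w) (rank-< v≼v′ v′⋠v)) bud
          lt : len w < K
          lt = ≤-trans (s≤s (m≤n+m (len w) (rank v′))) bud′

        encodeR : ∀ {v x} → Rel⇐ v x → Rel⇐ v (toNode (fromNode x))
        encodeR {v} {x} r = subst (Rel⇐ v) (sym (toNode-fromNode x)) r

      unfolded⇐ : Sim V (forestLabelled unfoldedForest)
      unfolded⇐ = record
        { R       = λ v x → Rel⇐ v (toNode x)
        ; total   = λ v →
            let i , si≼v = start-least v
                y , _ , r = forth⇐ {x = i , []}
                              (rel V.≼-refl V.≼-refl
                                (≤-trans (≤-reflexive (+-identityʳ _)) (∣p∣≤n (up (start i))))) si≼v
            in fromNode y , encodeR r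
        ; forth   = λ {_} {x} r v≼ →
            let y , x⊑y , r′ = forth⇐ r v≼
            in fromNode y , subst (toNode x ⊑ᴺ_) (sym (toNode-fromNode y)) x⊑y , encodeR r′
        ; label-≲ = λ r → label-resp (Rel⇐.below r) (Rel⇐.above r)
        }

    module UnfoldTree (V : Labelled Q.Carrier)
                      (label-resp : ∀ {x y} → Labelled._≼_ V x y → Labelled._≼_ V y x →
                                    Labelled.label V x Q.≲ Labelled.label V y)
                      (K : ℕ) (e : Fin K → Labelled.Carrier V)
                      (e-onto : ∀ v → ∃[ i ] (Labelled._≼_ V (e i) v × Labelled._≼_ V v (e i)))
                      (v₀ : Labelled.Carrier V) (least : ∀ v → Labelled._≼_ V v₀ v) where

      open Unfold V label-resp K e e-onto 1 (λ _ → v₀) (s≤s z≤n) (λ v → zero , least v) public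
      open Node 1 K

      unfoldedTree : Tree Q.Carrier
      unfoldedTree = record
        { forest    = unfoldedForest
        ; root      = fromNode (zero , [])
        ; rootLeast = λ x → subst (_⊑ᴺ toNode x) (sym (toNode-fromNode (zero , []))) (least′ (toNode x))
        }
        where
        least′ : ∀ x → (zero , []) ⊑ᴺ x
        least′ (zero , w) = refl , []

  toList-++⁺ : ∀ (u : List A) w → toList (u ++⁺ w) ≡ u ++ toList w
  toList-++⁺ []      w = refl
  toList-++⁺ (x ∷ u) w = cong (x ∷_) (toList-++⁺ u w)

  -- Agreement of infinite words on a prefix

  Ag : ℕ → A ^ω → A ^ω → Set
  Ag n ξ η = ∀ i → i < n → ξ i ≡ η i

  Ag-refl : ∀ {n} {ξ : A ^ω} → Ag n ξ ξ
  Ag-refl i _ = refl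

  Ag-trans : ∀ {n} {ξ η ζ : A ^ω} → Ag n ξ η → Ag n η ζ → Ag n ξ ζ
  Ag-trans p q i lt = trans (p i lt) (q i lt)

  Ag-≤ : ∀ {m n} {ξ η : A ^ω} → m ≤ n → Ag n ξ η → Ag m ξ η
  Ag-≤ m≤n p i lt = p i (<-≤-trans lt m≤n)

  Ag⇒↾ : ∀ n {ξ η : A ^ω} → Ag n ξ η → ξ ↾ n ≡ η ↾ n
  Ag⇒↾ zero    p = refl
  Ag⇒↾ (suc n) p = cong₂ _∷_ (p 0 (s≤s z≤n)) (Ag⇒↾ n (λ i lt → p (suc i) (s≤s lt)))

  ↾⇒Ag : ∀ n {ξ η : A ^ω} → ξ ↾ n ≡ η ↾ n → Ag n ξ η
  ↾⇒Ag (suc n) eq zero    lt       = proj₁ (∷-injective eq)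
  ↾⇒Ag (suc n) eq (suc i) (s≤s lt) = ↾⇒Ag n (proj₂ (∷-injective eq)) i lt

  ↾-+ : ∀ (ξ : A ^ω) i j → ξ ↾ (i + j) ≡ ξ ↾ i ++ (ξ ∘ (i +_)) ↾ j
  ↾-+ ξ zero    j = refl
  ↾-+ ξ (suc i) j = cong (ξ 0 ∷_) (↾-+ (ξ ∘ suc) i j)

  prepend : List A → A ^ω → A ^ω
  prepend []      ζ = ζ
  prepend (x ∷ u) ζ zero    = x
  prepend (x ∷ u) ζ (suc i) = prepend u ζ i

  prepend-↾ : ∀ (u : List A) ζ j → prepend u ζ ↾ (length u + j) ≡ u ++ ζ ↾ j
  prepend-↾ []      ζ j = refl
  prepend-↾ (x ∷ u) ζ j = cong (x ∷_) (prepend-↾ u ζ j)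

  -- The blocks are nonempty, so the first `n` letters depend only on `u` and the first `n` blocks;
  -- continuity of the constructed reduction comes from this.
  cat : List A → (ℕ → List⁺ A) → A ^ω
  cat (x ∷ u) W zero    = x
  cat (x ∷ u) W (suc i) = cat u W i
  cat []      W zero    = head (W 0)
  cat []      W (suc i) = cat (tail (W 0)) (W ∘ suc) i

  cat-Ag : ∀ n (u : List A) {W W′ : ℕ → List⁺ A} → Ag n W W′ → Ag n (cat u W) (cat u W′)
  cat-Ag (suc n) (x ∷ u) p zero    lt       = refl
  cat-Ag (suc n) (x ∷ u) p (suc i) (s≤s lt) = cat-Ag n u (Ag-≤ (n≤1+n n) p) i lt
  cat-Ag (suc n) []      p zero    lt       = cong head (p 0 (s≤s z≤n))
  cat-Ag (suc n) []      {W} {W′} p (suc i) (s≤s lt)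
    rewrite p 0 (s≤s z≤n) = cat-Ag n (tail (W′ 0)) (λ j lt → p (suc j) (s≤s lt)) i lt

  -- Values taken infinitely often

  IO : (ℕ → A) → A → Set
  IO s q = ∀ n → ∃[ m ] (n ≤ m × s m ≡ q)

  eventually-all : ∀ {n} {P : Fin n → ℕ → Set} → (∀ q → ∃[ T ] (∀ t → T ≤ t → P q t)) →
                   ∃[ T ] (∀ q t → T ≤ t → P q t)
  eventually-all {zero}  f = 0 , λ ()
  eventually-all {suc n} f =
    let T₀ , p₀ = f zero
        T₁ , p₁ = eventually-all (λ q → f (suc q))
    in T₀ ⊔ⁿ T₁ , λ { zero    t le → p₀ t (≤-trans (m≤m⊔n T₀ T₁) le)
                   ; (suc q) t le → p₁ q t (≤-trans (m≤n⊔m T₀ T₁) le) }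

  -- Each value taken only finitely often is avoided from some time on, and the maximum of these
  -- finitely many times works for all of them.
  eventually-IO : (s : ℕ → Fin n) → ∃[ T ] (∀ t → T ≤ t → IO s (s t))
  eventually-IO s =
    let T , p = eventually-all {P = λ q t → s t ≡ q → IO s q} by
    in T , λ t le → p (s t) t le refl
    where
    by : ∀ q → ∃[ T ] (∀ t → T ≤ t → s t ≡ q → IO s q)
    by q with em {IO s q}
    ... | yes io = 0 , λ _ _ _ → io
    ... | no ¬io =
      let N , ¬m = ¬∀⇒∃¬ ¬io
      in N , λ t le eq → contradiction (t , le , eq) ¬m

  -- Runs, visited states and loops of an automaton

  module Run {X : Set} (M : Automaton X) where
    open Automaton M public

    run : X ^ω → ℕ → State
    run ξ t = δ* init (ξ ↾ t)

    δ*-++ : ∀ q u v → δ* q (u ++ v) ≡ δ* (δ* q u) v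
    δ*-++ q u v = foldl-++ δ q u v

    run-Ag : ∀ {n ξ η} j → j ≤ n → Ag n ξ η → run ξ j ≡ run η j
    run-Ag j j≤n p = cong (δ* init) (Ag⇒↾ j (Ag-≤ j≤n p))

    run-+ : ∀ ξ i j → run ξ (i + j) ≡ δ* (run ξ i) ((ξ ∘ (i +_)) ↾ j)
    run-+ ξ i j = trans (cong (δ* init) (↾-+ ξ i j)) (δ*-++ init (ξ ↾ i) _)

    run-suc : ∀ ξ i → run ξ (suc i) ≡ δ (run ξ i) (ξ i)
    run-suc ξ i = trans (cong (run ξ) (+-comm 1 i))
      (trans (run-+ ξ i 1) (cong (λ j → δ (run ξ i) (ξ j)) (+-identityʳ i)))

    run-prepend : ∀ u ζ j → run (prepend u ζ) (length u + j) ≡ δ* (δ* init u) (ζ ↾ j)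
    run-prepend u ζ j = trans (cong (δ* init) (prepend-↾ u ζ j)) (δ*-++ init u _)

    -- The final state of the run on a word does not count as visited.
    data Visits : State → List X → State → Set where
      here  : ∀ {q x w} → Visits q (x ∷ w) q
      there : ∀ {q x w p} → Visits (δ q x) w p → Visits q (x ∷ w) p

    Visits-++ˡ : ∀ {q u} w {p} → Visits q u p → Visits q (u ++ w) p
    Visits-++ˡ w here      = here
    Visits-++ˡ w (there v) = there (Visits-++ˡ w v)

    Visits-++ʳ : ∀ {q} u {w p} → Visits (δ* q u) w p → Visits q (u ++ w) p
    Visits-++ʳ []      v = v
    Visits-++ʳ (x ∷ u) v = there (Visits-++ʳ u v)

    Visits-++⁻ : ∀ {q} u {w p} → Visits q (u ++ w) p → Visits q u p ⊎ Visits (δ* q u) w p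
    Visits-++⁻ []      v         = inj₂ v
    Visits-++⁻ (x ∷ u) here      = inj₁ here
    Visits-++⁻ (x ∷ u) (there v) with Visits-++⁻ u v
    ... | inj₁ v′ = inj₁ (there v′)
    ... | inj₂ v′ = inj₂ v′

    Visits-split : ∀ {q w p} → Visits q w p → ∃[ u ] ∃[ v ] (w ≡ u ++ v × δ* q u ≡ p)
    Visits-split {w = w} here = [] , w , refl , refl
    Visits-split (there {x = x} v) =
      let u , v′ , eq , eq′ = Visits-split v in x ∷ u , v′ , cong (x ∷_) eq , eq′

    Visits-↾⁺ : ∀ {q} (ζ : X ^ω) {l r} → r < l → Visits q (ζ ↾ l) (δ* q (ζ ↾ r))
    Visits-↾⁺ ζ {suc l} {zero}  lt       = here
    Visits-↾⁺ ζ {suc l} {suc r} (s≤s lt) = there (Visits-↾⁺ (ζ ∘ suc) lt)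

    Visits-↾⁻ : ∀ {q} (ζ : X ^ω) l {p} → Visits q (ζ ↾ l) p → ∃[ r ] (r < l × δ* q (ζ ↾ r) ≡ p)
    Visits-↾⁻ ζ (suc l) here      = 0 , s≤s z≤n , refl
    Visits-↾⁻ ζ (suc l) (there v) =
      let r , lt , eq = Visits-↾⁻ (ζ ∘ suc) l v in suc r , s≤s lt , eq

    cat-all : (E : State → Set) → ∀ {p} u {W} {qs : ℕ → State} →
              δ* p u ≡ qs 0 → (∀ k → δ* (qs k) (toList (W k)) ≡ qs (suc k)) →
              (∀ {r} → Visits p u r → E r) → (∀ k {r} → Visits (qs k) (toList (W k)) r → E r) →
              ∀ j → E (δ* p (cat u W ↾ j))
    cat-all E (x ∷ u) st nx eu eW zero    = eu here
    cat-all E (x ∷ u) st nx eu eW (suc j) = cat-all E u st nx (eu ∘ there) eW j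
    cat-all E []      refl nx eu eW zero    = eW 0 here
    cat-all E []      {W} refl nx eu eW (suc j) =
      cat-all E (tail (W 0)) (nx 0) (nx ∘ suc) (λ v → eW 0 (there v)) (eW ∘ suc) j

    cat-eventually : (E : State → Set) → ∀ K {p} u {W} {qs : ℕ → State} →
              δ* p u ≡ qs 0 → (∀ k → δ* (qs k) (toList (W k)) ≡ qs (suc k)) →
              (∀ k → K ≤ k → ∀ {r} → Visits (qs k) (toList (W k)) r → E r) →
              ∃[ J ] (∀ j → J ≤ j → E (δ* p (cat u W ↾ j)))
    cat-eventually E K (x ∷ u) st nx eW =
      let J , f = cat-eventually E K u st nx eW in suc J , λ { (suc j) (s≤s le) → f j le }
    cat-eventually E zero [] st nx eW = 0 , λ j _ → cat-all E [] st nx (λ ()) (λ k → eW k z≤n) j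
    cat-eventually E (suc K) [] {W} refl nx eW =
      let J , f = cat-eventually E K (tail (W 0)) (nx 0) (nx ∘ suc) (λ k le → eW (suc k) (s≤s le))
      in suc J , λ { (suc j) (s≤s le) → f j le }

    cat-hits₀ : ∀ {p} u {W r} → Visits p u r → ∃[ j ] (δ* p (cat u W ↾ j) ≡ r)
    cat-hits₀ (x ∷ u) here      = 0 , refl
    cat-hits₀ (x ∷ u) (there v) = let j , eq = cat-hits₀ u v in suc j , eq

    cat-hits : ∀ k {p} u {W} {qs : ℕ → State} {r} →
              δ* p u ≡ qs 0 → (∀ k → δ* (qs k) (toList (W k)) ≡ qs (suc k)) →
              Visits (qs k) (toList (W k)) r → ∃[ j ] (k ≤ j × δ* p (cat u W ↾ j) ≡ r)
    cat-hits k (x ∷ u) st nx v =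
      let j , le , eq = cat-hits k u st nx v in suc j , m≤n⇒m≤1+n le , eq
    cat-hits zero [] refl nx here = 0 , z≤n , refl
    cat-hits zero [] {W} refl nx (there v) = let j , eq = cat-hits₀ (tail (W 0)) v in suc j , z≤n , eq
    cat-hits (suc k) [] {W} refl nx v =
      let j , le , eq = cat-hits k (tail (W 0)) (nx 0) (nx ∘ suc) v in suc j , s≤s le , eq

    IO-⊆ : ∀ {s : ℕ → State} {E : State → Set} {T} → (∀ t → T ≤ t → E (s t)) → ∀ {q} → IO s q → E q
    IO-⊆ {E = E} {T} f io = let m , le , eq = io T in subst E eq (f m le)

    -- The criterion by which concatenated runs are evaluated: eventual confinement to `E` gives one
    -- inclusion, full tours of `E` in blocks of arbitrarily large index give the other.
    cat-Inf : (E : State → Set) → ∀ K u {W} {qs : ℕ → State} →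
              δ* init u ≡ qs 0 → (∀ k → δ* (qs k) (toList (W k)) ≡ qs (suc k)) →
              (∀ k → K ≤ k → ∀ {r} → Visits (qs k) (toList (W k)) r → E r) →
              (∀ K → ∃[ k ] (K ≤ k × (∀ {r} → E r → Visits (qs k) (toList (W k)) r))) →
              ∀ {q} → E q ⇔ Inf (cat u W) q
    cat-Inf E K u {W} st nx within often {q} = mk⇔
      (λ e N → let k , le , f = often N
                   j , k≤j , eq = cat-hits k u st nx (f e)
               in j , ≤-trans le k≤j , eq)
      (IO-⊆ {s = run (cat u W)} {E} (proj₂ (cat-eventually E K u st nx within)))

    -- The sets of states visited infinitely often

    Loop : Subset size → Set
    Loop D = Σ[ ξ ∈ X ^ω ] (∀ {q} → q ∈ D ⇔ Inf ξ q)

    Loop-resp : ∀ {D D′} → D ⊆ D′ → D′ ⊆ D → Loop D → Loop D′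
    Loop-resp p q (ξ , f) =
      ξ , mk⇔ (λ x → Equivalence.to f (q x)) (λ x → p (Equivalence.from f x))

    Inf-Loop : ∀ ξ → Loop ⟦ Inf ξ ⟧
    Inf-Loop ξ = ξ , mk⇔ ∈⟦⟧⁻ ∈⟦⟧⁺

    loop-enter : ∀ {D} ((ξ , _) : Loop D) → ∃[ T ] (∀ t → T ≤ t → run ξ t ∈ D)
    loop-enter (ξ , f) = let T , p = eventually-IO (run ξ) in T , λ t le → Equivalence.from f (p t le)

    point : ∀ {D} → Loop D → ∃[ q ] (q ∈ D)
    point L = let T , f = loop-enter L in _ , f T ≤-refl

    loop-reachable : ∀ {D} → Loop D → ∀ {q} → q ∈ D → ∃[ u ] (δ* init u ≡ q)
    loop-reachable (ξ , f) q∈ = let m , _ , eq = Equivalence.to f q∈ 0 in ξ ↾ m , eq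

    record Path (D : Subset size) (p q : State) : Set where
      constructor path
      field
        word   : List⁺ X
        leads  : δ* p (toList word) ≡ q
        within : ∀ {r} → Visits p (toList word) r → r ∈ D
        covers : ∀ {r} → r ∈ D → Visits p (toList word) r

    -- The witnessing run stays in `D` from time `T` on. It is cut at a visit to `p` after `T` and
    -- followed until all of `D` has been seen and `q` is reached again.
    loop-path : ∀ {D} → Loop D → ∀ {p q} → p ∈ D → q ∈ D → Path D p q
    loop-path {D} L@(ξ , f) {p} {q} p∈ q∈ = build
      where
      T = proj₁ (loop-enter L)
      in-D = proj₂ (loop-enter L)
      i = proj₁ (Equivalence.to f p∈ T)
      T≤i = proj₁ (proj₂ (Equivalence.to f p∈ T))
      run-i : run ξ i ≡ p
      run-i = proj₂ (proj₂ (Equivalence.to f p∈ T))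
      ζ : X ^ω
      ζ = ξ ∘ (i +_)
      run-ζ : ∀ j → run ξ (i + j) ≡ δ* p (ζ ↾ j)
      run-ζ j = trans (run-+ ξ i j) (cong (λ s → δ* s (ζ ↾ j)) run-i)
      after : ∀ {r} B → r ∈ D → ∃[ j ] (B ≤ j × δ* p (ζ ↾ j) ≡ r)
      after B r∈ = let m , le , eq = Equivalence.to f r∈ (i + B)
                       i≤m = ≤-trans (m≤m+n i B) le
                   in m ∸ i , subst (_≤ m ∸ i) (m+n∸m≡n i B) (∸-monoˡ-≤ i le)
                    , trans (sym (run-ζ (m ∸ i))) (trans (cong (run ξ) (m+[n∸m]≡n i≤m)) eq)
      hit : ∀ r → ∃[ B ] (∀ t → B ≤ t → r ∈ D → Visits p (ζ ↾ t) r)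
      hit r with em {r ∈ D}
      ... | no r∉ = 0 , λ _ _ r∈ → contradiction r∈ r∉
      ... | yes r∈ = let j , _ , eq = after 0 r∈
                     in suc j , λ t le _ → subst (Visits p (ζ ↾ t)) eq (Visits-↾⁺ ζ le)
      build : Path D p q
      build with eventually-all hit
      -- A time of at least `suc B` makes the word nonempty even when `B` is zero.
      ... | B , all with after (suc B) q∈
      ... | suc j , le , eq = path (ζ 0 ∷ (ζ ∘ suc) ↾ j) eq
        (λ v → let r , lt , eq′ = Visits-↾⁻ ζ (suc j) v
               in subst (_∈ D) (trans (run-ζ r) eq′) (in-D (i + r) (≤-trans T≤i (m≤m+n i r))))
        (λ {r} r∈ → all r (suc j) (≤-trans (n≤1+n B) le) r∈)

    cycle-Loop : ∀ {u q} (w : List⁺ X) → δ* init u ≡ q → δ* q (toList w) ≡ q →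
                 Loop ⟦ Visits q (toList w) ⟧
    cycle-Loop {u} {q} w st cyc = cat u (λ _ → w) ,
        mk⇔ (λ x → Equivalence.to io (∈⟦⟧⁻ x)) (λ x → ∈⟦⟧⁺ (Equivalence.from io x))
      where
      io : ∀ {p} → Visits q (toList w) p ⇔ Inf (cat u (λ _ → w)) p
      io = cat-Inf (Visits q (toList w)) 0 u {λ _ → w} {λ _ → q} st (λ _ → cyc)
             (λ _ _ v → v) (λ K → K , ≤-refl , id)

    module _ {Z : State → Set} {z₀ : State} (Zz₀ : Z z₀) {u : List X} (reached : δ* init u ≡ z₀)
             (connected : ∀ {z z′} → Z z → Z z′ →
                ∃[ w ] (δ* z (toList w) ≡ z′ × (∀ {r} → Visits z (toList w) r → Z r))) where

      private
        tour : (rs : List State) → ∃[ w ] (δ* z₀ (toList w) ≡ z₀ × (∀ {r} → Visits z₀ (toList w) r → Z r)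
                                     × (∀ {r} → r ∈ˡ rs → Z r → Visits z₀ (toList w) r))
        tour [] = let w , eq , in-Z = connected Zz₀ Zz₀ in w , eq , in-Z , λ ()
        tour (r ∷ rs) with em {Z r} | tour rs
        ... | no ¬Zr | w , eq , in-Z , cov = w , eq , in-Z ,
          λ { (here refl) Zr → contradiction Zr ¬Zr ; (there m) Zr → cov m Zr }
        ... | yes Zr | w@(x ∷ xs) , eq , in-Z , cov with connected Zz₀ Zr | connected Zr Zz₀
        ... | w₁@(x₁ ∷ xs₁) , eq₁ , in₁ | w₂@(x₂ ∷ xs₂) , eq₂ , in₂ =
          x₁ ∷ xs₁ ++ (x₂ ∷ xs₂ ++ x ∷ xs)
          , trans (δ*-++ z₀ (x₁ ∷ xs₁) _)
              (trans (cong (λ s → δ* s (x₂ ∷ xs₂ ++ x ∷ xs)) eq₁)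
                (trans (δ*-++ r (x₂ ∷ xs₂) _) (trans (cong (λ s → δ* s (x ∷ xs)) eq₂) eq)))
          , (λ v → in-all (Visits-++⁻ (x₁ ∷ xs₁) v))
          , λ { (here refl) _ → Visits-++ʳ (x₁ ∷ xs₁) (subst (λ s → Visits s (x₂ ∷ xs₂ ++ x ∷ xs) _) (sym eq₁) here)
              ; (there m) Zr′ → Visits-++ʳ (x₁ ∷ xs₁) (subst (λ s → Visits s (x₂ ∷ xs₂ ++ x ∷ xs) _) (sym eq₁)
                  (Visits-++ʳ (x₂ ∷ xs₂) (subst (λ s → Visits s (x ∷ xs) _) (sym eq₂) (cov m Zr′)))) }
          where
          in-all : ∀ {p} → Visits z₀ (x₁ ∷ xs₁) p ⊎ Visits (δ* z₀ (x₁ ∷ xs₁)) (x₂ ∷ xs₂ ++ x ∷ xs) p → Z p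
          in-all (inj₁ v) = in₁ v
          in-all (inj₂ v) with Visits-++⁻ (x₂ ∷ xs₂) (subst (λ s → Visits s (x₂ ∷ xs₂ ++ x ∷ xs) _) eq₁ v)
          ... | inj₁ v′ = in₂ v′
          ... | inj₂ v′ = in-Z (subst (λ s → Visits s (x ∷ xs) _) eq₂ v′)

      -- One excursion from `z₀` and back for every state of `Z` gives a closed tour, which is
      -- repeated forever.
      connected-Loop : Loop ⟦ Z ⟧
      connected-Loop =
        let w , eq , in-Z , cov = tour (allFin size)
        in Loop-resp (λ x → ∈⟦⟧⁺ (in-Z (∈⟦⟧⁻ x))) (λ x → ∈⟦⟧⁺ (cov (∈-allFin _) (∈⟦⟧⁻ x)))
             (cycle-Loop {u} w reached eq)

    Reachable : State → State → Set
    Reachable p q = ∃[ w ] (δ* p w ≡ q)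

    Reachable-trans : ∀ {p q r} → Reachable p q → Reachable q r → Reachable p r
    Reachable-trans {p} (u , refl) (v , eq) = u ++ v , trans (δ*-++ p u v) eq

    Reachable-run : ∀ ξ {i j} → i ≤ j → Reachable (run ξ i) (run ξ j)
    Reachable-run ξ {i} {j} le =
      (ξ ∘ (i +_)) ↾ (j ∸ i) , trans (sym (run-+ ξ i (j ∸ i))) (cong (run ξ) (m+[n∸m]≡n le))

    loop-connected : ∀ {D} → Loop D → ∀ {p q} → p ∈ D → q ∈ D → Reachable p q
    loop-connected L p∈ q∈ = let open Path (loop-path L p∈ q∈) in toList word , leads

    _⟶_ : Subset size → Subset size → Set
    C ⟶ D = ∃[ p ] (p ∈ C × ∃[ q ] (q ∈ D × Reachable p q))

    ⟶-all : ∀ {C D} → Loop C → Loop D → C ⟶ D → ∀ {p q} → p ∈ C → q ∈ D → Reachable p q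
    ⟶-all LC LD (p′ , p′∈ , q′ , q′∈ , r) p∈ q∈ =
      Reachable-trans (loop-connected LC p∈ p′∈) (Reachable-trans r (loop-connected LD q′∈ q∈))

    ⟶-trans : ∀ {B C D} → Loop C → B ⟶ C → C ⟶ D → B ⟶ D
    ⟶-trans LC (p , p∈ , q , q∈ , r) (p′ , p′∈ , q′ , q′∈ , r′) =
      p , p∈ , q′ , q′∈ , Reachable-trans r (Reachable-trans (loop-connected LC q∈ p′∈) r′)

    ⟶-refl : ∀ {C} → Loop C → C ⟶ C
    ⟶-refl L = let q , q∈ = point L in q , q∈ , q , q∈ , [] , refl

    MaxLoop : Subset size → Set
    MaxLoop C = Loop C × (∀ D → Loop D → C ⊆ D → D ⊆ C)

    max-above : ∀ {D} → Loop D → ∃[ C ] (MaxLoop C × D ⊆ C)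
    max-above {D} L = go D (⊃-wellFounded D) L
      where
      go : ∀ D → Acc (flip _⊂_) D → Loop D → ∃[ C ] (MaxLoop C × D ⊆ C)
      go D (acc rs) L with em {∃[ D′ ] (Loop D′ × D ⊂ D′)}
      ... | yes (D′ , L′ , D⊂) = let C , mx , D′⊆ = go D′ (rs D⊂) L′ in C , mx , ⊆-trans (proj₁ D⊂) D′⊆
      ... | no none = D , (L , λ D′ L′ D⊆ {x} x∈ → by D′ L′ (λ {y} → D⊆ {y}) x x∈) , ⊆-refl
        where
        by : ∀ D′ → Loop D′ → D ⊆ D′ → ∀ x → x ∈ D′ → x ∈ D
        by D′ L′ D⊆ x x∈ with em {x ∈ D}
        ... | yes x∈D = x∈D
        ... | no x∉D = contradiction (D′ , L′ , (λ {y} → D⊆ {y}) , x , x∈ , x∉D) none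

    -- The strongly connected component `Z` of a state of `C` is itself a loop and contains both `C`
    -- and `D`; maximality makes both equal to it.
    max-antisym : ∀ {C D} → MaxLoop C → MaxLoop D → C ⟶ D → D ⟶ C → C ≡ D
    max-antisym {C} {D} (LC , maxC) (LD , maxD) C⟶D D⟶C =
      ⊆-antisym (⊆-trans C⊆Z (maxD _ LZ D⊆Z)) (⊆-trans D⊆Z (maxC _ LZ C⊆Z))
      where
      z₀ = proj₁ (point LC)
      z₀∈ = proj₂ (point LC)
      Z : State → Set
      Z z = Reachable z₀ z × Reachable z z₀
      between : ∀ {z z′ w} → Z z → Z z′ → δ* z w ≡ z′ → ∀ {r} → Visits z w r → Z r
      between {z} (r₁ , _) (_ , r₂) eq v with Visits-split v
      ... | u , v′ , refl , refl =
        Reachable-trans r₁ (u , refl) , Reachable-trans (v′ , trans (sym (δ*-++ z u v′)) eq) r₂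
      open Path (loop-path LC z₀∈ z₀∈)
      connected : ∀ {z z′} → Z z → Z z′ → ∃[ w ] (δ* z (toList w) ≡ z′ × (∀ {r} → Visits z (toList w) r → Z r))
      connected {z} {z′} Zz@(_ , a , eq) Zz′@((b , eq′) , _) =
        -- Passing through a closed path at `z₀` keeps the connecting word nonempty when `a` and `b`
        -- are both empty.
        a ++⁺ (word ⁺++ b) , e , between Zz Zz′ e
        where
        e : δ* z (toList (a ++⁺ (word ⁺++ b))) ≡ z′
        e = trans (cong (δ* z) (toList-++⁺ a (word ⁺++ b)))
              (trans (δ*-++ z a _) (trans (cong (λ s → δ* s (toList word ++ b)) eq)
                (trans (δ*-++ z₀ (toList word) b) (trans (cong (λ s → δ* s b) leads) eq′))))
      LZ : Loop ⟦ Z ⟧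
      LZ = connected-Loop {Z} {z₀} (([] , refl) , ([] , refl)) {proj₁ (loop-reachable LC z₀∈)}
             (proj₂ (loop-reachable LC z₀∈)) connected
      C⊆Z : C ⊆ ⟦ Z ⟧
      C⊆Z x∈ = ∈⟦⟧⁺ (loop-connected LC z₀∈ x∈ , loop-connected LC x∈ z₀∈)
      D⊆Z : D ⊆ ⟦ Z ⟧
      D⊆Z x∈ = ∈⟦⟧⁺ (⟶-all LC LD C⟶D z₀∈ x∈ , ⟶-all LD LC D⟶C x∈ z₀∈)

  subsets : ∀ n → List (Subset n)
  subsets zero    = [] ∷ []
  subsets (suc n) = map (inside ∷_) (subsets n) ++ map (outside ∷_) (subsets n)

  ∈-subsets : (D : Subset n) → D ∈ˡ subsets n
  ∈-subsets []            = here refl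
  ∈-subsets (inside ∷ D)  = ∈-++⁺ˡ (∈-map⁺ (inside ∷_) (∈-subsets D))
  ∈-subsets (outside ∷ D) = ∈-++⁺ʳ (map (inside ∷_) (subsets _)) (∈-map⁺ (outside ∷_) (∈-subsets D))

  module _ {A : Set} (B : A → Set) where

    filterΣ : List A → List (Σ A B)
    filterΣ []       = []
    filterΣ (x ∷ xs) with em {B x}
    ... | yes b = (x , b) ∷ filterΣ xs
    ... | no _  = filterΣ xs

    filterΣ-onto : ∀ {xs x} → x ∈ˡ xs → B x → ∃[ i ] (proj₁ (lookup (filterΣ xs) i) ≡ x)
    filterΣ-onto {y ∷ xs} m b with em {B y} | m
    ... | yes _ | here refl = zero , refl
    ... | no ¬b | here refl = contradiction b ¬b
    ... | no _  | there m′ = filterΣ-onto m′ b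
    ... | yes _ | there m′ = let i , eq = filterΣ-onto m′ b in suc i , eq

  -- The labelled orders attached to an automaton

  -- The working form of regularity: a single automaton serves all components, and the acceptance
  -- conditions are absorbed into the values of the partition.
  InfDetermines : Automaton X → Partition k X → Set
  InfDetermines M A = ∀ ξ η → (∀ q → Inf ξ q → Inf η q) → (∀ q → Inf η q → Inf ξ q) → A ξ ≡ A η
    where open Automaton M

  module _ {X : Set} {k : ℕ} where

    private
      module S₀ = Simulation (≡-preorder (Fin k))
      module S₁ = Simulation (Poset.preorder (𝓣 k))

    module Structure (M : Automaton X) (A : Partition k X) (det : InfDetermines M A) where
      open Run M

      loopLabel : ∀ {D} → Loop D → Fin k
      loopLabel L = A (proj₁ L)

      Inf-label : ∀ {D} (L : Loop D) {ξ} → (∀ {q} → q ∈ D ⇔ Inf ξ q) → loopLabel L ≡ A ξ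
      Inf-label (η , f) {ξ} g = det η ξ (λ q → Equivalence.to g ∘ Equivalence.from f)
                                        (λ q → Equivalence.to f ∘ Equivalence.from g)

      record Inner (C : Subset size) : Set where
        constructor inner
        field
          {set} : Subset size
          loop  : Loop set
          below : set ⊆ C

      record _⊇ⁱ_ {C} (x y : Inner C) : Set where
        constructor sup
        field
          contains : Inner.set y ⊆ Inner.set x

      Inn : Subset size → Labelled (Fin k)
      Inn C = record
        { Carrier = Inner C
        ; _≼_     = _⊇ⁱ_
        ; ≼-refl  = sup id
        ; ≼-trans = λ (sup p) (sup q) → sup (p ∘ q)
        ; label   = loopLabel ∘ Inner.loop
        }

      private
        enumInner : ∀ C → List (Σ[ D ∈ Subset size ] (Σ[ L ∈ Loop D ] (∀ q → q ∈ D → q ∈ C)))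
        enumInner C = filterΣ _ (subsets size)

        e : ∀ C → Fin (length (enumInner C)) → Inner C
        e C i = let D , L , sub = lookup (enumInner C) i in inner L (sub _)

        onto : ∀ {C} (x : Inner C) → ∃[ i ] (Inner.set (e C i) ≡ Inner.set x)
        onto (inner {D} L sub) = filterΣ-onto _ (∈-subsets D) (L , λ q → sub)

        onto≈ : ∀ {C} (x : Inner C) → ∃[ i ] (e C i ⊇ⁱ x × x ⊇ⁱ e C i)
        onto≈ x = let i , eq = onto x in i , sup (⊆-reflexive (sym eq)) , sup (⊆-reflexive eq)

        label-≡ : ∀ {C} {x y : Inner C} → x ⊇ⁱ y → y ⊇ⁱ x → loopLabel (Inner.loop x) ≡ loopLabel (Inner.loop y)
        label-≡ {_} {x} {y} (sup p) (sup q) = Inf-label (Inner.loop x)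
          (mk⇔ (Equivalence.to (proj₂ (Inner.loop y)) ∘ q) (p ∘ Equivalence.from (proj₂ (Inner.loop y))))

        module InnerTree {C} (L : Loop C) =
          S₀.UnfoldTree (Inn C) label-≡ _ (e C) onto≈ (inner L id) (λ x → sup (Inner.below x))

      abstract
        innerTree : ∀ {C} → Loop C → Tree (Fin k)
        innerTree = InnerTree.unfoldedTree

        innerTree⇒ : ∀ {C} (L : Loop C) → S₀.Sim (forestLabelled (Tree.forest (innerTree L))) (Inn C)
        innerTree⇒ = InnerTree.unfolded⇒

        innerTree⇐ : ∀ {C} (L : Loop C) → S₀.Sim (Inn C) (forestLabelled (Tree.forest (innerTree L)))
        innerTree⇐ = InnerTree.unfolded⇐

      record Outer : Set where
        constructor outer
        field
          {set} : Subset size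
          max   : MaxLoop set
        loop : Loop set
        loop = proj₁ max

      Out : Labelled (Tree (Fin k))
      Out = record
        { Carrier = Outer
        ; _≼_     = λ x y → Outer.set x ⟶ Outer.set y
        ; ≼-refl  = λ {x} → ⟶-refl (Outer.loop x)
        ; ≼-trans = λ {_} {y} → ⟶-trans (Outer.loop y)
        ; label   = innerTree ∘ Outer.loop
        }

      private
        enumOuter : List (∃ MaxLoop)
        enumOuter = filterΣ MaxLoop (subsets size)

        eᵒ : Fin (length enumOuter) → Outer
        eᵒ i = outer (proj₂ (lookup enumOuter i))

        ontoᵒ : ∀ x → ∃[ i ] (Outer.set (eᵒ i) ⟶ Outer.set x × Outer.set x ⟶ Outer.set (eᵒ i))
        ontoᵒ (outer {C} mx) =
          let i , eq = filterΣ-onto MaxLoop (∈-subsets C) mx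
              C⟶C = ⟶-refl (proj₁ mx)
          in i , subst (_⟶ C) (sym eq) C⟶C , subst (C ⟶_) (sym eq) C⟶C

        -- Different witnessing runs may give different trees, but both trees unfold the same
        -- `Inn C` and so simulate each other.
        same-set : ∀ {C D} (L : Loop C) (L′ : Loop D) → C ≡ D →
                   Preorder._≲_ (Poset.preorder (𝓣 k)) (innerTree L) (innerTree L′)
        same-set L L′ refl = S₀.Sim⇒hom {Tree.forest (innerTree L)} {Tree.forest (innerTree L′)}
                               (S₀.Sim-trans (innerTree⇒ L) (innerTree⇐ L′))

        label-≤ : ∀ {x y : Outer} → Outer.set x ⟶ Outer.set y → Outer.set y ⟶ Outer.set x →
                  Preorder._≲_ (Poset.preorder (𝓣 k)) (innerTree (Outer.loop x)) (innerTree (Outer.loop y))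
        label-≤ {x} {y} x⟶y y⟶x =
          same-set (Outer.loop x) (Outer.loop y) (max-antisym (Outer.max x) (Outer.max y) x⟶y y⟶x)

      module _ (x₀ : X) where
        private
          -- The states recurring on a constant word form a loop, and some maximal loop lies above
          -- it.
          0<K : 0 < length enumOuter
          0<K = let C , mx , _ = max-above (Inf-Loop (λ _ → x₀))
                    i , _ = ontoᵒ (outer mx)
                in positive i
            where
            positive : ∀ {m} → Fin m → 0 < m
            positive {suc m} _ = s≤s z≤n

          start-least : ∀ x → ∃[ i ] (Outer.set (eᵒ i) ⟶ Outer.set x)
          start-least x = let i , p , _ = ontoᵒ x in i , p

          -- Every enumerated maximal loop also serves as a start. This makes `start-least`
          -- immediate, and the additional trees do not affect the forest up to equivalence.
          module OuterForest =
            S₁.Unfold Out (λ {x} {y} → label-≤ {x} {y}) _ eᵒ ontoᵒ _ eᵒ 0<K start-least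

        abstract
          outerForest : Forest (Tree (Fin k))
          outerForest = OuterForest.unfoldedForest

          outerForest⇒ : S₁.Sim (forestLabelled outerForest) Out
          outerForest⇒ = OuterForest.unfolded⇒

          outerForest⇐ : S₁.Sim Out (forestLabelled outerForest)
          outerForest⇐ = OuterForest.unfolded⇐

  -- Product automata

  module _ {X : Set} where

    trivial : Automaton X
    trivial = record { size = 1 ; δ = λ _ _ → zero ; init = zero }

    InfFiner : Automaton X → Automaton X → Set
    InfFiner M N = ∀ ξ η → (∀ q → Automaton.Inf M ξ q → Automaton.Inf M η q) →
                           (∀ q → Automaton.Inf N ξ q → Automaton.Inf N η q)

    module _ (M N : Automaton X) where
      private
        module M = Run M
        module N = Run N

      _⊗_ : Automaton X
      _⊗_ = record
        { size = M.size * N.size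
        ; δ    = λ i x → step (remQuot N.size i) x
        ; init = combine M.init N.init
        }
        where
        step : M.State × N.State → X → Fin (M.size * N.size)
        step (p , q) x = combine (M.δ p x) (N.δ q x)

      private
        module P = Run _⊗_

        δ*-⊗ : ∀ p q u → P.δ* (combine p q) u ≡ combine (M.δ* p u) (N.δ* q u)
        δ*-⊗ p q []      = refl
        δ*-⊗ p q (x ∷ u) =
          trans (cong (λ (p , q) → P.δ* (combine (M.δ p x) (N.δ q x)) u) (remQuot-combine p q))
                (δ*-⊗ (M.δ p x) (N.δ q x) u)

        run-⊗ : ∀ ξ t → P.run ξ t ≡ combine (M.run ξ t) (N.run ξ t)
        run-⊗ ξ t = δ*-⊗ M.init N.init (ξ ↾ t)

        -- Once only recurrent product states occur, any further visit to `q` exhibits a recurrent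
        -- product state that projects to `q`.
        project : ∀ {m} (pr : M.State × N.State → Fin m) ξ {q} →
                  IO (λ t → pr (M.run ξ t , N.run ξ t)) q →
                  ∃[ i ] (P.Inf ξ i × pr (remQuot N.size i) ≡ q)
        project pr ξ io =
          let T , f = eventually-IO (P.run ξ)
              t , le , eq = io T
          in P.run ξ t , f t le
             , trans (cong pr (trans (cong (remQuot N.size) (run-⊗ ξ t)) (remQuot-combine (M.run ξ t) (N.run ξ t)))) eq

        unproject : ∀ {m} (pr : M.State × N.State → Fin m) ξ {i} → P.Inf ξ i →
                    IO (λ t → pr (M.run ξ t , N.run ξ t)) (pr (remQuot N.size i))
        unproject pr ξ io n =
          let t , le , eq = io n
          in t , le , cong pr (trans (sym (remQuot-combine (M.run ξ t) (N.run ξ t)))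
                                (cong (remQuot N.size) (trans (sym (run-⊗ ξ t)) eq)))

        finer : ∀ {m} (pr : M.State × N.State → Fin m) ξ η → (∀ q → P.Inf ξ q → P.Inf η q) →
                ∀ q → IO (λ t → pr (M.run ξ t , N.run ξ t)) q → IO (λ t → pr (M.run η t , N.run η t)) q
        finer pr ξ η sub q io =
          let i , inf , eq = project pr ξ io
          in subst (IO _) eq (unproject pr η (sub i inf))

      ⊗-finerˡ : InfFiner _⊗_ M
      ⊗-finerˡ = finer proj₁

      ⊗-finerʳ : InfFiner _⊗_ N
      ⊗-finerʳ = finer proj₂

    common : ∀ {j} (Ms : Fin j → Automaton X) → ∃[ M ] (∀ i → InfFiner M (Ms i))
    common {zero}  Ms = trivial , λ ()
    common {suc j} Ms =
      let M , f = common (Ms ∘ suc)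
      in _⊗_ (Ms zero) M , λ { zero → ⊗-finerˡ (Ms zero) M
                     ; (suc i) ξ η sub → f i ξ η (⊗-finerʳ (Ms zero) M ξ η sub) }

    -- The product determines the recurrent states of each acceptor, in particular of the one for
    -- the component of `ξ`. This acceptor accepts `ξ`, hence also `η`, so both words have the value
    -- `L ξ`.
    regular⇒InfDetermines : ∀ {k} (L : Partition k X) → (∀ i → RegularLanguage (component L i)) →
                            ∃[ M ] InfDetermines M L
    regular⇒InfDetermines L reg =
      let M , f = common (λ i → MullerAcceptor.automaton (proj₁ (reg i)))
      in M , λ ξ η sub sub′ →
        let open MullerAcceptor (proj₁ (reg (L ξ))) hiding (Inf)
            rec = proj₂ (reg (L ξ))
            S , F , inf = Equivalence.to (rec ξ) refl
            to = f (L ξ) ξ η sub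
            from = f (L ξ) η ξ sub′
        in sym (Equivalence.from (rec η)
             (S , F , λ q → mk⇔ (to q ∘ Equivalence.to (inf q)) (Equivalence.from (inf q) ∘ from q)))

  -- A round robin: the value `q` comes up at all times congruent to `toℕ q`. It serves every
  -- request infinitely often in the construction of a generic word.
  schedule : ∀ {n} → Fin n → Σ[ s ∈ (ℕ → Fin n) ] (∀ q N → ∃[ k ] (N ≤ k × s k ≡ q))
  schedule {suc n} _ = (λ k → k mod suc n) , λ q N →
    toℕ q + N * suc n
    , ≤-trans (m≤m*n N (suc n)) (m≤n+m (N * suc n) (toℕ q))
    , toℕ-injective (trans (toℕ-fromℕ< _)
        (trans ([m+kn]%n≡m%n (toℕ q) N (suc n)) (m<n⇒m%n≡m (toℕ<n q))))

  -- Continuous reductions induce simulations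

  module _ {X : Set} (M : Automaton X) where
    open Run M

    record Follow (D : Subset size) (p : State) : Set where
      field
        word  : X ^ω
        stays : ∀ j → δ* p (word ↾ j) ∈ D
        hits  : ∀ {q} → q ∈ D → ∀ N → ∃[ j ] (N ≤ j × δ* p (word ↾ j) ≡ q)

    follow : ∀ {D} → Loop D → ∀ {p} → p ∈ D → Follow D p
    follow {D} L@(ξ , f) {p} p∈ =
      let T , in-D = loop-enter L
          i , T≤i , run-i = Equivalence.to f p∈ T
          run-ζ : ∀ j → run ξ (i + j) ≡ δ* p ((ξ ∘ (i +_)) ↾ j)
          run-ζ = λ j → trans (run-+ ξ i j) (cong (λ s → δ* s ((ξ ∘ (i +_)) ↾ j)) run-i)
      in record
        { word  = ξ ∘ (i +_)
        ; stays = λ j → subst (_∈ D) (run-ζ j) (in-D (i + j) (≤-trans T≤i (m≤m+n i j)))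
        ; hits  = λ q∈ N →
            let m , le , eq = Equivalence.to f q∈ (i + N)
                i≤m = ≤-trans (m≤m+n i N) le
            in m ∸ i , subst (_≤ m ∸ i) (m+n∸m≡n i N) (∸-monoˡ-≤ i le)
               , trans (sym (run-ζ (m ∸ i))) (trans (cong (run ξ) (m+[n∸m]≡n i≤m)) eq)
        }

    Visits-prepend : ∀ {p} w ζ {j} → j < length w → Visits p w (δ* p (prepend w ζ ↾ j))
    Visits-prepend (x ∷ w) ζ {zero}  lt       = here
    Visits-prepend (x ∷ w) ζ {suc j} (s≤s lt) = there (Visits-prepend w ζ lt)

    splice : X ^ω → ℕ → X ^ω → X ^ω
    splice ξ t ζ = prepend (ξ ↾ t) ζ

    splice-Ag : ∀ ξ t ζ → Ag t ξ (splice ξ t ζ)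
    splice-Ag ξ (suc t) ζ zero    lt       = refl
    splice-Ag ξ (suc t) ζ (suc i) (s≤s lt) = splice-Ag (ξ ∘ suc) t ζ i lt

    run-splice : ∀ ξ t ζ j → run (splice ξ t ζ) (t + j) ≡ δ* (run ξ t) (ζ ↾ j)
    run-splice ξ t ζ j = trans (cong (λ l → run (splice ξ t ζ) (l + j)) (sym (length-↾ ξ t)))
                               (run-prepend (ξ ↾ t) ζ j)
      where
      length-↾ : ∀ ξ t → length (ξ ↾ t) ≡ t
      length-↾ ξ zero    = refl
      length-↾ ξ (suc t) = cong suc (length-↾ (ξ ∘ suc) t)

  module _ {X : Set} {k : ℕ} where

    private
      module S₀ = Simulation (≡-preorder (Fin k))
      module S₁ = Simulation (Poset.preorder (𝓣 k))

    module Reduction (M N : Automaton X) (A B : Partition k X)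
                     (detA : InfDetermines M A) (detB : InfDetermines N B)
                     (g : X ^ω → X ^ω) (g-cont : Continuous g) (A≡Bg : ∀ ξ → A ξ ≡ B (g ξ)) where

      private
        module M = Run M
        module N = Run N
        module SM = Structure M A detA
        module SN = Structure N B detB

        cont : ∀ ξ n → ∃[ m ] (∀ η → Ag m ξ η → Ag n (g ξ) (g η))
        cont ξ n = let m , f = g-cont ξ n
                   in m , λ η ag → ↾⇒Ag n (sym (f η (sym (Ag⇒↾ m ag))))

        Stay : Subset M.size → ℕ → X ^ω → Set
        Stay D t ξ = ∀ j → t ≤ j → M.run ξ j ∈ D

        -- Only the prefix of length t of ξ and the prefix of length m of g ξ
        -- are meant; the rest of ξ is one way to go on.
        record Point : Set where
          constructor pt
          field
            ξ : X ^ω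
            t m : ℕ
        open Point

        record Ext (P P′ : Point) : Set where
          constructor ext
          field
            agree : Ag (t P) (ξ P) (ξ P′)
            t≤    : t P ≤ t P′
            m≤    : m P ≤ m P′
        open Ext

        Ext-refl : ∀ {P} → Ext P P
        Ext-refl = ext Ag-refl ≤-refl ≤-refl

        Ext-trans : ∀ {P Q R} → Ext P Q → Ext Q R → Ext P R
        Ext-trans (ext a b c) (ext a′ b′ c′) = ext (Ag-trans a (Ag-≤ b a′)) (≤-trans b b′) (≤-trans c c′)

        -- The states that N can still visit while M stays in D. At a stable
        -- point this set cannot shrink any more, so each of its states can be
        -- visited again and again.
        Ev : Subset M.size → Point → N.State → Set
        Ev D P q = ∃[ η ] (Ag (t P) (ξ P) η × Stay D (t P) η × ∃[ j ] (m P ≤ j × N.run (g η) j ≡ q))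

        Stay-via : ∀ {D t P η} → Stay D t (ξ P) → Ag (Point.t P) (ξ P) η → Stay D (Point.t P) η → Stay D t η
        Stay-via {D} {_} {P} {η} st ag st′ j le with ≤-total j (Point.t P)
        ... | inj₁ j≤ = subst (_∈ D) (M.run-Ag j j≤ ag) (st j le)
        ... | inj₂ ≤j = st′ j ≤j

        Ev-mono : ∀ {D D′ P P′} → Ext P P′ → D′ ⊆ D → Stay D (t P) (ξ P′) → ∀ {q} → Ev D′ P′ q → Ev D P q
        Ev-mono {P′ = P′} E sub st (η , ag , st′ , j , le , eq) =
          η , Ag-trans (agree E) (Ag-≤ (t≤ E) ag)
          , Stay-via {P = P′} st ag (λ j le → sub (st′ j le)) , j , ≤-trans (m≤ E) le , eq

        Stable : Subset M.size → Point → Set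
        Stable D P = ∀ P′ → Ext P P′ → Stay D (t P) (ξ P′) → ∀ q → Ev D P q → Ev D P′ q

        Stay-≤ : ∀ {D t t′ ξ} → t ≤ t′ → Stay D t ξ → Stay D t′ ξ
        Stay-≤ le st j le′ = st j (≤-trans le le′)

        -- Every failure of stability yields an extension with a strictly smaller finite set
        -- `Ev D P`, so the search ends.
        stabilise : ∀ {D} P → Stay D (t P) (ξ P) →
                    ∃[ P′ ] (Ext P P′ × Stay D (t P) (ξ P′) × Stable D P′)
        stabilise {D} P st = go P st (⊂-wellFounded ⟦ Ev D P ⟧)
          where
          go : ∀ P → Stay D (t P) (ξ P) → Acc _⊂_ ⟦ Ev D P ⟧ →
               ∃[ P′ ] (Ext P P′ × Stay D (t P) (ξ P′) × Stable D P′)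
          go P st (acc rs) with em {∃[ P′ ] (Ext P P′ × Stay D (t P) (ξ P′) × ∃[ q ] (Ev D P q × ¬ Ev D P′ q))}
          ... | yes (P′ , E , st′ , q , ev , ¬ev) =
            let P″ , E′ , st″ , sta = go P′ (Stay-≤ (t≤ E) st′)
                  (rs ( (λ q∈ → ∈⟦⟧⁺ (Ev-mono E id st′ (∈⟦⟧⁻ q∈)))
                      , q , ∈⟦⟧⁺ ev , λ q∈ → ¬ev (∈⟦⟧⁻ q∈)))
            in P″ , Ext-trans E E′ , Stay-via {P = P′} st′ (agree E′) st″ , sta
          ... | no none = P , Ext-refl , st , by
            where
            by : Stable D P
            by P′ E st′ q ev with em {Ev D P′ q}
            ... | yes ev′ = ev′
            ... | no ¬ev = contradiction (P′ , E , st′ , q , ev , ¬ev) none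

        record Good (D : Subset M.size) (P : Point) : Set where
          field
            stay   : Stay D (t P) (ξ P)
            stable : Stable D P
            forced : ∀ η → Ag (t P) (ξ P) η → Ag (m P) (g (ξ P)) (g η)

        -- After stabilising, the prefix is lengthened by a modulus of continuity, which fixes the
        -- first `m` letters of the image. Stability survives because lengthening is itself an
        -- extension.
        prepare : ∀ {D} P → Stay D (t P) (ξ P) → ∃[ P′ ] (Ext P P′ × Stay D (t P) (ξ P′) × Good D P′)
        prepare {D} P st =
          let P₁ , E₁ , st₁ , sta = stabilise P st
              c , f = cont (ξ P₁) (m P₁)
              P₂ = pt (ξ P₁) (t P₁ ⊔ⁿ c) (m P₁)
              E₂ : Ext P₁ P₂
              E₂ = ext Ag-refl (m≤m⊔n _ c) ≤-refl
              st₁′ : Stay D (t P₁) (ξ P₁)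
              st₁′ = Stay-≤ (t≤ E₁) st₁
          in P₂ , Ext-trans E₁ E₂ , st₁ , record
               { stay = Stay-≤ (t≤ E₂) st₁′
               ; stable = λ P′ E st′ q ev →
                   sta P′ (Ext-trans E₂ E) (Stay-via {P = P₂} st₁′ (agree E) st′) q
                       (Ev-mono E₂ id st₁′ ev)
               ; forced = λ η ag → f η (Ag-≤ (m≤n⊔m (t P₁) c) ag)
               }

        module Generic {D P} (L : M.Loop D) (G : Good D P) where
          open Good G

          record Stage : Set where
            constructor stage
            field
              at    : Point
              from  : Ext P at
              stayᵖ : Stay D (t P) (ξ at)
          open Stage

          hitM : ∀ (s : Stage) q → ∃[ s′ ] (Ext (at s) (at s′) × t (at s) < t (at s′) ×
                   (q ∈ D → ∃[ j ] (t (at s) ≤ j × j < t (at s′) × M.run (ξ (at s′)) j ≡ q)))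
          hitM s@(stage (pt ξ′ t′ m′) E st) q with em {q ∈ D}
          -- The prefix grows even when there is nothing to visit, so that every letter is fixed at
          -- some stage.
          ... | no q∉ = stage (pt ξ′ (suc t′) m′) (Ext-trans E up) st , up , ≤-refl , λ q∈ → contradiction q∈ q∉
            where
            up : Ext (pt ξ′ t′ m′) (pt ξ′ (suc t′) m′)
            up = ext Ag-refl (n≤1+n t′) ≤-refl
          ... | yes q∈ =
            let open Follow (follow M L (st t′ (t≤ E)))
                j , _ , eq = hits q∈ 0
                η = splice M ξ′ t′ word
                ag = splice-Ag M ξ′ t′ word
                up : Ext (pt ξ′ t′ m′) (pt η (suc (t′ + j)) m′)
                up = ext ag (m≤n⇒m≤1+n (m≤m+n t′ j)) ≤-refl
                st′ : Stay D t′ η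
                st′ = λ i le → subst (λ i → M.run η i ∈ D) (m+[n∸m]≡n le)
                        (subst (_∈ D) (sym (run-splice M ξ′ t′ word (i ∸ t′))) (stays (i ∸ t′)))
            in stage (pt η (suc (t′ + j)) m′) (Ext-trans E up) (Stay-via {P = pt ξ′ t′ m′} st ag st′)
               , up , s≤s (m≤m+n t′ j)
               , λ _ → t′ + j , m≤m+n t′ j , ≤-refl , trans (run-splice M ξ′ t′ word j) eq

          -- Stability provides a continuation inside `D` whose image visits `q` at or beyond
          -- position `m`; continuity secures this visit by a finite prefix, whatever follows.
          hitN : ∀ (s : Stage) q → ∃[ s′ ] (Ext (at s) (at s′) × m (at s) < m (at s′) ×
                   (Ev D P q → ∃[ j ] (m (at s) ≤ j × (∀ η → Ag (t (at s′)) (ξ (at s′)) η → N.run (g η) j ≡ q))))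
          hitN s@(stage P′@(pt ξ′ t′ m′) E st) q with em {Ev D P q}
          ... | no ¬ev = stage (pt ξ′ t′ (suc m′)) (Ext-trans E up) st , up , ≤-refl , λ ev → contradiction ev ¬ev
            where
            up : Ext (pt ξ′ t′ m′) (pt ξ′ t′ (suc m′))
            up = ext Ag-refl ≤-refl (n≤1+n m′)
          ... | yes ev =
            let η , ag , st′ , j , le , eq = stable P′ E st q ev
                c , f = cont η j
                up : Ext P′ (pt η (t′ ⊔ⁿ c) (suc j))
                up = ext ag (m≤m⊔n t′ c) (m≤n⇒m≤1+n le)
            in stage (pt η (t′ ⊔ⁿ c) (suc j)) (Ext-trans E up) (Stay-via {P = P′} st ag st′)
               , up , s≤s le
               , λ _ → j , le , λ ζ ag′ → trans (sym (N.run-Ag j ≤-refl (f ζ (Ag-≤ (m≤n⊔m t′ c) ag′)))) eq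

          sM = proj₁ (schedule M.init)
          sN = proj₁ (schedule N.init)

          stages : ℕ → Stage
          stages zero    = stage P Ext-refl stay
          stages (suc i) = proj₁ (hitN (proj₁ (hitM (stages i) (sM i))) (sN i))

          P[_] : ℕ → Point
          P[ i ] = at (stages i)

          step-ext : ∀ i → Ext P[ i ] P[ suc i ]
          step-ext i = let s′ , E , _ = hitM (stages i) (sM i)
                           _ , E′ , _ = hitN s′ (sN i)
                       in Ext-trans E E′

          stages-ext : ∀ {i j} → i ≤ j → Ext P[ i ] P[ j ]
          stages-ext {i} {j} le with m≤n⇒m<n∨m≡n le
          ... | inj₂ refl = Ext-refl
          stages-ext {i} {suc j} le | inj₁ (s≤s lt) = Ext-trans (stages-ext lt) (step-ext j)

          t≥ : ∀ i → i ≤ t P[ i ]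
          t≥ zero    = z≤n
          t≥ (suc i) = let s′ , E , lt , _ = hitM (stages i) (sM i)
                           _ , E′ , _ = hitN s′ (sN i)
                       in ≤-trans (s≤s (t≥ i)) (≤-trans lt (t≤ E′))

          m≥ : ∀ i → i ≤ m P[ i ]
          m≥ zero    = z≤n
          m≥ (suc i) = let s′ , E , _ = hitM (stages i) (sM i)
                           _ , E′ , lt , _ = hitN s′ (sN i)
                       in ≤-trans (s≤s (m≥ i)) (≤-trans (s≤s (m≤ E)) lt)

          ξ* : X ^ω
          -- By `t≥`, the prefix fixed at stage `suc i` already includes letter `i`.
          ξ* i = ξ P[ suc i ] i

          ξ*-Ag : ∀ i → Ag (t P[ i ]) (ξ P[ i ]) ξ*
          ξ*-Ag i j lt with ≤-total i (suc j)
          ... | inj₁ le = agree (stages-ext le) j lt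
          ... | inj₂ le = sym (agree (stages-ext le) j (t≥ (suc j)))

          stay* : Stay D (t P) ξ*
          stay* j le = subst (_∈ D) (M.run-Ag j (t≥ j) (ξ*-Ag j)) (stayᵖ (stages j) j le)

          Inf-M : ∀ {q} → q ∈ D ⇔ M.Inf ξ* q
          Inf-M {q} = mk⇔
            (λ q∈ n →
              let i , n≤i , eq = proj₂ (schedule M.init) q n
                  s′ , E , _ , h = hitM (stages i) (sM i)
                  s″ , E′ , _ = hitN s′ (sN i)
                  j , le , lt , eq′ = h (subst (_∈ D) (sym eq) q∈)
              in j , ≤-trans n≤i (≤-trans (t≥ i) le)
                 , trans (sym (M.run-Ag j (<⇒≤ lt) (Ag-trans (agree E′) (Ag-≤ (t≤ E′) (ξ*-Ag (suc i))))))
                         (trans eq′ eq))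
            (M.IO-⊆ {M.run ξ*} {_∈ D} stay*)

          -- The scheduled visits give one inclusion. For the other, `ξ*` itself stays in `D` and
          -- thus witnesses that every state its image visits from position `m P` on belongs to
          -- `Ev D P`.
          Inf-N : ∀ {q} → q ∈ ⟦ Ev D P ⟧ ⇔ N.Inf (g ξ*) q
          Inf-N {q} = mk⇔
            (λ q∈ n →
              let i , n≤i , eq = proj₂ (schedule N.init) q n
                  s′ , E , _ = hitM (stages i) (sM i)
                  s″ , E′ , _ , h = hitN s′ (sN i)
                  j , le , f = h (subst (Ev D P) (sym eq) (∈⟦⟧⁻ q∈))
              in j , ≤-trans n≤i (≤-trans (m≥ i) (≤-trans (m≤ E) le))
                 , trans (f ξ* (ξ*-Ag (suc i))) eq)
            (N.IO-⊆ {N.run (g ξ*)} {_∈ ⟦ Ev D P ⟧} {m P}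
              (λ j le → ∈⟦⟧⁺ (ξ* , ξ*-Ag 0 , stay* , j , le , refl)))

          image : N.Loop ⟦ Ev D P ⟧
          image = g ξ* , Inf-N

          image-label : ∀ {E} → E ≡ ⟦ Ev D P ⟧ → (L′ : N.Loop E) → SM.loopLabel L ≡ SN.loopLabel L′
          image-label refl L′ = trans (SM.Inf-label L Inf-M) (trans (A≡Bg ξ*) (sym (SN.Inf-label L′ Inf-N)))

        advance : ∀ P w {D} → M.Loop D → M.δ* (M.run (ξ P) (t P)) w ∈ D →
                  ∃[ η ] (Ag (t P) (ξ P) η × Stay D (t P + length w) η ×
                    (∀ j → j < length w → M.Visits (M.run (ξ P) (t P)) w (M.run η (t P + j))))
        advance (pt ξ t m) w {D} L p∈ =
          η , splice-Ag M ξ t _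
             , (λ i le → subst (_∈ D) (run-at i le) (stays (i ∸ (t + length w))))
             , λ j lt → subst (M.Visits (M.run ξ t) w) (sym (run-splice M ξ t _ j)) (Visits-prepend M w word lt)
          where
          open Follow (follow M L p∈)
          η : X ^ω
          η = splice M ξ t (prepend w word)
          run-at : ∀ i → t + length w ≤ i →
                   M.δ* (M.δ* (M.run ξ t) w) (word ↾ (i ∸ (t + length w))) ≡ M.run η i
          run-at i le = let r = i ∸ (t + length w) in
            trans (trans (sym (M.δ*-++ (M.run ξ t) w _))
              (trans (cong (M.δ* (M.run ξ t)) (sym (prepend-↾ w word r)))
                (sym (run-splice M ξ t (prepend w word) (length w + r)))))
              (cong (M.run η) (trans (sym (+-assoc t (length w) r)) (m+[n∸m]≡n le)))

        module Descend {C D P} (LD : M.Loop D) (D⊆C : D ⊆ C) (G : Good C P)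
                       {q} (q∈ : q ∈ D) (π : M.Path C (M.run (ξ P) (t P)) q) where
          open M.Path π

          w : List X
          w = toList word

          Advanced : Set
          Advanced = ∃[ η ] (Ag (t P) (ξ P) η × Stay D (t P + length w) η ×
                       (∀ j → j < length w → M.Visits (M.run (ξ P) (t P)) w (M.run η (t P + j))))

          advanced : Advanced
          advanced = advance P w LD (subst (_∈ D) (sym leads) q∈)

          in-C : ((η , _) : Advanced) → Stay C (t P) η
          in-C (η , _ , st , vis) j le =
            [ (λ le′ → D⊆C (st j le′)) , early ]′ (≤-<-connex (t P + length w) j)
            where
            early : j < t P + length w → M.run η j ∈ C
            early lt = subst (λ i → M.run η i ∈ C) (m+[n∸m]≡n le)
              (within (vis (j ∸ t P)
                (+-cancelˡ-< (t P) _ _ (subst (_< t P + length w) (sym (m+[n∸m]≡n le)) lt))))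

          P₁ : Advanced → Point
          P₁ (η , _) = pt η (t P + length w) (m P)

          finish : (a : Advanced) → ∃[ P′ ] (Ext (P₁ a) P′ × Stay D (t P + length w) (ξ P′) × Good D P′) →
                   ∃[ P′ ] (Good D P′ × (∀ {q} → Ev D P′ q → Ev C P q))
          finish a@(_ , ag , _) (P′ , E , st′ , G′) =
            P′ , G′ , Ev-mono {P = P} (Ext-trans (ext ag (m≤m+n (t P) (length w)) ≤-refl) E) D⊆C
                        (Stay-via {P = P₁ a} (in-C a) (agree E) (λ j le → D⊆C (st′ j le)))

        abstract
          -- The new point is reached along a word that stays in `C`. Whatever the image can then
          -- visit while the run stays in `D` was already possible at `P` for a run staying in `C`.
          descend : ∀ {C D P} → M.Loop C → M.Loop D → D ⊆ C → Good C P →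
                    ∃[ P′ ] (Good D P′ × (∀ {q} → Ev D P′ q → Ev C P q))
          descend {C} {D} {P} LC LD D⊆C G = finish advanced (prepare (P₁ advanced) (proj₁ (proj₂ (proj₂ advanced))))
            where
            open Descend LD D⊆C G (proj₂ (M.point LD))
                (M.loop-path LC (Good.stay G (t P) ≤-refl) (D⊆C (proj₂ (M.point LD))))

        -- By `forced`, both images bring `N` to the same state at position `m P`, and the image of
        -- the extended word leads from there to position `m P′`.
        Ext-⟶ : ∀ {C D P P′} → Good C P → Good D P′ → Ext P P′ → ⟦ Ev C P ⟧ N.⟶ ⟦ Ev D P′ ⟧
        Ext-⟶ {C} {D} {P} {P′} G G′ E =
          visited P , now G , visited P′ , now G′
          , subst (λ s → N.Reachable s (visited P′))
              (sym (N.run-Ag {m P} {g (ξ P)} {g (ξ P′)} (m P) ≤-refl (Good.forced G (ξ P′) (agree E))))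
              (N.Reachable-run (g (ξ P′)) (m≤ E))
          where
          visited : Point → N.State
          visited P = N.run (g (ξ P)) (m P)
          now : ∀ {C P} → Good C P → visited P ∈ ⟦ Ev C P ⟧
          now {P = P} G = ∈⟦⟧⁺ (ξ P , Ag-refl , Good.stay G , m P , ≤-refl , refl)

        abstract
          leave : ∀ {C D P} → M.Loop C → M.Loop D → C M.⟶ D → Good C P →
                  ∃[ P′ ] (Good D P′ × ⟦ Ev C P ⟧ N.⟶ ⟦ Ev D P′ ⟧)
          leave {C} {D} {P} LC LD C⟶D G =
            let p , p∈ = M.point LD
                w , leads = M.⟶-all LC LD C⟶D (Good.stay G (t P) ≤-refl) p∈
                η , ag , st , _ = advance P w LD (subst (_∈ D) (sym leads) p∈)
                P₂ , E , _ , G′ = prepare (pt η (t P + length w) (m P)) st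
            in P₂ , G′ , Ext-⟶ G G′ (Ext-trans (ext ag (m≤m+n (t P) (length w)) ≤-refl) E)

        module _ {C W P} (LC : M.Loop C) (G : Good C P) (⊆W : ⟦ Ev C P ⟧ ⊆ W) where

          -- The point is quantified existentially: different good points for one loop may give it
          -- different images.
          Imageⁱ : SM.Inner C → SN.Inner W → Set
          Imageⁱ x y = ∃[ P′ ] (Good (SM.Inner.set x) P′ × SN.Inner.set y ≡ ⟦ Ev (SM.Inner.set x) P′ ⟧)

          imageⁱ : ∀ {B} (LB : M.Loop B) {P₁} (G₁ : Good B P₁) → ⟦ Ev B P₁ ⟧ ⊆ W →
              (x : SM.Inner C) → SM.Inner.set x ⊆ B →
                   ∃[ y ] (SN.Inner.set y ⊆ ⟦ Ev B P₁ ⟧ × Imageⁱ x y)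
          imageⁱ LB G₁ ⊆W x sub with descend LB (SM.Inner.loop x) sub G₁
          ... | P′ , G′ , sub′ =
              SN.inner (Generic.image (SM.Inner.loop x) G′) (λ q∈ → ⊆W (smaller q∈)) , smaller , P′ , G′ , refl
            where
            smaller : ⟦ Ev (SM.Inner.set x) P′ ⟧ ⊆ _
            smaller q∈ = ∈⟦⟧⁺ (sub′ (∈⟦⟧⁻ q∈))

          forthⁱ : ∀ {x y x′} → Imageⁱ x y → x SM.⊇ⁱ x′ → ∃[ y′ ] (y SN.⊇ⁱ y′ × Imageⁱ x′ y′)
          forthⁱ {x} {SN.inner _ b} {x′} (P₁ , G₁ , refl) (SM.sup sub) =
            let y′ , smaller , im = imageⁱ (SM.Inner.loop x) G₁ b x′ sub in y′ , SN.sup smaller , im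

          labelⁱ : ∀ {x y} → Imageⁱ x y → SM.loopLabel (SM.Inner.loop x) ≡ SN.loopLabel (SN.Inner.loop y)
          labelⁱ {x} {y} (P′ , G′ , eq) = Generic.image-label (SM.Inner.loop x) G′ eq (SN.Inner.loop y)

          innerSim : S₀.Sim (SM.Inn C) (SN.Inn W)
          innerSim = record
            { R       = Imageⁱ
            ; total   = λ x → let y , _ , im = imageⁱ LC G ⊆W x (SM.Inner.below x) in y , im
            ; forth   = forthⁱ
            ; label-≲ = λ {x} {y} → labelⁱ {x} {y}
            }

        Imageᵒ : SM.Outer → SN.Outer → Set
        Imageᵒ x y = ∃[ P ] (Good (SM.Outer.set x) P × ⟦ Ev (SM.Outer.set x) P ⟧ ⊆ SN.Outer.set y)

        totalᵒ : ∀ x → ∃[ y ] Imageᵒ x y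
        totalᵒ (SM.outer (L , _)) with M.loop-enter L
        ... | T , st with prepare (pt (proj₁ L) T 0) st
        ... | P , _ , _ , G with N.max-above (Generic.image L G)
        ... | W , mx , sub = SN.outer mx , P , G , sub

        forthᵒ : ∀ {x y x′} → Imageᵒ x y → SM.Outer.set x M.⟶ SM.Outer.set x′ →
                 ∃[ y′ ] (SN.Outer.set y N.⟶ SN.Outer.set y′ × Imageᵒ x′ y′)
        forthᵒ {SM.outer (L , _)} {SN.outer _} {SM.outer (L′ , _)} (P , G , sub) x⟶ with leave L L′ x⟶ G
        ... | P′ , G′ , (p , p∈ , q , q∈ , r) with N.max-above (Generic.image L′ G′)
        ... | W , mx , sub′ = SN.outer mx , (p , sub p∈ , q , sub′ q∈ , r) , P′ , G′ , sub′

        labelᵒ : ∀ {x y} → Imageᵒ x y →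
                 Preorder._≲_ (Poset.preorder (𝓣 k)) (SM.innerTree (SM.Outer.loop x)) (SN.innerTree (SN.Outer.loop y))
        labelᵒ {x} {y} (P , G , sub) =
          S₀.Sim⇒hom {Tree.forest (SM.innerTree (SM.Outer.loop x))} {Tree.forest (SN.innerTree (SN.Outer.loop y))}
            (S₀.Sim-trans (SM.innerTree⇒ (SM.Outer.loop x))
              (S₀.Sim-trans (innerSim (SM.Outer.loop x) G sub) (SN.innerTree⇐ (SN.Outer.loop y))))

      outerSim : S₁.Sim SM.Out SN.Out
      outerSim = record
        { R       = Imageᵒ
        ; total   = totalᵒ
        ; forth   = λ {x} {y} {x′} → forthᵒ {x} {y} {x′}
        ; label-≲ = λ {x} {y} → labelᵒ {x} {y}
        }

  -- Backward prefixes and bounded searches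

  rev↾ : {A : Set} → A ^ω → ℕ → List A
  rev↾ ξ zero    = []
  rev↾ ξ (suc t) = ξ t ∷ rev↾ ξ t

  rev↾-Ag : {A : Set} {ξ η : A ^ω} → ∀ t → Ag t ξ η → rev↾ ξ t ≡ rev↾ η t
  rev↾-Ag zero    ag = refl
  rev↾-Ag (suc t) ag = cong₂ _∷_ (ag t ≤-refl) (rev↾-Ag t (Ag-≤ (n≤1+n t) ag))

  last-true : {P : ℕ → Set} → ∀ {a} d → P a → ¬ P (d + a) → ∃[ l ] (a ≤ l × l < d + a × P l × ¬ P (suc l))
  last-true zero    p ¬p = contradiction p ¬p
  last-true {P} {a} (suc d) p ¬p with em {P (d + a)}
  ... | yes q = d + a , m≤n+m a d , ≤-refl , q , ¬p
  ... | no ¬q = let l , a≤l , l< , q , ¬q′ = last-true {P} d p ¬q in l , a≤l , m<n⇒m<1+n l< , q , ¬q′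

  first-true : {P : ℕ → Set} → ∀ a d → P (d + a) → ∃[ t ] (a ≤ t × P t × (∀ j → a ≤ j → j < t → ¬ P j))
  first-true a zero p = a , ≤-refl , p , λ j le lt → contradiction lt (≤⇒≯ le)
  first-true {P} a (suc d) p with em {∃[ j ] (a ≤ j × j < suc d + a × P j)}
  ... | no none = suc d + a , m≤n+m a (suc d) , p , λ j le lt q → none (j , le , lt , q)
  ... | yes (j , le , lt , q) = first-true′ d j le (s≤s⁻¹ lt) q
    where
    first-true′ : ∀ d j → a ≤ j → j ≤ d + a → P j → ∃[ t ] (a ≤ t × P t × (∀ j → a ≤ j → j < t → ¬ P j))
    first-true′ zero j le le′ q = j , le , q , λ i a≤i i<j → contradiction (<-≤-trans i<j le′) (≤⇒≯ a≤i)
    first-true′ (suc d) j le le′ q with em {∃[ i ] (a ≤ i × i < j × P i)}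
    ... | no none = j , le , q , λ i a≤i i<j r → none (i , a≤i , i<j , r)
    ... | yes (i , a≤i , i<j , r) = first-true′ d i a≤i (s≤s⁻¹ (≤-trans i<j le′)) r

  -- Loops closed by the last letter of a finite word

  module Returns {X : Set} (M : Automaton X) where
    open Run M

    stateAfter : List X → State
    stateAfter []       = init
    stateAfter (x ∷ ru) = δ (stateAfter ru) x

    stateAfter-rev : ∀ ξ t → stateAfter (rev↾ ξ t) ≡ run ξ t
    stateAfter-rev ξ zero    = refl
    stateAfter-rev ξ (suc t) = trans (cong (λ s → δ s (ξ t)) (stateAfter-rev ξ t)) (sym (run-suc ξ t))

    -- The word, stored backwards, is searched for the latest visit to `q` strictly before its end;
    -- the result is the part read since then, in forward order.
    since : State → List X → Maybe (List⁺ X)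
    since q [] = nothing
    since q (x ∷ ru) with stateAfter ru ≟ q
    ... | yes _ = just (x ∷ [])
    ... | no  _ = Maybe.map (_⁺++ (x ∷ [])) (since q ru)

    since-reached : ∀ q ru {w} → since q ru ≡ just w →
                    (∃[ u ] (δ* init u ≡ q)) × δ* q (toList w) ≡ stateAfter ru
    since-reached q (x ∷ ru) eq with stateAfter ru ≟ q
    since-reached q (x ∷ ru) refl | yes s≡q = reached ru s≡q , cong (λ s → δ s x) (sym s≡q)
      where
      reached : ∀ ru {q} → stateAfter ru ≡ q → ∃[ u ] (δ* init u ≡ q)
      reached []       eq = [] , eq
      reached (y ∷ ru) eq = let u , eq′ = reached ru refl
                            in u ++ y ∷ [] , trans (δ*-++ init u (y ∷ [])) (trans (cong (λ s → δ s y) eq′) eq)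
    since-reached q (x ∷ ru) eq | no _ with since q ru in eq′
    since-reached q (x ∷ ru) refl | no _ | just w =
      let r , cyc = since-reached q ru eq′
      in r , trans (δ*-++ q (toList w) (x ∷ [])) (cong (λ s → δ s x) cyc)

    record Since (ξ : X ^ω) (t : ℕ) (q : State) (w : List⁺ X) : Set where
      field
        l      : ℕ
        l<t    : l < t
        at-l   : run ξ l ≡ q
        latest : ∀ j → l < j → j < t → run ξ j ≢ q
        vis⁻   : ∀ {r} → Visits q (toList w) r → ∃[ j ] (l ≤ j × j < t × run ξ j ≡ r)
        vis⁺   : ∀ j → l ≤ j → j < t → Visits q (toList w) (run ξ j)

    since-spec : ∀ ξ t q {w} → since q (rev↾ ξ t) ≡ just w → Since ξ t q w
    since-spec ξ (suc t) q eq with stateAfter (rev↾ ξ t) ≟ q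
    since-spec ξ (suc t) q refl | yes s≡q = record
      { l = t ; l<t = ≤-refl ; at-l = at-t
      ; latest = λ j t<j j<t+1 → contradiction (s≤s⁻¹ j<t+1) (<⇒≱ t<j)
      ; vis⁻ = λ { here → t , ≤-refl , ≤-refl , at-t ; (there ()) }
      ; vis⁺ = λ j t≤j j<t+1 → subst (λ i → Visits q (ξ t ∷ []) (run ξ i)) (≤-antisym t≤j (s≤s⁻¹ j<t+1))
                 (subst (Visits q (ξ t ∷ [])) (sym at-t) here)
      }
      where
      at-t : run ξ t ≡ q
      at-t = trans (sym (stateAfter-rev ξ t)) s≡q
    since-spec ξ (suc t) q eq | no s≢q with since q (rev↾ ξ t) in eq′
    since-spec ξ (suc t) q refl | no s≢q | just w = record
      { l = l ; l<t = m<n⇒m<1+n l<t ; at-l = at-l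
      ; latest = λ j l<j j<t+1 → later j l<j (m≤n⇒m<n∨m≡n (s≤s⁻¹ j<t+1))
      ; vis⁻ = λ v → visited⁻ (Visits-++⁻ (toList w) v)
      ; vis⁺ = λ j l≤j j<t+1 → visited⁺ j l≤j (m≤n⇒m<n∨m≡n (s≤s⁻¹ j<t+1))
      }
      where
      open Since (since-spec ξ t q eq′)
      end : δ* q (toList w) ≡ run ξ t
      end = trans (proj₂ (since-reached q (rev↾ ξ t) eq′)) (stateAfter-rev ξ t)
      later : ∀ j → l < j → j < t ⊎ j ≡ t → run ξ j ≢ q
      later j l<j (inj₁ j<t)  = latest j l<j j<t
      later j l<j (inj₂ refl) = λ e → s≢q (trans (stateAfter-rev ξ t) e)
      visited⁻ : ∀ {r} → Visits q (toList w) r ⊎ Visits (δ* q (toList w)) (ξ t ∷ []) r →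
                 ∃[ j ] (l ≤ j × j < suc t × run ξ j ≡ r)
      visited⁻ (inj₁ v) = let j , l≤j , j<t , e = vis⁻ v in j , l≤j , m<n⇒m<1+n j<t , e
      visited⁻ (inj₂ here) = t , <⇒≤ l<t , ≤-refl , sym end
      visited⁺ : ∀ j → l ≤ j → j < t ⊎ j ≡ t → Visits q (toList w ++ ξ t ∷ []) (run ξ j)
      visited⁺ j l≤j (inj₁ j<t)  = Visits-++ˡ (ξ t ∷ []) (vis⁺ j l≤j j<t)
      visited⁺ j l≤j (inj₂ refl) = Visits-++ʳ (toList w)
        (subst (λ s → Visits s (ξ t ∷ []) (run ξ t)) (sym end) here)

    since-exists : ∀ ξ t {q l} → l < t → run ξ l ≡ q → ∃[ w ] (since q (rev↾ ξ t) ≡ just w)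
    since-exists ξ (suc t) {q} {l} l<t eq with stateAfter (rev↾ ξ t) ≟ q
    ... | yes _ = _ , refl
    ... | no s≢q with m≤n⇒m<n∨m≡n (s≤s⁻¹ l<t)
    ... | inj₂ refl = contradiction (trans (stateAfter-rev ξ t) eq) s≢q
    ... | inj₁ l<t′ with since-exists ξ t l<t′ eq
    ... | w , e rewrite e = _ , refl

    record LoopThrough (s : State) : Set where
      constructor through
      field
        {set} : Subset size
        loop  : Loop set
        at    : s ∈ set

    private
      build : ∀ ru m → since (stateAfter ru) ru ≡ m → Maybe (LoopThrough (stateAfter ru))
      build ru nothing  _  = nothing
      build ru (just w) eq =
        let (u , st) , cyc = since-reached (stateAfter ru) ru eq
        in just (through (cycle-Loop {u} w st cyc) (∈⟦⟧⁺ here))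

      build-just : ∀ ru m eq {D} → Maybe.map LoopThrough.set (build ru m eq) ≡ just D →
                   ∃[ w ] (m ≡ just w × D ≡ ⟦ Visits (stateAfter ru) (toList w) ⟧)
      build-just ru (just w) eq refl = w , refl , refl

      build-set : ∀ ru m eq {w} → m ≡ just w →
                  Maybe.map LoopThrough.set (build ru m eq) ≡ just ⟦ Visits (stateAfter ru) (toList w) ⟧
      build-set ru _ eq refl = refl

    abstract
      loopAt : ∀ ru → Maybe (LoopThrough (stateAfter ru))
      loopAt ru = build ru _ refl

      loopAt-nil : loopAt [] ≡ nothing
      loopAt-nil = refl

    loopSet : List X → Maybe (Subset size)
    loopSet ru = Maybe.map LoopThrough.set (loopAt ru)

    abstract
      loopSet-just : ∀ ru {D} → loopSet ru ≡ just D →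
                     ∃[ w ] (since (stateAfter ru) ru ≡ just w × D ≡ ⟦ Visits (stateAfter ru) (toList w) ⟧)
      loopSet-just ru eq = build-just ru _ refl eq

      loopSet-set : ∀ ru {w} → since (stateAfter ru) ru ≡ just w →
                    loopSet ru ≡ just ⟦ Visits (stateAfter ru) (toList w) ⟧
      loopSet-set ru eq = build-set ru _ refl eq

    module _ (ξ : X ^ω) where

      loopSet-spec : ∀ t {D} → loopSet (rev↾ ξ t) ≡ just D →
                     ∃[ w ] (Since ξ t (run ξ t) w × D ≡ ⟦ Visits (run ξ t) (toList w) ⟧)
      loopSet-spec t {D} eq =
        let w , eq′ , eq″ = loopSet-just (rev↾ ξ t) eq in at (stateAfter-rev ξ t) eq′ eq″
        where
        at : ∀ {s w} → s ≡ run ξ t → since s (rev↾ ξ t) ≡ just w → D ≡ ⟦ Visits s (toList w) ⟧ →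
             ∃[ w ] (Since ξ t (run ξ t) w × D ≡ ⟦ Visits (run ξ t) (toList w) ⟧)
        at refl eq′ eq″ = _ , since-spec ξ t (run ξ t) eq′ , eq″

      loopSet-exists : ∀ t {l} → l < t → run ξ l ≡ run ξ t →
                       ∃[ w ] (Since ξ t (run ξ t) w × loopSet (rev↾ ξ t) ≡ just ⟦ Visits (run ξ t) (toList w) ⟧)
      loopSet-exists t l<t eq with since-exists ξ t l<t eq
      ... | w , e = w , since-spec ξ t (run ξ t) e
                  , subst (λ s → since s (rev↾ ξ t) ≡ just w → loopSet (rev↾ ξ t) ≡ just ⟦ Visits s (toList w) ⟧)
                      (stateAfter-rev ξ t) (loopSet-set (rev↾ ξ t)) e

      private
        T₀ : ℕ
        T₀ = proj₁ (eventually-IO (run ξ))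
        inf : ∀ t → T₀ ≤ t → Inf ξ (run ξ t)
        inf = proj₂ (eventually-IO (run ξ))

        Covered : ℕ → ℕ → Set
        Covered l t = ∀ q → Inf ξ q → ∃[ j ] (l ≤ j × j < t × run ξ j ≡ q)

        covered : ∀ l → ∃[ T ] (∀ t → T ≤ t → Covered l t)
        covered l = let T , f = eventually-all by in T , λ t le q io → f q t le io
          where
          by : ∀ q → ∃[ T ] (∀ t → T ≤ t → Inf ξ q → ∃[ j ] (l ≤ j × j < t × run ξ j ≡ q))
          by q with em {Inf ξ q}
          ... | no ¬io = 0 , λ _ _ io → contradiction io ¬io
          ... | yes io = let j , le , eq = io l in suc j , λ t lt _ → j , le , lt , eq

      -- Late enough, the current state has already been visited after `T₀`. Its latest earlier
      -- visit is then also after `T₀`, and from `T₀` on only recurrent states occur.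
      loops-below-Inf : ∃[ T ] (∀ t → T ≤ t → ∀ {D} → loopSet (rev↾ ξ t) ≡ just D → D ⊆ ⟦ Inf ξ ⟧)
      loops-below-Inf = T₁ ⊔ⁿ T₀ , below
        where
        T₁ = proj₁ (covered T₀)
        below : ∀ t → T₁ ⊔ⁿ T₀ ≤ t → ∀ {D} → loopSet (rev↾ ξ t) ≡ just D → D ⊆ ⟦ Inf ξ ⟧
        below t le eq {r} r∈ with loopSet-spec t eq
        ... | w , S , refl =
          let open Since S
              j , T₀≤j , j<t , eq-j = proj₂ (covered T₀) t (≤-trans (m≤m⊔n T₁ T₀) le) (run ξ t)
                                        (inf t (≤-trans (m≤n⊔m T₁ T₀) le))
              j≤l = ≮⇒≥ (λ l<j → latest j l<j j<t eq-j)
              i , l≤i , _ , eq-i = vis⁻ (∈⟦⟧⁻ r∈)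
          in ∈⟦⟧⁺ (subst (Inf ξ) eq-i (inf i (≤-trans T₀≤j (≤-trans j≤l l≤i))))

      -- The state of Inf ξ whose last visit is earliest closes a loop
      -- through all of Inf ξ when it is visited again.
      loops-reach-Inf : ∀ T → ∃[ t ] (T ≤ t × loopSet (rev↾ ξ t) ≡ just ⟦ Inf ξ ⟧)
      loops-reach-Inf T = result
        where
        lo = T ⊔ⁿ T₀
        hi = proj₁ (covered lo) ⊔ⁿ lo
        hi≡ : (hi ∸ lo) + lo ≡ hi
        hi≡ = m∸n+n≡m (m≤n⊔m (proj₁ (covered lo)) lo)
        ¬cov : ∀ t → ¬ Covered t t
        ¬cov t cov = let j , t≤j , j<t , _ = cov (run ξ T₀) (inf T₀ ≤-refl) in <⇒≱ j<t t≤j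
        Result : Set
        Result = ∃[ t ] (T ≤ t × loopSet (rev↾ ξ t) ≡ just ⟦ Inf ξ ⟧)
        module _ {l} (lo≤l : lo ≤ l) (l<hi : l < hi) (cov : Covered l hi) (¬cov+1 : ¬ Covered (suc l) hi) where
          q = run ξ l
          q-inf : Inf ξ q
          q-inf = inf l (≤-trans (m≤n⊔m T T₀) lo≤l)
          unvisited : ∀ j → l < j → j < hi → run ξ j ≢ q
          unvisited j l<j j<hi eq = ¬cov+1 (λ p io → recover p io (cov p io))
            where
            recover : ∀ p → Inf ξ p → ∃[ i ] (l ≤ i × i < hi × run ξ i ≡ p) → ∃[ i ] (suc l ≤ i × i < hi × run ξ i ≡ p)
            recover p io (i , l≤i , i<hi , e) with m≤n⇒m<n∨m≡n l≤i
            ... | inj₁ l<i = i , l<i , i<hi , e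
            ... | inj₂ refl = j , l<j , j<hi , trans eq e
          at-return : ∀ t → hi ≤ t → run ξ t ≡ q → (∀ j → hi ≤ j → j < t → run ξ j ≢ q) → Result
          at-return t hi≤t eq first with loopSet-exists t (<-≤-trans l<hi hi≤t) (sym eq)
          ... | w , S , set≡ = t , ≤-trans (≤-trans (m≤m⊔n T T₀) lo≤l) (≤-trans (<⇒≤ l<hi) hi≤t)
                             , trans set≡ (cong just (⊆-antisym (λ r∈ → ∈⟦⟧⁺ (sub (∈⟦⟧⁻ r∈)))
                                 (λ r∈ → ∈⟦⟧⁺ (sup (∈⟦⟧⁻ r∈)))))
            where
            module S = Since S
            not-later : ∀ j → l < j → j < t → run ξ j ≢ q
            not-later j l<j j<t with ≤-<-connex hi j
            ... | inj₁ hi≤j = first j hi≤j j<t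
            ... | inj₂ j<hi = unvisited j l<j j<hi
            S≥ : l ≤ S.l
            S≥ = ≮⇒≥ (λ lt → S.latest l lt (<-≤-trans l<hi hi≤t) (sym eq))
            S≤ : S.l ≤ l
            S≤ = ≮⇒≥ (λ lt → not-later S.l lt S.l<t (trans S.at-l eq))
            sub : ∀ {r} → Visits (run ξ t) (toList w) r → Inf ξ r
            sub v = let j , l≤j , _ , e = S.vis⁻ v
                    in subst (Inf ξ) e (inf j (≤-trans (≤-trans (m≤n⊔m T T₀) lo≤l) (≤-trans S≥ l≤j)))
            sup : ∀ {r} → Inf ξ r → Visits (run ξ t) (toList w) r
            sup {r} io = let j , l≤j , j<hi , e = cov r io
                         in subst (Visits (run ξ t) (toList w)) e (S.vis⁺ j (≤-trans S≤ l≤j) (<-≤-trans j<hi hi≤t))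
          return : Result
          return =
            let m , hi≤m , eq = q-inf hi
                -- The first return to `q` from `hi` on has `l` as its latest earlier visit, so the
                -- loop it closes includes everything visited from `l` to `hi`.
                t , hi≤t , e , first = first-true {λ t → run ξ t ≡ q} hi (m ∸ hi)
                    (trans (cong (run ξ) (m∸n+n≡m hi≤m)) eq)
            in at-return t hi≤t e first
        result : Result
        result =
          -- Here `l` is a last moment from which the visits before `hi` still exhaust `Inf ξ`; the
          -- state at `l` therefore does not occur again before `hi`.
          let l , lo≤l , l<hi , cov , ¬cov+1 =
                last-true {λ l → Covered l hi} {lo} (hi ∸ lo) (proj₂ (covered lo) hi (m≤m⊔n _ lo))
                  (λ c → ¬cov hi (subst (λ i → Covered i hi) hi≡ c))
          in return lo≤l (subst (l <_) hi≡ l<hi) cov ¬cov+1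

      loop-by-size : ∃[ t ] (t ≤ size × ∃[ D ] (loopSet (rev↾ ξ t) ≡ just D))
      loop-by-size =
        let i , j , i<j , eq = pigeonhole (n<1+n size) (λ (i : Fin (suc size)) → run ξ (toℕ i))
            w , _ , e = loopSet-exists (toℕ j) i<j eq
        in toℕ j , s≤s⁻¹ (toℕ<n j) , _ , e

  -- Simulations induce continuous reductions

  module _ {X : Set} {k : ℕ} where

    private
      module S₀ = Simulation (≡-preorder (Fin k))
      module S₁ = Simulation (Poset.preorder (𝓣 k))

    module Strategy (M N : Automaton X) (A B : Partition k X)
                    (detA : InfDetermines M A) (detB : InfDetermines N B) where

      private
        module M = Run M
        module N = Run N
        module SM = Structure M A detA
        module SN = Structure N B detB
        module R = Returns M

        record Journey (E : Subset N.size) (p q : N.State) : Set where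
          field
            word   : List⁺ X
            leads  : N.δ* p (toList word) ≡ q
            covers : ∀ {r} → r ∈ E → N.Visits p (toList word) r

        journey : ∀ {E p q} → N.Reachable p q → N.Path E q q → Journey E p q
        journey {E} {p} (w , refl) π = record
          { word   = w ++⁺ word
          ; leads  = trans (cong (N.δ* p) (toList-++⁺ w word)) (trans (N.δ*-++ p w (toList word)) leads)
          ; covers = λ r∈ → subst (λ v → N.Visits p v _) (sym (toList-++⁺ w word)) (N.Visits-++ʳ w (covers r∈))
          }
          where open N.Path π

        journey-within : ∀ {D E p q} (π : N.Path D p q) (ρ : N.Path E q q) → E ⊆ D →
                         ∃[ J ] (∀ {r} → N.Visits p (toList (Journey.word {E} {p} {q} J)) r → r ∈ D)
        journey-within {D} {E} {p} {q} π ρ E⊆D = record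
          { word   = π.word ⁺++⁺ ρ.word
          ; leads  = trans (N.δ*-++ p (toList π.word) (toList ρ.word))
                       (trans (cong (λ s → N.δ* s (toList ρ.word)) π.leads) ρ.leads)
          ; covers = λ r∈ → N.Visits-++ʳ (toList π.word)
                       (subst (λ s → N.Visits s (toList ρ.word) _) (sym π.leads) (ρ.covers r∈))
          } , λ v → [ π.within
                    , (λ v → E⊆D (ρ.within (subst (λ s → N.Visits s (toList ρ.word) _) π.leads v)))
                    ]′ (N.Visits-++⁻ (toList π.word) v)
          where
          module π = N.Path π
          module ρ = N.Path ρ

      module _ (S : S₁.Sim SM.Out SN.Out) where

        private
          module S = S₁.Sim S

          -- A phase fixes a maximal loop together with its image. The comparison of their labels is
          -- what provides the simulation of inner loops used during the phase.
          record Phase : Set where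
            constructor phase
            field
              {x} : SM.Outer
              {y} : SN.Outer
              r   : S.R x y

            C : Subset M.size
            C = SM.Outer.set x

            W : Subset N.size
            W = SN.Outer.set y

            abstract
              sim : S₀.Sim (SM.Inn C) (SN.Inn W)
              sim = S₀.Sim-trans (SM.innerTree⇐ (SM.Outer.loop x)) (S₀.Sim-trans
                      (S₀.hom⇒Sim {Tree.forest (SM.innerTree (SM.Outer.loop x))}
                                  {Tree.forest (SN.innerTree (SN.Outer.loop y))} (S.label-≲ r))
                      (SN.innerTree⇒ (SN.Outer.loop y)))

            open S₀.Sim sim renaming (R to _∼_) public

          module _ (φ : Phase) where
            open Phase φ

            -- A strictly decreasing chain of loops that begins with `C`; the chosen images decrease
            -- along it, and each choice is remembered until its loop is popped.
            data Stack : Set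
            topD : Stack → SM.Inner C
            topE : Stack → SN.Inner W

            data Stack where
              base : Stack
              push : (st : Stack) {D : SM.Inner C} {E : SN.Inner W} → D ∼ E →
                     topD st SM.⊇ⁱ D → ¬ D SM.⊇ⁱ topD st → topE st SN.⊇ⁱ E → Stack

            topD base                  = SM.inner (SM.Outer.loop x) id
            topD (push _ {D} _ _ _ _)  = D
            topE base                  = proj₁ (total (SM.inner (SM.Outer.loop x) id))
            topE (push _ {_} {E} _ _ _ _) = E

          module _ {φ : Phase} where
            open Phase φ

            top∼ : (st : Stack φ) → topD φ st ∼ topE φ st
            top∼ base             = proj₂ (total (SM.inner (SM.Outer.loop x) id))
            top∼ (push _ r _ _ _) = r

            data _⊑_ (st₀ : Stack φ) : Stack φ → Set where
              ⊑-refl : st₀ ⊑ st₀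
              ⊑-push : ∀ {st D E} {r : D ∼ E} {p q o} → st₀ ⊑ st → st₀ ⊑ push st r p q o

            ⊑-dom : ∀ {st₀ st} → st₀ ⊑ st → topD φ st₀ SM.⊇ⁱ topD φ st
            ⊑-dom ⊑-refl = SM.sup id
            ⊑-dom (⊑-push {p = SM.sup p} a) with SM.sup a′ ← ⊑-dom a = SM.sup (a′ ∘ p)

            ⊑-cod : ∀ {st₀ st} → st₀ ⊑ st → topE φ st₀ SN.⊇ⁱ topE φ st
            ⊑-cod ⊑-refl = SN.sup id
            ⊑-cod (⊑-push {o = SN.sup o} a) with SN.sup a′ ← ⊑-cod a = SN.sup (a′ ∘ o)

            ⊑-strict : ∀ {st₀ st} → st₀ ⊑ st → topD φ st SM.⊇ⁱ topD φ st₀ → st ≡ st₀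
            ⊑-strict ⊑-refl _ = refl
            ⊑-strict (⊑-push {q = q} a) (SM.sup b) with SM.sup a′ ← ⊑-dom a = contradiction (SM.sup (b ∘ a′)) q

            -- `keeps` protects every part of the stack whose top contains `D`. `grows` ensures that
            -- the point where the output stands lies in the image at the top of `rest`.
            record Popped (st : Stack φ) (D : SM.Inner C) : Set where
              field
                rest   : Stack φ
                above  : topD φ rest SM.⊇ⁱ D
                grows  : topE φ rest SN.⊇ⁱ topE φ st
                keeps  : ∀ {st₀} → st₀ ⊑ st → topD φ st₀ SM.⊇ⁱ D → st₀ ⊑ rest

            pop : ∀ st D → Popped st D
            pop base D = record
              { rest = base ; above = SM.sup (SM.Inner.below D) ; grows = SN.sup id ; keeps = λ a _ → a }
            pop st@(push st′ {D′} r p q o) D with em {D′ SM.⊇ⁱ D}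
            ... | yes b = record { rest = st ; above = b ; grows = SN.sup id ; keeps = λ a _ → a }
            ... | no ¬b = record
              { rest = rest ; above = above ; grows = SN.sup (contains grows ∘ contains o)
              ; keeps = λ { ⊑-refl b → contradiction b ¬b ; (⊑-push a) b → keeps a b } }
              where
              open Popped (pop st′ D)
              open SN._⊇ⁱ_

            -- By `same`, a loop that is already on top keeps the image chosen for it earlier;
            -- otherwise the output could change images forever.
            record Pushed (st : Stack φ) (D : SM.Inner C) : Set where
              field
                result  : Stack φ
                dom≡    : SM.Inner.set (topD φ result) ≡ SM.Inner.set D
                shrinks : topE φ st SN.⊇ⁱ topE φ result
                extends : st ⊑ result
                same    : D SM.⊇ⁱ topD φ st → result ≡ st

            pushed : ∀ st {D} → topD φ st SM.⊇ⁱ D → Pushed st D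
            pushed st {D} up@(SM.sup a) with em {D SM.⊇ⁱ topD φ st}
            ... | yes (SM.sup b) = record
              { result = st ; dom≡ = ⊆-antisym b a ; shrinks = SN.sup id ; extends = ⊑-refl ; same = λ _ → refl }
            ... | no ¬b = let E , le , r = forth (top∼ st) up in record
              { result = push st r up ¬b le ; dom≡ = refl ; shrinks = le
              ; extends = ⊑-push ⊑-refl ; same = λ b → contradiction b ¬b }

          record Config : Set where
            constructor config
            field
              {φ}   : Phase
              stack : Stack φ

            open Phase φ using (C; W) public

            dom : Subset M.size
            dom = SM.Inner.set (topD φ stack)

            cod : Subset N.size
            cod = SN.Inner.set (topE φ stack)

            domLoop : M.Loop dom
            domLoop = SM.Inner.loop (topD φ stack)

            codLoop : N.Loop cod
            codLoop = SN.Inner.loop (topE φ stack)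

            label≡ : SM.loopLabel domLoop ≡ SN.loopLabel codLoop
            label≡ = Phase.label-≲ φ (top∼ stack)

            point : N.State
            point = proj₁ (N.point codLoop)

            point∈ : point ∈ cod
            point∈ = proj₂ (N.point codLoop)

          open Config

          data _⊑ᶜ_ : Config → Config → Set where
            same-phase : ∀ {φ} {st₀ st : Stack φ} → st₀ ⊑ st → config st₀ ⊑ᶜ config st

          ⊑ᶜ-refl : ∀ {c} → c ⊑ᶜ c
          ⊑ᶜ-refl = same-phase ⊑-refl

          ⊑ᶜ-cod : ∀ {c₀ c} → c₀ ⊑ᶜ c → cod c ⊆ cod c₀
          ⊑ᶜ-cod (same-phase a) = SN._⊇ⁱ_.contains (⊑-cod a)

          -- What a move guarantees for a configuration `c₀` on the stack if no larger or
          -- incomparable loop is closed: it survives, the output stays inside its image, and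
          -- closing exactly its loop brings it back to the top.
          record Moved (c₀ next : Config) (p : N.State) (w : List X) (md : Maybe (Subset M.size)) : Set where
            field
              kept   : c₀ ⊑ᶜ next
              within : ∀ {q} → N.Visits p w q → q ∈ cod c₀
              reset  : md ≡ just (dom c₀) → next ≡ c₀

          record Move (c : Config) (md : Maybe (Subset M.size)) : Set where
            field
              next   : Config
              word   : List⁺ X
              leads  : N.δ* (point c) (toList word) ≡ point next
              covers : ∀ {q} → q ∈ cod next → N.Visits (point c) (toList word) q
              dom≡   : ∀ {D} → md ≡ just D → dom next ≡ D
              moved  : ∀ {c₀} → c₀ ⊑ᶜ c → (∀ {D} → md ≡ just D → D ⊆ dom c₀) →
                       Moved c₀ next (point c) (toList word) md

          -- A block is emitted even when no loop is closed; a tour of the current image remains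
          -- inside the image of every configuration further down the stack.
          idle : ∀ c → Move c nothing
          idle c = record
            { next = c ; word = word ; leads = leads ; covers = covers ; dom≡ = λ ()
            ; moved = λ a _ → record { kept = a ; within = λ v → ⊑ᶜ-cod a (within v) ; reset = λ () }
            }
            where open N.Path (N.loop-path (codLoop c) (point∈ c) (point∈ c))

          module _ {φ : Phase} (st : Stack φ) {D : Subset M.size} (L : M.Loop D) (D⊆C : D ⊆ Phase.C φ) where
            private
              c : Config
              c = config st
              open Popped (pop st (SM.inner L D⊆C))
              open Pushed (pushed rest above) renaming (dom≡ to same-dom)
              c′ : Config
              c′ = config result
              toured : ∃[ J ] (∀ {r} → N.Visits (point c) (toList (Journey.word {cod c′} {point c} {point c′} J)) r →
                               r ∈ cod (config rest))
              -- The old and the new image both lie in the image at the top of `rest`, so passing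
              -- through the latter never leaves the image of a configuration that is kept.
              toured = journey-within
                (N.loop-path (codLoop (config rest))
                  (SN._⊇ⁱ_.contains grows (point∈ c)) (SN._⊇ⁱ_.contains shrinks (point∈ c′)))
                (N.loop-path (codLoop c′) (point∈ c′) (point∈ c′)) (SN._⊇ⁱ_.contains shrinks)
              module J = Journey (proj₁ toured)

            withinPhase : Move c (just D)
            withinPhase = record
              { next = c′ ; word = J.word ; leads = J.leads ; covers = J.covers
              ; dom≡ = λ { refl → same-dom } ; moved = withinPhase-moved }
              where
              withinPhase-moved : ∀ {c₀} → c₀ ⊑ᶜ c → (∀ {D′} → just D ≡ just D′ → D′ ⊆ dom c₀) →
                             Moved c₀ c′ (point c) (toList J.word) (just D)
              withinPhase-moved (same-phase {st₀ = st₀} a) sub = record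
                { kept   = same-phase (⊑-trans b extends)
                ; within = λ v → SN._⊇ⁱ_.contains (⊑-cod b) (proj₂ toured v)
                ; reset  = λ { refl → cong config (rest-result (SM.sup id)) }
                }
                where
                ⊑-trans : ∀ {s t u : Stack φ} → s ⊑ t → t ⊑ u → s ⊑ u
                ⊑-trans p ⊑-refl     = p
                ⊑-trans p (⊑-push q) = ⊑-push (⊑-trans p q)
                b : st₀ ⊑ rest
                b = keeps a (SM.sup (sub refl))
                rest-result : SM.inner L D⊆C SM.⊇ⁱ topD φ st₀ → result ≡ st₀
                rest-result (SM.sup s) =
                  let rest≡ = ⊑-strict b (SM.sup (SM._⊇ⁱ_.contains above ∘ s))
                  in trans (same (SM.sup (λ q∈ → s (subst (λ t → _ ∈ SM.Inner.set (topD φ t)) rest≡ q∈)))) rest≡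

          module _ {x : SM.Outer} {D : Subset M.size} (L : M.Loop D) (D⊆C : D ⊆ SM.Outer.set x) where

            record Started (y : SN.Outer) : Set where
              field
                φ      : Phase
                st     : Stack φ
                W≡     : Phase.y φ ≡ y
                dom≡   : dom (config st) ≡ D

            started : ∀ {y} → S.R x y → Started y
            started r = record { φ = phase r ; st = result ; W≡ = refl ; dom≡ = dom≡ }
              where open Pushed (pushed {phase r} base {SM.inner L D⊆C} (SM.sup D⊆C))

          module _ (c : Config) {D : Subset M.size} (L : M.Loop D) (C⟶D : C c M.⟶ D) (D⊈C : ¬ D ⊆ C c) where
            private
              above : ∃[ C′ ] (M.MaxLoop C′ × D ⊆ C′)
              above = M.max-above L
              x′ : SM.Outer
              x′ = SM.outer (proj₁ (proj₂ above))
              C⟶C′ : C c M.⟶ SM.Outer.set x′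
              C⟶C′ = let p , p∈ , q , q∈ , r = C⟶D in p , p∈ , q , proj₂ (proj₂ above) q∈ , r
              forward : ∃[ y′ ] (W c N.⟶ SN.Outer.set y′ × S.R x′ y′)
              forward = S.forth (Phase.r (φ c)) C⟶C′
              open Started (started L (proj₂ (proj₂ above)) (proj₂ (proj₂ forward))) renaming (φ to φ′)
              c′ : Config
              c′ = config st
              bridge : N.Reachable (point c) (point c′)
              bridge = N.⟶-all (SN.Outer.loop (Phase.y (φ c))) (SN.Outer.loop (proj₁ forward)) (proj₁ (proj₂ forward))
                         (SN.Inner.below (topE (φ c) (stack c)) (point∈ c))
                         (subst (λ y → point c′ ∈ SN.Outer.set y) W≡ (SN.Inner.below (topE φ′ st) (point∈ c′)))
              module J = Journey (journey bridge (N.loop-path (codLoop c′) (point∈ c′) (point∈ c′)))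

              -- Vacuous: a loop below `dom c₀` would lie in `C c`, and then no new phase would
              -- begin.
              newPhase-moved : ∀ {c₀} → c₀ ⊑ᶜ c → (∀ {D′} → just D ≡ just D′ → D′ ⊆ dom c₀) →
                              Moved c₀ c′ (point c) (toList J.word) (just D)
              newPhase-moved (same-phase {st₀ = st₀} a) sub =
                contradiction (λ {q} q∈ → SM.Inner.below (topD (φ c) st₀) (sub refl q∈)) D⊈C

            newPhase : Move c (just D)
            newPhase = record
              { next = c′ ; word = J.word ; leads = J.leads ; covers = J.covers
              ; dom≡ = λ { refl → dom≡ } ; moved = newPhase-moved }

          abstract
            move : ∀ c {D} → M.Loop D → C c M.⟶ D → Move c (just D)
            move c {D} L C⟶D with em {D ⊆ C c}
            ... | yes sub = withinPhase (stack c) L sub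
            ... | no ¬sub = newPhase c L C⟶D ¬sub

            fresh : ∀ {D} → M.Loop D → ∃[ c ] (dom c ≡ D)
            fresh L =
              let C′ , mx , sub = M.max-above L
                  y , r = S.total (SM.outer mx)
                  open Started (started {SM.outer mx} L (λ {q} → sub {q}) r)
              in config st , dom≡

          dom⊆C : ∀ c → dom c ⊆ C c
          dom⊆C c = SM.Inner.below (topD (φ c) (stack c))

          -- The anchor makes the next phase reachable from the current one.
          record Live (s : M.State) : Set where
            constructor live
            field
              conf   : Config
              anchor : ∃[ q ] (q ∈ C conf × M.Reachable q s)
          open Live

          record Transition (s : M.State) (x : X) (ml : Maybe (R.LoopThrough (M.δ s x))) (a : Live s) : Set where
            field
              move′ : Move (conf a) (Maybe.map R.LoopThrough.set ml)
              live′ : ∃[ q ] (q ∈ C (Move.next move′) × M.Reachable q (M.δ s x))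

          transition : ∀ {s} x ml a → Transition s x ml a
          transition {s} x nothing (live c (q , q∈ , r)) = record
            { move′ = idle c ; live′ = q , q∈ , M.Reachable-trans r (x ∷ [] , refl) }
          transition {s} x (just (R.through L s∈)) (live c (q , q∈ , r)) = record
            { move′ = m ; live′ = M.δ s x , dom⊆C (Move.next m)
                (subst (M.δ s x ∈_) (sym (Move.dom≡ m refl)) s∈) , [] , refl }
            where
            m = move c L (q , q∈ , M.δ s x , s∈ , M.Reachable-trans r (x ∷ [] , refl))

          advance : ∀ ru x → Maybe (Live (R.stateAfter ru)) → Maybe (R.LoopThrough (R.stateAfter (x ∷ ru))) →
                    Maybe (Live (R.stateAfter (x ∷ ru))) × List⁺ X
          advance ru x (just a) ml =
            just (live (Move.next move′) live′) , Move.word move′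
            where open Transition (transition x ml a)
          advance ru x nothing (just (R.through L s∈)) =
            just (live (proj₁ (fresh L)) (_ , dom⊆C (proj₁ (fresh L))
                (subst (_ ∈_) (sym (proj₂ (fresh L))) s∈) , [] , refl))
            , x ∷ []
          -- The emitted letter is a placeholder: `answer` collects blocks only from time `T₀` on,
          -- when a configuration exists.
          advance ru x nothing nothing = nothing , x ∷ []

          strategy : ∀ ru → Maybe (Live (R.stateAfter ru))
          strategy []       = nothing
          strategy (x ∷ ru) = proj₁ (advance ru x (strategy ru) (R.loopAt (x ∷ ru)))

          emit : List X → X → List⁺ X
          emit ru x = proj₂ (advance ru x (strategy ru) (R.loopAt (x ∷ ru)))

          entryWord : ∀ {s} → Maybe (Live s) → List X
          entryWord nothing  = []
          entryWord (just a) = proj₁ (N.loop-reachable (codLoop (conf a)) (point∈ (conf a)))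

          entry : List X → List X
          entry ru = entryWord (strategy ru)

          -- By the pigeonhole principle some loop is closed after T₀ letters.
          T₀ : ℕ
          T₀ = M.size

          answer : X ^ω → X ^ω
          answer ξ = cat (entry (rev↾ ξ T₀)) (λ k → emit (rev↾ ξ (k + T₀)) (ξ (k + T₀)))

          answer-continuous : Continuous answer
          -- The entry word depends on `T₀` letters, and each further letter determines one nonempty
          -- block.
          answer-continuous ξ n = n + T₀ , λ η eq → Ag⇒↾ n (agrees η (↾⇒Ag (n + T₀) eq))
            where
            agrees : ∀ η → Ag (n + T₀) η ξ → Ag n (answer η) (answer ξ)
            agrees η ag i lt = trans
              (cong (λ ru → cat (entry ru) (λ k → emit (rev↾ η (k + T₀)) (η (k + T₀))) i)
                    (rev↾-Ag T₀ (Ag-≤ (m≤n+m T₀ n) ag)))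
              (cat-Ag n (entry (rev↾ ξ T₀))
                (λ k k<n → cong₂ emit (rev↾-Ag (k + T₀) (Ag-≤ (+-monoˡ-≤ T₀ (<⇒≤ k<n)) ag))
                                      (ag (k + T₀) (+-monoˡ-< T₀ k<n))) i lt)

          Alive : List X → Set
          Alive ru = ∃[ a ] (strategy ru ≡ just a)

          step : ∀ ru x (a : Live (R.stateAfter ru)) → Transition (R.stateAfter ru) x (R.loopAt (x ∷ ru)) a
          step ru x a = transition x (R.loopAt (x ∷ ru)) a

          alive-step : ∀ ru x → Alive ru → Alive (x ∷ ru)
          alive-step ru x (a , eq) =
            live (Move.next move′) live′ , cong (λ m → proj₁ (advance ru x m (R.loopAt (x ∷ ru)))) eq
            where open Transition (step ru x a)

          emit-step : ∀ ru x ((a , _) : Alive ru) → emit ru x ≡ Move.word (Transition.move′ (step ru x a))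
          emit-step ru x (a , eq) = cong (λ m → proj₂ (advance ru x m (R.loopAt (x ∷ ru)))) eq

          alive-loop : ∀ ru {D} → R.loopSet ru ≡ just D → Alive ru
          alive-loop [] eq with () ← trans (sym eq) (cong (Maybe.map R.LoopThrough.set) R.loopAt-nil)
          alive-loop (x ∷ ru) eq = by (strategy ru) (R.loopAt (x ∷ ru)) eq
            where
            by : ∀ m ml {D} → Maybe.map R.LoopThrough.set ml ≡ just D → ∃[ a ] (proj₁ (advance ru x m ml) ≡ just a)
            by (just a) ml       _ = _ , refl
            by nothing  (just l) _ = _ , refl

          module _ (ξ : X ^ω) where

            alive-from : ∀ k {t} → Alive (rev↾ ξ t) → Alive (rev↾ ξ (k + t))
            alive-from zero        al = al
            alive-from (suc k) {t} al = alive-step (rev↾ ξ (k + t)) (ξ (k + t)) (alive-from k al)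

            abstract
              alive₀ : Alive (rev↾ ξ T₀)
              alive₀ =
                let t , t≤ , D , eq = R.loop-by-size ξ
                in subst (λ i → Alive (rev↾ ξ i)) (m∸n+n≡m t≤) (alive-from (T₀ ∸ t) (alive-loop (rev↾ ξ t) eq))

            alive : ∀ k → Alive (rev↾ ξ (k + T₀))
            alive k = alive-from k alive₀

            cfg : ℕ → Config
            cfg k = conf (proj₁ (alive k))

            mv : ∀ k → Move (cfg k) (R.loopSet (rev↾ ξ (suc k + T₀)))
            mv k = Transition.move′ (step (rev↾ ξ (k + T₀)) (ξ (k + T₀)) (proj₁ (alive k)))

            word≡ : ∀ k → emit (rev↾ ξ (k + T₀)) (ξ (k + T₀)) ≡ Move.word (mv k)
            word≡ k = emit-step (rev↾ ξ (k + T₀)) (ξ (k + T₀)) (alive k)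

            enters : N.δ* N.init (entry (rev↾ ξ T₀)) ≡ point (cfg 0)
            enters = trans (cong (λ m → N.δ* N.init (entryWord m)) (proj₂ alive₀))
                           (proj₂ (N.loop-reachable (codLoop (cfg 0)) (point∈ (cfg 0))))

            module Limit {T} (below : ∀ t → T ≤ t → ∀ {D} → R.loopSet (rev↾ ξ t) ≡ just D → D ⊆ ⟦ M.Inf ξ ⟧)
                         (k₁ : ℕ) (T≤ : T ≤ suc k₁ + T₀)
                             (hit : R.loopSet (rev↾ ξ (suc k₁ + T₀)) ≡ just ⟦ M.Inf ξ ⟧) where

              c* : Config
              c* = cfg (suc k₁)

              dom* : dom c* ≡ ⟦ M.Inf ξ ⟧
              dom* = Move.dom≡ (mv k₁) hit

              below* : ∀ k → suc k₁ ≤ k → ∀ {D} → R.loopSet (rev↾ ξ (suc k + T₀)) ≡ just D → D ⊆ dom c*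
              below* k le {D} eq = subst (D ⊆_) (sym dom*)
                (below (suc k + T₀) (≤-trans T≤ (+-monoˡ-≤ T₀ (m≤n⇒m≤1+n le))) eq)

              above* : ∀ d → c* ⊑ᶜ cfg (d + suc k₁)
              above* zero    = ⊑ᶜ-refl
              above* (suc d) = Moved.kept (Move.moved (mv (d + suc k₁)) (above* d)
                (λ {D} → below* (d + suc k₁) (m≤n+m (suc k₁) d) {D}))

              moved* : ∀ k → suc k₁ ≤ k →
                       Moved c* (cfg (suc k)) (point (cfg k)) (toList (Move.word (mv k)))
                           (R.loopSet (rev↾ ξ (suc k + T₀)))
              moved* k le = Move.moved (mv k) (subst (λ i → c* ⊑ᶜ cfg i) (m∸n+n≡m le) (above* (k ∸ suc k₁)))
                (λ {D} → below* k le {D})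

              -- All loops closed after `c*` lie in its domain, so `within` confines the output to
              -- `cod c*`. Whenever the loop `Inf ξ` is closed again, `reset` returns to `c*` and
              -- `covers` gives a full tour of its image.
              Inf* : ∀ {q} → q ∈ cod c* ⇔ N.Inf (answer ξ) q
              Inf* = N.cat-Inf (_∈ cod c*) (suc k₁) (entry (rev↾ ξ T₀)) {qs = λ k → point (cfg k)} enters
                (λ k → trans (cong (λ w → N.δ* (point (cfg k)) (toList w)) (word≡ k)) (Move.leads (mv k)))
                (λ k le {r} v → Moved.within (moved* k le)
                  (subst (λ w → N.Visits (point (cfg k)) (toList w) r) (word≡ k) v))
                often
                where
                often : ∀ K → ∃[ k ] (K ≤ k × (∀ {r} → r ∈ cod c* →
                          N.Visits (point (cfg k)) (toList (emit (rev↾ ξ (k + T₀)) (ξ (k + T₀)))) r))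
                often K = at (R.loops-reach-Inf ξ (suc (K ⊔ⁿ suc k₁) + T₀))
                  where
                  at : ∃[ t ] (suc (K ⊔ⁿ suc k₁) + T₀ ≤ t × R.loopSet (rev↾ ξ t) ≡ just ⟦ M.Inf ξ ⟧) → _
                  at (suc t , s≤s le , eq) =
                    κ , ≤-trans (m≤m⊔n K (suc k₁)) K≤k , λ {r} r∈ →
                      subst (λ w → N.Visits (point (cfg κ)) (toList w) r) (sym (word≡ κ))
                        (Move.covers (mv κ) (subst (λ c → r ∈ cod c)
                            (sym (Moved.reset (moved* κ (≤-trans (m≤n⊔m K (suc k₁)) K≤k)) set≡)) r∈))
                    where
                    κ = t ∸ T₀
                    K≤k : K ⊔ⁿ suc k₁ ≤ κ
                    K≤k = subst (_≤ κ) (m+n∸n≡m (K ⊔ⁿ suc k₁) T₀) (∸-monoˡ-≤ T₀ le)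
                    set≡ : R.loopSet (rev↾ ξ (suc κ + T₀)) ≡ just (dom c*)
                    set≡ = trans (cong (λ i → R.loopSet (rev↾ ξ (suc i))) (m∸n+n≡m (≤-trans (m≤n+m T₀ _) le)))
                                 (trans eq (cong just (sym dom*)))

              labels : A ξ ≡ B (answer ξ)
              labels = trans
                (sym (SM.Inf-label (domLoop c*) (mk⇔ (λ q∈ → ∈⟦⟧⁻ (subst (_ ∈_) dom* q∈))
                                                     (λ io → subst (_ ∈_) (sym dom*) (∈⟦⟧⁺ io)))))
                (trans (label≡ c*) (SN.Inf-label (codLoop c*) Inf*))

            correct : A ξ ≡ B (answer ξ)
            correct = at (R.loops-below-Inf ξ)
              where
              at : ∃[ T ] (∀ t → T ≤ t → ∀ {D} → R.loopSet (rev↾ ξ t) ≡ just D → D ⊆ ⟦ M.Inf ξ ⟧) → A ξ ≡ B (answer ξ)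
              at (T , below) = hit (R.loops-reach-Inf ξ (suc T₀ ⊔ⁿ T))
                where
                hit : ∃[ t ] (suc T₀ ⊔ⁿ T ≤ t × R.loopSet (rev↾ ξ t) ≡ just ⟦ M.Inf ξ ⟧) → A ξ ≡ B (answer ξ)
                hit (zero , le , _) = contradiction (≤-trans (m≤m⊔n (suc T₀) T) le) λ ()
                hit (suc t , le , eq) = Limit.labels (λ t le {D} → below t le {D}) (t ∸ T₀)
                  (≤-trans (m≤n⊔m (suc T₀) T) (subst (suc T₀ ⊔ⁿ T ≤_) (sym t≡) le))
                  (trans (cong (λ i → R.loopSet (rev↾ ξ i)) t≡) eq)
                  where
                  t≡ : suc (t ∸ T₀) + T₀ ≡ suc t
                  t≡ = cong suc (m∸n+n≡m (s≤s⁻¹ (≤-trans (m≤m⊔n (suc T₀) T) le)))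

        reduction : A ≤CA B
        reduction = answer , answer-continuous , correct

  -- Iterates of monotone maps and saturating counters

  iter : {A : Set} → (A → A) → ℕ → A → A
  iter f zero    x = x
  iter f (suc n) x = iter f n (f x)

  foldl-replicate : {A B : Set} (δ : A → B → A) (u : List B) → ∀ n q →
                    foldl δ q (concat (replicate n u)) ≡ iter (λ q → foldl δ q u) n q
  foldl-replicate δ u zero    q = refl
  foldl-replicate δ u (suc n) q =
    trans (foldl-++ δ q u (concat (replicate n u))) (foldl-replicate δ u n (foldl δ q u))

  iter-fixed : {A : Set} (f : A → A) → ∀ {x} → f x ≡ x → ∀ n → iter f n x ≡ x
  iter-fixed f eq zero    = refl
  iter-fixed f eq (suc n) = trans (cong (iter f n) eq) (iter-fixed f eq n)

  -- If `x` is at most `f x`, the orbit increases, so `f x` is at most the iterate that equals `x`.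
  -- The other case is dual.
  monotone-periodic : ∀ {n} (f : Fin n → Fin n) → (∀ {x y} → toℕ x ≤ toℕ y → toℕ (f x) ≤ toℕ (f y)) →
                      ∀ j x → iter f (suc j) x ≡ x → f x ≡ x
  monotone-periodic f mono j x eq with ≤-total (toℕ x) (toℕ (f x))
  ... | inj₁ up = toℕ-injective (≤-antisym (subst (λ y → toℕ (f x) ≤ toℕ y) eq (rises j (mono up))) up)
    where
    rises : ∀ n {y} → toℕ y ≤ toℕ (f y) → toℕ y ≤ toℕ (iter f n y)
    rises zero    le = ≤-refl
    rises (suc n) le = ≤-trans le (rises n (mono le))
  ... | inj₂ dn = toℕ-injective (≤-antisym dn (subst (λ y → toℕ y ≤ toℕ (f x)) eq (falls j (mono dn))))
    where
    falls : ∀ n {y} → toℕ (f y) ≤ toℕ y → toℕ (iter f n y) ≤ toℕ y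
    falls zero    le = ≤-refl
    falls (suc n) le = ≤-trans (falls n (mono le)) le

  -- The successor saturates at the maximum and so stays monotone; counting modulo would create
  -- proper cycles.
  incr : ∀ {n} → Fin (suc n) → Fin (suc n)
  incr {zero}  zero    = zero
  incr {suc n} zero    = suc zero
  incr {suc n} (suc c) = suc (incr c)

  incr-mono : ∀ {n} {c d : Fin (suc n)} → toℕ c ≤ toℕ d → toℕ (incr c) ≤ toℕ (incr d)
  incr-mono {zero}  {zero}  {zero}  le       = z≤n
  incr-mono {suc n} {zero}  {zero}  le       = ≤-refl
  incr-mono {suc n} {zero}  {suc d} le       = s≤s z≤n
  incr-mono {suc n} {suc c} {suc d} (s≤s le) = s≤s (incr-mono le)

  toℕ-incr : ∀ {n} {c d : Fin (suc n)} → toℕ c < toℕ d → toℕ (incr c) ≡ suc (toℕ c)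
  toℕ-incr {suc n} {zero}  {suc d} lt       = refl
  toℕ-incr {suc n} {suc c} {suc d} (s≤s lt) = cong suc (toℕ-incr lt)

  incr≢⇒< : ∀ {n} {c : Fin (suc n)} → incr c ≢ c → toℕ c < toℕ (incr c)
  incr≢⇒< {zero}  {zero}  ne = contradiction refl ne
  incr≢⇒< {suc n} {zero}  ne = s≤s z≤n
  incr≢⇒< {suc n} {suc c} ne = s≤s (incr≢⇒< (ne ∘ cong suc))

  -- Greatest lower bounds in trees

  module _ {A : Set} (T : Tree A) where
    private
      module T = Tree T
      module PO = IsPartialOrder T.isPartialOrder

    record Glb (Y : Fin T.size → Set) (g : Fin T.size) : Set where
      constructor glb
      field
        lower    : ∀ {t} → Y t → g T.⊑ t
        greatest : ∀ {h} → (∀ {t} → Y t → h T.⊑ t) → h T.⊑ g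

    Glb-unique : ∀ {Y g g′} → Glb Y g → Glb Y g′ → g ≡ g′
    Glb-unique (glb l m) (glb l′ m′) = PO.antisym (m′ l) (m l′)

    Glb-least : ∀ {Y g} → Y g → (∀ {t} → Y t → g T.⊑ t) → Glb Y g
    Glb-least y l = glb l (λ h → h y)

    -- The lower bounds of a nonempty set all lie below one element and hence form a finite chain,
    -- which contains the root; its greatest element is the meet.
    Glb-exists : ∀ {Y y} → Y y → ∃[ g ] Glb Y g
    Glb-exists {Y} {y} Yy = go T.root (spo-noetherian ⊏-spo T.root) (λ _ → T.rootLeast _)
      where
      _⊏_ : Fin T.size → Fin T.size → Set
      x ⊏ y = x T.⊑ y × x ≢ y
      ⊏-spo = ToStrict.<-isStrictPartialOrder _≡_ T._⊑_ T.isPartialOrder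
      Lower : Fin T.size → Set
      Lower h = ∀ {t} → Y t → h T.⊑ t
      go : ∀ h → Acc (flip _⊏_) h → Lower h → ∃[ g ] Glb Y g
      go h (acc rs) l with em {∃[ h′ ] (h ⊏ h′ × (∀ t → Y t → h′ T.⊑ t))}
      ... | yes (h′ , lt , l′) = go h′ (rs lt) (λ Yt → l′ _ Yt)
      ... | no none = h , glb l greatest
        where
        greatest : ∀ {h′} → Lower h′ → h′ T.⊑ h
        greatest {h′} l′ with T.lowerConeChain (l′ Yy) (l Yy)
        ... | inj₁ le = le
        ... | inj₂ ge with em {h ≡ h′}
        ... | yes refl = PO.refl
        ... | no ne = contradiction (h′ , (ge , ne) , λ t Yt → l′ Yt) none

  -- Aperiodic automata realising forests

  module _ {X : Set} {k : ℕ} (a b : X) (a≢b : b ≢ a) where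

    private
      module S₀ = Simulation (≡-preorder (Fin k))
      module S₁ = Simulation (Poset.preorder (𝓣 k))

    module Realise (P : Forest (Tree (Fin k))) where
      private
        module P = Forest P
        module PO = IsPartialOrder P.isPartialOrder
        module T (p : Fin P.size) = Tree (P.label p)
        module TO (p : Fin P.size) = IsPartialOrder (T.isPartialOrder p)

        Position : Set
        Position = Σ[ p ∈ Fin P.size ] Fin (T.size p)

        first : ∀ {n} → 0 < n → Fin n
        first {suc n} _ = zero

        positions : List Position
        positions = concatMap (λ p → map (p ,_) (allFin (T.size p))) (allFin P.size)

        ∈-positions : ∀ s → s ∈ˡ positions
        ∈-positions (p , t) = ∈-concatMap⁺ (λ p → map (p ,_) (allFin (T.size p)))
          (Any.map (λ { refl → ∈-map⁺ (p ,_) (∈-allFin t) }) (∈-allFin p))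

        -- The extra command in front makes `K` a successor, as `incr` requires, and gives a meaning
        -- to the counter value `zero`; every `code` is positive.
        commands : List Position
        commands = (first P.nonEmpty , T.root (first P.nonEmpty)) ∷ positions

        K : ℕ
        K = suc (length positions)

        command : Fin K → Position
        command = lookup commands

        code : Position → Fin K
        code s = suc (index (∈-positions s))

        command-code : ∀ s → command (code s) ≡ s
        command-code s = sym (lookup-index (∈-positions s))

        -- The current position, once one has been chosen, and the number of
        -- a's (up to K - 1) read since the last other letter; the letter b
        -- executes the command with that number.
        Q : Set
        Q = Maybe Position × Fin K

        -- Commands that would not go upwards in the outer forest are ignored. Within one outer node
        -- every move is allowed, so its inner nodes lie on common loops.
        execute : Position → Position → Position
        execute (p , t) s′ with em {p P.⊑ proj₁ s′}
        ... | yes _ = s′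
        ... | no  _ = p , t

        stepC : X → Fin K → Fin K
        stepC x c with em {x ≡ a}
        ... | yes _ = incr c
        ... | no  _ = zero

        stepS : X → Fin K → Position → Position
        stepS x c s with em {x ≡ a}
        ... | yes _ = s
        ... | no  _ = execute s (command c)

        -- A full counter makes a further `a` execute as well. Otherwise the word consisting only of
        -- `a` would form a loop without a position, to which no label could be given.
        begin : X → Fin K → Q
        begin x c with em {x ≡ a} | em {incr c ≡ c}
        ... | yes _ | no _  = nothing , incr c
        ... | yes _ | yes _ = just (command c) , zero
        ... | no _  | _     = just (command c) , zero

        δQ : Q → X → Q
        δQ (nothing , c) x = begin x c
        δQ (just s , c)  x = just (stepS x c s) , stepC x c

        δQ* : Q → List X → Q
        δQ* = foldl δQ

        decode? : Fin (suc K) → Maybe Position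
        decode? zero    = nothing
        decode? (suc i) = just (command i)

        encode? : Maybe Position → Fin (suc K)
        encode? nothing  = zero
        encode? (just s) = suc (code s)

        decode-encode? : ∀ m → decode? (encode? m) ≡ m
        decode-encode? nothing  = refl
        decode-encode? (just s) = cong just (command-code s)

        encodeQ : Q → Fin (suc K * K)
        encodeQ (m , c) = combine (encode? m) c

        decodeQ : Fin (suc K * K) → Q
        decodeQ i = let j , c = remQuot K i in decode? j , c

      abstract
        automaton : Automaton X
        automaton = record
          { size = suc K * K ; δ = λ i x → encodeQ (δQ (decodeQ i) x) ; init = encodeQ (nothing , zero) }

      private
        module M = Run automaton

        abstract
          enc : Q → M.State
          enc = encodeQ

          dec : M.State → Q
          dec = decodeQ

          dec-enc : ∀ q → dec (enc q) ≡ q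
          dec-enc (m , c) = trans (cong (λ (j , c) → decode? j , c) (remQuot-combine (encode? m) c))
                                  (cong (_, c) (decode-encode? m))

          init-enc : M.init ≡ enc (nothing , zero)
          init-enc = refl

          δ-dec : ∀ z x → M.δ z x ≡ enc (δQ (dec z) x)
          δ-dec z x = refl

        δ-enc : ∀ q x → M.δ (enc q) x ≡ enc (δQ q x)
        δ-enc q x = trans (δ-dec (enc q) x) (cong (λ q → enc (δQ q x)) (dec-enc q))

        δ*-enc : ∀ q u → M.δ* (enc q) u ≡ enc (δQ* q u)
        δ*-enc q []      = refl
        δ*-enc q (x ∷ u) = trans (cong (λ z → M.δ* z u) (δ-enc q x)) (δ*-enc (δQ q x) u)

        dec-δ* : ∀ z u → dec (M.δ* z u) ≡ δQ* (dec z) u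
        dec-δ* z []      = refl
        dec-δ* z (x ∷ u) = trans (dec-δ* (M.δ z x) u)
          (cong (λ q → δQ* q u) (trans (cong dec (δ-dec z x)) (dec-enc (δQ (dec z) x))))

        -- Runs from a position

        execute-⊑ : ∀ s s′ → proj₁ s P.⊑ proj₁ (execute s s′)
        execute-⊑ (p , t) s′ with em {p P.⊑ proj₁ s′}
        ... | yes le = le
        ... | no  _  = PO.refl

        stepS-⊑ : ∀ x c s → proj₁ s P.⊑ proj₁ (stepS x c s)
        stepS-⊑ x c s with em {x ≡ a}
        ... | yes _ = PO.refl
        ... | no  _ = execute-⊑ s (command c)

        stepC-mono : ∀ x {c d} → toℕ c ≤ toℕ d → toℕ (stepC x c) ≤ toℕ (stepC x d)
        stepC-mono x le with em {x ≡ a}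
        ... | yes _ = incr-mono le
        ... | no  _ = z≤n

        runC : List X → Fin K → Fin K
        runC []      c = c
        runC (x ∷ u) c = runC u (stepC x c)

        runS : List X → Fin K → Position → Position
        runS []      c s = s
        runS (x ∷ u) c s = runS u (stepC x c) (stepS x c s)

        δQ*-just : ∀ u s c → δQ* (just s , c) u ≡ (just (runS u c s) , runC u c)
        δQ*-just []      s c = refl
        δQ*-just (x ∷ u) s c = δQ*-just u (stepS x c s) (stepC x c)

        runC-mono : ∀ u {c d} → toℕ c ≤ toℕ d → toℕ (runC u c) ≤ toℕ (runC u d)
        runC-mono []      le = le
        runC-mono (x ∷ u) le = runC-mono u (stepC-mono x le)

        runS-⊑ : ∀ u c s → proj₁ s P.⊑ proj₁ (runS u c s)
        runS-⊑ []      c s = PO.refl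
        runS-⊑ (x ∷ u) c s = PO.trans (stepS-⊑ x c s) (runS-⊑ u (stepC x c) (stepS x c s))

        -- A command depends on the position only through its first component,
        -- so the first accepted command makes two runs coincide.
        runS-merge : ∀ u c {p} t t′ → runS u c (p , t) ≡ runS u c (p , t′) ⊎
                     (runS u c (p , t) ≡ (p , t) × runS u c (p , t′) ≡ (p , t′))
        runS-merge []      c t t′ = inj₂ (refl , refl)
        runS-merge (x ∷ u) c {p} t t′ with em {x ≡ a}
        ... | yes _ = runS-merge u (incr c) t t′
        ... | no _ with em {p P.⊑ proj₁ (command c)}
        ... | yes _ = inj₁ refl
        ... | no _  = runS-merge u zero t t′

        begin-< : ∀ x c {c′} → begin x c ≡ (nothing , c′) → toℕ c < toℕ c′
        begin-< x c eq with em {x ≡ a} | em {incr c ≡ c}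
        begin-< x c refl | yes _ | no ne = incr≢⇒< ne

        δQ*-nothing : ∀ u c {c′} → δQ* (nothing , c) u ≡ (nothing , c′) → toℕ c ≤ toℕ c′
        δQ*-nothing []      c refl = ≤-refl
        δQ*-nothing (x ∷ u) c eq with begin x c in e
        ... | nothing , c₁ = ≤-trans (<⇒≤ (begin-< x c e)) (δQ*-nothing u c₁ eq)
        ... | just s , c₁ with () ← trans (sym (cong proj₁ (δQ*-just u s c₁))) (cong proj₁ eq)

        -- As long as no position has been chosen, every letter strictly increases the counter; a
        -- chosen position is never given up.
        no-return : ∀ x u {c} → δQ* (nothing , c) (x ∷ u) ≢ (nothing , c)
        no-return x u {c} eq with begin x c in e
        ... | nothing , c₁ = <⇒≱ (begin-< x c e) (δQ*-nothing u c₁ eq)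
        ... | just s , c₁ with () ← trans (sym (cong proj₁ (δQ*-just u s c₁))) (cong proj₁ eq)

        module _ (u : List X) where
          private
            g : Position × Fin K → Position × Fin K
            g (s , c) = runS u c s , runC u c

            lift : Position × Fin K → Q
            lift (s , c) = just s , c

            iter-lift : ∀ n y → iter (λ q → δQ* q u) n (lift y) ≡ lift (iter g n y)
            iter-lift zero    y       = refl
            iter-lift (suc n) (s , c) = trans (cong (iter (λ q → δQ* q u) n) (δQ*-just u s c))
                (iter-lift n (g (s , c)))

            iter-counter : ∀ n y → proj₂ (iter g n y) ≡ iter (runC u) n (proj₂ y)
            iter-counter zero    y = refl
            iter-counter (suc n) y = iter-counter n (g y)

            iter-⊑ : ∀ n y → proj₁ (proj₁ y) P.⊑ proj₁ (proj₁ (iter g n y))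
            iter-⊑ zero    y       = PO.refl
            iter-⊑ (suc n) (s , c) = PO.trans (runS-⊑ u c s) (iter-⊑ n (g (s , c)))

            -- The counter evolves monotonically and is therefore fixed; the outer node only moves
            -- up and returns, so it is fixed too. By `runS-merge` the inner node either stays or is
            -- fixed after one round, and periodicity then puts it back at its start.
            periodic : ∀ n y → iter g (suc n) y ≡ y → g y ≡ y
            periodic n ((p , t) , c) eq = by (runS u c (p , t)) refl same-p
              where
              same-c : runC u c ≡ c
              same-c = monotone-periodic (runC u) (runC-mono u) n c
                         (trans (sym (iter-counter (suc n) ((p , t) , c))) (cong proj₂ eq))
              same-p : p ≡ proj₁ (runS u c (p , t))
              same-p = PO.antisym (runS-⊑ u c (p , t))
                (subst (λ y → proj₁ (runS u c (p , t)) P.⊑ proj₁ (proj₁ y)) eq (iter-⊑ n (g ((p , t) , c))))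
              by : ∀ s′ → runS u c (p , t) ≡ s′ → p ≡ proj₁ s′ → g ((p , t) , c) ≡ ((p , t) , c)
              by (.p , t′) eq′ refl with runS-merge u c {p} t t′
              ... | inj₂ (stays , _) = cong₂ _,_ stays same-c
              ... | inj₁ merge = trans (sym (iter-fixed g fixed n)) eq
                where
                fixed : g (g ((p , t) , c)) ≡ g ((p , t) , c)
                fixed = cong₂ _,_ (trans (cong₂ (runS u) same-c eq′) (sym merge)) (cong (runC u) same-c)

          just-periodic : ∀ n s c → iter (λ q → δQ* q u) (suc n) (just s , c) ≡ (just s , c) →
                          δQ* (just s , c) u ≡ (just s , c)
          just-periodic n s c eq = trans (δQ*-just u s c)
              (cong lift (periodic n (s , c) (unlift (trans (sym (iter-lift (suc n) (s , c))) eq))))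
            where
            unlift : ∀ {y y′} → lift y ≡ lift y′ → y ≡ y′
            unlift refl = refl

        Q-aperiodic : ∀ q x u n → iter (λ q → δQ* q (x ∷ u)) (suc n) q ≡ q → δQ* q (x ∷ u) ≡ q
        Q-aperiodic (just s , c) x u n eq = just-periodic (x ∷ u) n s c eq
        Q-aperiodic (nothing , c) x u n eq = contradiction
          (trans (foldl-replicate δQ (x ∷ u) (suc n) (nothing , c)) eq)
          (no-return x (u ++ concat (replicate n (x ∷ u))))

      -- `decodeQ` is not injective, so `q` may lie outside the image of `enc`. After a nonempty
      -- word every state lies in that image, so the states after one round and after all rounds can
      -- be compared there; the latter is `q`.
      aperiodic : Automaton.Aperiodic automaton
      aperiodic q []      n       u≢[] _  eq = contradiction refl u≢[]
      aperiodic q (x ∷ u) (suc n) _    _  eq =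
        trans (to-enc x u) (trans (cong enc back) (trans (sym (to-enc x (u ++ concat (replicate n (x ∷ u))))) eq))
        where
        to-enc : ∀ x u → M.δ* q (x ∷ u) ≡ enc (δQ* (dec q) (x ∷ u))
        to-enc x u = trans (cong (λ z → M.δ* z u) (δ-dec q x)) (δ*-enc (δQ (dec q) x) u)
        periodic : δQ* (dec q) (concat (replicate (suc n) (x ∷ u))) ≡ dec q
        periodic = trans (sym (dec-δ* q (concat (replicate (suc n) (x ∷ u))))) (cong dec eq)
        back : δQ* (dec q) (x ∷ u) ≡ δQ* (dec q) (concat (replicate (suc n) (x ∷ u)))
        back = trans (Q-aperiodic (dec q) x u n
            (trans (sym (foldl-replicate δQ (x ∷ u) (suc n) (dec q))) periodic))
                     (sym periodic)

      private
        At : M.State → (p : Fin P.size) → Fin (T.size p) → Set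
        At z p t = ∃[ c ] (dec z ≡ (just (p , t) , c))

        At-unique : ∀ {z p p′ t t′} → At z p t → At z p′ t′ → (p , t) ≡ (p′ , t′)
        At-unique (_ , eq) (_ , eq′) = just-injective (cong proj₁ (trans (sym eq) eq′))

        At-⊑ : ∀ {z z′ p p′ t t′} → M.Reachable z z′ → At z p t → At z′ p′ t′ → p P.⊑ p′
        At-⊑ {z} {_} {p} {p′} {t} (w , refl) (c , eq) (c′ , eq′) =
          subst (λ s → p P.⊑ proj₁ s) same (runS-⊑ w c (p , t))
          where
          same : runS w c (p , t) ≡ (p′ , _)
          same = just-injective (cong proj₁
            (trans (sym (δQ*-just w (p , t) c))
              (trans (cong (λ q → δQ* q w) (sym eq)) (trans (sym (dec-δ* z w)) eq′))))

        positioned : ∀ {D} → M.Loop D → ∀ {z} → z ∈ D → ∃[ p ] ∃[ t ] At z p t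
        positioned L {z} z∈ = by (dec z) refl (M.loop-path L z∈ z∈)
          where
          by : ∀ q → dec z ≡ q → M.Path _ z z → ∃[ p ] ∃[ t ] At z p t
          by (just (p , t) , c) eq _ = p , t , c , eq
          by (nothing , c) eq (M.path (x ∷ u) leads _ _) = contradiction
            (trans (cong (λ q → δQ* q (x ∷ u)) (sym eq))
                (trans (sym (dec-δ* z (x ∷ u))) (trans (cong dec leads) eq)))
            (no-return x u)

        record Desc (D : Subset M.size) (p : Fin P.size) (g : Fin (T.size p)) : Set where
          constructor desc
          field
            outerNode : ∀ {z} → z ∈ D → ∃[ t ] At z p t
            meet      : Glb (P.label p) (λ t → ∃[ z ] (z ∈ D × At z p t)) g

        -- States of a loop reach each other and the outer node never moves down, so by antisymmetry
        -- they share it.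
        desc-exists : ∀ {D} → M.Loop D → ∃[ p ] ∃[ g ] Desc D p g
        desc-exists {D} L = from (positioned L z₀∈)
          where
          z₀ = proj₁ (M.point L)
          z₀∈ = proj₂ (M.point L)
          from : ∃[ p ] ∃[ t ] At z₀ p t → ∃[ p ] ∃[ g ] Desc D p g
          from (p , t , at) = p , proj₁ m , desc here-too (proj₂ m)
            where
            m = Glb-exists (P.label p) {λ t → ∃[ z ] (z ∈ D × At z p t)} (z₀ , z₀∈ , at)
            here-too : ∀ {z} → z ∈ D → ∃[ t ] At z p t
            here-too {z} z∈ = same (positioned L z∈)
              where
              same : ∃[ p′ ] ∃[ t′ ] At z p′ t′ → ∃[ t ] At z p t
              same (p′ , t′ , at′) = subst (λ p → ∃[ t ] At z p t)
                (PO.antisym (At-⊑ (M.loop-connected L z∈ z₀∈) at′ at) (At-⊑ (M.loop-connected L z₀∈ z∈) at at′))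
                (t′ , at′)

        desc-node : ∀ {D D′ p p′ g} → D′ ⊆ D → M.Loop D′ →
            (∀ {z} → z ∈ D → ∃[ t ] At z p t) → Desc D′ p′ g → p ≡ p′
        desc-node sub L′ f (desc f′ _) =
          let z , z∈ = M.point L′
              _ , at = f (sub z∈)
              _ , at′ = f′ z∈
          in cong proj₁ (At-unique at at′)

        desc-label : ∀ {D p p′ g g′} → M.Loop D → Desc D p g → Desc D p′ g′ → T.label p g ≡ T.label p′ g′
        desc-label L d@(desc f m) d′ = by (desc-node id L f d′) d′
          where
          by : ∀ {p′ g′} → _ ≡ p′ → Desc _ p′ g′ → T.label _ _ ≡ T.label p′ g′
          by refl (desc _ m′) = cong (T.label _) (Glb-unique (P.label _) m m′)

      private
        Described : X ^ω → Fin k → Set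
        Described ξ i = ∃[ p ] ∃[ g ] (Desc ⟦ M.Inf ξ ⟧ p g × T.label p g ≡ i)

        describedBy : ∀ {ξ} → ∃[ p ] ∃[ g ] Desc ⟦ M.Inf ξ ⟧ p g → ∃[ i ] Described ξ i
        describedBy (p , g , d) = T.label p g , p , g , d , refl

      abstract
        partition : Partition k X
        partition ξ = proj₁ (describedBy (desc-exists (M.Inf-Loop ξ)))

        partition-described : ∀ ξ → Described ξ (partition ξ)
        partition-described ξ = proj₂ (describedBy (desc-exists (M.Inf-Loop ξ)))

      private
        described-unique : ∀ {ξ i j} → Described ξ i → Described ξ j → i ≡ j
        described-unique {ξ} (p , g , d , eq) (p′ , g′ , d′ , eq′) =
          trans (sym eq) (trans (desc-label (M.Inf-Loop ξ) d d′) eq′)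

        Inf-set : ∀ {D ξ} → (∀ {q} → q ∈ D ⇔ M.Inf ξ q) → D ≡ ⟦ M.Inf ξ ⟧
        Inf-set f = ⊆-antisym (λ x → ∈⟦⟧⁺ (Equivalence.to f x)) (λ x → Equivalence.from f (∈⟦⟧⁻ x))

        partition-label : ∀ {D ξ p g} → (∀ {q} → q ∈ D ⇔ M.Inf ξ q) → Desc D p g → partition ξ ≡ T.label p g
        partition-label {D} {ξ} {p} {g} f d =
          described-unique {ξ} (partition-described ξ) (p , g , subst (λ D → Desc D p g) (Inf-set f) d , refl)

      determines : InfDetermines automaton partition
      determines ξ η to from = at (partition-described ξ)
        where
        at : Described ξ (partition ξ) → partition ξ ≡ partition η
        at (p , g , d , eq) = trans (sym eq)
          (sym (partition-label (mk⇔ (λ x → to _ (∈⟦⟧⁻ x)) (λ x → ∈⟦⟧⁺ (from _ x))) d))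

      acceptor : Fin k → MullerAcceptor X
      acceptor i = record { automaton = automaton ; 𝓕 = λ S → ∃[ p ] ∃[ g ] (Desc S p g × T.label p g ≡ i) }

      recognises : ∀ i → MullerAcceptor.Recognises (acceptor i) (component partition i)
      recognises i ξ = mk⇔ (to (partition-described ξ)) from
        where
        to : Described ξ (partition ξ) → partition ξ ≡ i → MullerAcceptor.Accepts (acceptor i) ξ
        to (p , g , d , eq) eq′ = ⟦ M.Inf ξ ⟧ , (p , g , d , trans eq eq′) , λ q → mk⇔ ∈⟦⟧⁻ ∈⟦⟧⁺
        from : MullerAcceptor.Accepts (acceptor i) ξ → partition ξ ≡ i
        from (S , (p , g , d , eq) , inf) = trans (partition-label {S} {ξ} {p} {g} (λ {q} → inf q) d) eq

      components : ∀ i → AperiodicLanguage (component partition i)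
      components i = acceptor i , aperiodic , recognises i

      private
        module St = Structure automaton partition determines

        loop-label : ∀ {D p g} (L : M.Loop D) → Desc D p g → St.loopLabel L ≡ T.label p g
        loop-label (ξ , f) d = partition-label f d

        -- A smaller loop visits fewer inner nodes, so the meet of these nodes is higher: reverse
        -- inclusion of loops becomes the tree order.
        inner⇒ : ∀ {C p} → M.Loop C → (∀ {z} → z ∈ C → ∃[ t ] At z p t) →
                 S₀.Sim (St.Inn C) (forestLabelled (T.forest p))
        inner⇒ {C} {p} LC f = record
          { R       = λ x t → Desc (St.Inner.set x) p t
          ; total   = describe
          ; forth   = λ { {x} {_} {x′} (desc _ m) (St.sup sub) → down m sub (describe x′) }
          ; label-≲ = λ {x} d → loop-label (St.Inner.loop x) d
          }
          where
          recentre : ∀ {D p′ g} → p ≡ p′ → Desc D p′ g → ∃[ g ] Desc D p g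
          recentre refl d = _ , d
          describe : (x : St.Inner C) → ∃[ g ] Desc (St.Inner.set x) p g
          describe x = let _ , _ , d = desc-exists (St.Inner.loop x)
                       in recentre (desc-node (St.Inner.below x) (St.Inner.loop x) f d) d
          down : ∀ {D D′ t} → Glb (P.label p) (λ t → ∃[ z ] (z ∈ D × At z p t)) t → D′ ⊆ D →
                 ∃[ g ] Desc D′ p g → ∃[ t′ ] (T._⊑_ p t t′ × Desc D′ p t′)
          down m sub (g , d) = g , Glb.greatest (Desc.meet d) (λ (z , z∈ , at) → Glb.lower m (z , sub z∈ , at)) , d

      out⇒ : S₁.Sim St.Out (forestLabelled P)
      out⇒ = record
        { R       = λ C p → ∀ {z} → z ∈ St.Outer.set C → ∃[ t ] At z p t
        ; total   = λ C → let p , _ , d = desc-exists (St.Outer.loop C) in p , Desc.outerNode d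
        ; forth   = λ { {_} {_} {C′} f (z , z∈ , z′ , z′∈ , r) →
            let p′ , _ , d = desc-exists (St.Outer.loop C′)
            in p′ , At-⊑ r (proj₂ (f z∈)) (proj₂ (Desc.outerNode d z′∈)) , Desc.outerNode d }
        ; label-≲ = λ {C} {p} f → S₀.Sim⇒hom {Tree.forest (St.innerTree (St.Outer.loop C))} {T.forest p}
            (S₀.Sim-trans (St.innerTree⇒ (St.Outer.loop C)) (inner⇒ (St.Outer.loop C) f))
        }

      private
        -- The counters are bounded by what a tour of the inner nodes above t
        -- needs, a bound that decreases as t goes up.
        Above : (p : Fin P.size) → Fin (T.size p) → M.State → Set
        Above p t z = ∃[ t′ ] (T._⊑_ p t t′ × ∃[ c ] (z ≡ enc (just (p , t′) , c) ×
                        ∃[ t″ ] (T._⊑_ p t t″ × toℕ c ≤ toℕ (code (p , t″)))))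

        stepC-a : ∀ c → stepC a c ≡ incr c
        stepC-a c with em {a ≡ a}
        ... | yes _ = refl
        ... | no ne = contradiction refl ne

        stepS-a : ∀ c s → stepS a c s ≡ s
        stepS-a c s with em {a ≡ a}
        ... | yes _ = refl
        ... | no ne = contradiction refl ne

        stepC-b : ∀ c → stepC b c ≡ zero
        stepC-b c with em {b ≡ a}
        ... | yes eq = contradiction eq a≢b
        ... | no _   = refl

        stepS-b : ∀ c s → stepS b c s ≡ execute s (command c)
        stepS-b c s with em {b ≡ a}
        ... | yes eq = contradiction eq a≢b
        ... | no _   = refl

        execute-accept : ∀ s s′ → proj₁ s P.⊑ proj₁ s′ → execute s s′ ≡ s′
        execute-accept (p , t) s′ le with em {p P.⊑ proj₁ s′}
        ... | yes _ = refl
        ... | no ¬le = contradiction le ¬le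

        count : ∀ s c → M.δ (enc (just s , c)) a ≡ enc (just s , incr c)
        count s c = trans (δ-enc (just s , c) a) (cong₂ (λ s c → enc (just s , c)) (stepS-a c s) (stepC-a c))

        exec : ∀ s s′ → proj₁ s P.⊑ proj₁ s′ → M.δ (enc (just s , code s′)) b ≡ enc (just s′ , zero)
        exec s s′ le = trans (δ-enc (just s , code s′) b)
          (cong₂ (λ s c → enc (just s , c))
            (trans (stepS-b (code s′) s) (trans (cong (execute s) (command-code s′)) (execute-accept s s′ le)))
            (stepC-b (code s′)))

        Leg : (M.State → Set) → M.State → M.State → Set
        Leg Z z z′ = ∃[ w ] (M.δ* z w ≡ z′ × (∀ {r} → M.Visits z w r → Z r))

        Leg-++ : ∀ {Z z z′ z″} → Leg Z z z′ → Leg Z z′ z″ → Leg Z z z″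
        Leg-++ {_} {z} (u , refl , f) (v , eq , f′) =
          u ++ v , trans (M.δ*-++ z u v) eq , λ vis → [ f , f′ ]′ (M.Visits-++⁻ u vis)

        Leg-∷ : ∀ {Z z z′ z″} x → Z z → M.δ z x ≡ z′ → Leg Z z′ z″ → Leg Z z z″
        Leg-∷ x Zz refl (v , eq , f) = x ∷ v , eq , λ { M.here → Zz ; (M.there vis) → f vis }

        climb : ∀ {Z} s {d : Fin K} j (c : Fin K) → j + toℕ c ≡ toℕ d →
                (∀ c′ → toℕ c′ ≤ toℕ d → Z (enc (just s , c′))) → Leg Z (enc (just s , c)) (enc (just s , d))
        climb s zero c eq f = [] , cong (λ c → enc (just s , c)) (toℕ-injective eq) , λ ()
        climb s {d} (suc j) c eq f = Leg-∷ a (f c (<⇒≤ c<d)) (count s c)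
          (climb s j (incr c) (trans (cong (j +_) (toℕ-incr c<d)) (trans (+-suc j (toℕ c)) eq)) f)
          where
          c<d : toℕ c < toℕ d
          c<d = subst (toℕ c <_) eq (s≤s (m≤n+m (toℕ c) j))

        climb≤ : ∀ {Z} s {c d : Fin K} → toℕ c ≤ toℕ d →
                 (∀ c′ → toℕ c′ ≤ toℕ d → Z (enc (just s , c′))) → Leg Z (enc (just s , c)) (enc (just s , d))
        climb≤ s {c} {d} le f = climb s (toℕ d ∸ toℕ c) c (m∸n+n≡m le) f

        launch : ∀ s j (c : Fin K) → j + toℕ c ≡ toℕ (code s) →
            ∃[ u ] (M.δ* (enc (nothing , c)) u ≡ enc (just s , zero))
        launch s zero c eq = b ∷ [] , trans (δ-enc (nothing , c) b) (cong enc
            (trans (execute-first c) (cong (λ s → just s , zero)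
                (trans (cong command (toℕ-injective eq)) (command-code s)))))
          where
          execute-first : ∀ c → begin b c ≡ (just (command c) , zero)
          execute-first c with em {b ≡ a} | em {incr c ≡ c}
          ... | yes eq | _ = contradiction eq a≢b
          ... | no _ | yes _ = refl
          ... | no _ | no _ = refl
        launch s (suc j) c eq =
          let u , eq′ = launch s j (incr c) (trans (cong (j +_) (toℕ-incr c<d)) (trans (+-suc j (toℕ c)) eq))
          in a ∷ u , trans (cong (λ z → M.δ* z u) (trans (δ-enc (nothing , c) a) (cong enc (count-first c ne)))) eq′
          where
          c<d : toℕ c < toℕ (code s)
          c<d = subst (toℕ c <_) eq (s≤s (m≤n+m (toℕ c) j))
          ne : incr c ≢ c
          ne e = 1+n≢n (trans (sym (toℕ-incr c<d)) (cong toℕ e))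
          count-first : ∀ c → incr c ≢ c → begin a c ≡ (nothing , incr c)
          count-first c ne with em {a ≡ a} | em {incr c ≡ c}
          ... | no na | _ = contradiction refl na
          ... | yes _ | yes e = contradiction e ne
          ... | yes _ | no _ = refl

        Above-start : ∀ p t → Above p t (enc (just (p , t) , zero))
        Above-start p t = t , TO.refl p , zero , refl , t , TO.refl p , z≤n

        -- The counter may already have passed the code of `t₂`, and only executing a command resets
        -- it. The command of `t₃`, whose code bounds the counter by definition of `Above`, is
        -- executed first; then `t₂` is called from counter zero.
        Above-connected : ∀ p t {z z′} → Above p t z → Above p t z′ →
                          ∃[ w ] (M.δ* z (toList w) ≡ z′ × (∀ {r} → M.Visits z (toList w) r → Above p t r))
        Above-connected p t {z} (t₁ , le₁ , c₁ , refl , t₃ , le₃ , c₁≤) (t₂ , le₂ , c₂ , refl , t₄ , le₄ , c₂≤) =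
          join (climb≤ (p , t₁) c₁≤ (λ c′ le → t₁ , le₁ , c′ , refl , t₃ , le₃ , le))
               (t₁ , le₁ , code (p , t₃) , refl , t₃ , le₃ , ≤-refl)
               (exec (p , t₁) (p , t₃) PO.refl)
               (Leg-++ (climb≤ (p , t₃) {zero} {code (p , t₂)} z≤n (λ c′ le → t₃ , le₃ , c′ , refl , t₂ , le₂ , le))
                 (Leg-∷ b (t₃ , le₃ , code (p , t₂) , refl , t₂ , le₂ , ≤-refl) (exec (p , t₃) (p , t₂) PO.refl)
                   (climb≤ (p , t₂) {zero} {c₂} z≤n (λ c′ le → t₂ , le₂ , c′ , refl , t₄ , le₄ , ≤-trans le c₂≤))))
          where
          join : ∀ {Z z z₁ z₂ z′} → Leg Z z z₁ → Z z₁ → M.δ z₁ b ≡ z₂ → Leg Z z₂ z′ →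
                 ∃[ w ] (M.δ* z (toList w) ≡ z′ × (∀ {r} → M.Visits z (toList w) r → Z r))
          join {Z} {z} {z₁} {z₂} {z′} (u , refl , f) Zz₁ refl (v , eq , f′) =
            u ++⁺ (b ∷ v)
            , trans (cong (M.δ* z) (toList-++⁺ u (b ∷ v))) (trans (M.δ*-++ z u (b ∷ v)) eq)
            , λ vis → [ f , then ]′ (M.Visits-++⁻ u (subst (λ w → M.Visits z w _) (toList-++⁺ u (b ∷ v)) vis))
            where
            then : ∀ {r} → M.Visits z₁ (b ∷ v) r → Z r
            then M.here = Zz₁
            then (M.there vis) = f′ vis

        abstract
          Above-Loop : ∀ p t → M.Loop ⟦ Above p t ⟧
          Above-Loop p t = M.connected-Loop {Above p t} (Above-start p t)
            {proj₁ (launch (p , t) (toℕ (code (p , t))) zero (+-identityʳ _))}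
            (trans (cong (λ z → M.δ* z (proj₁ (launch (p , t) (toℕ (code (p , t))) zero (+-identityʳ _)))) init-enc)
              (proj₂ (launch (p , t) (toℕ (code (p , t))) zero (+-identityʳ _))))
            (Above-connected p t)

        Above-mono : ∀ {p t t′} → T._⊑_ p t t′ → ⟦ Above p t′ ⟧ ⊆ ⟦ Above p t ⟧
        Above-mono {p} {t} {t′} le z∈ = ∈⟦⟧⁺ (weaken (∈⟦⟧⁻ z∈))
          where
          weaken : ∀ {z} → Above p t′ z → Above p t z
          weaken (t₁ , le₁ , c , eq , t₂ , le₂ , c≤) = t₁ , TO.trans p le le₁ , c , eq , t₂ , TO.trans p le le₂ , c≤

        -- The node `t` is itself visited and lies below all other visited inner nodes, so it is
        -- their meet.
        Above-Desc : ∀ p t → Desc ⟦ Above p t ⟧ p t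
        Above-Desc p t = desc
          (λ z∈ → let t₁ , _ , c , eq , _ = ∈⟦⟧⁻ {P = Above p t} z∈ in t₁ , c , trans (cong dec eq) (dec-enc _))
          (Glb-least (P.label p) (_ , ∈⟦⟧⁺ (Above-start p t) , zero , dec-enc _)
            λ (z , z∈ , at) → least (∈⟦⟧⁻ z∈) at)
          where
          least : ∀ {z t′} → Above p t z → At z p t′ → T._⊑_ p t t′
          least (t₁ , le₁ , c , refl , _) at with At-unique (c , dec-enc (just (p , t₁) , c)) at
          ... | refl = le₁

        inner⇐ : ∀ {C p} → ⟦ Above p (T.root p) ⟧ ⊆ C → S₀.Sim (forestLabelled (T.forest p)) (St.Inn C)
        inner⇐ {C} {p} sub = record
          { R       = λ t x → St.Inner.set x ≡ ⟦ Above p t ⟧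
          ; total   = λ t → above t , refl
          ; forth   = λ { {t} {_} {t′} refl le → above t′ , St.sup (Above-mono le) , refl }
          ; label-≲ = λ { {t} {x} eq → sym (loop-label (St.Inner.loop x)
              (subst (λ D → Desc D p t) (sym eq) (Above-Desc p t))) }
          }
          where
          above : ∀ t → St.Inner C
          above t = St.inner (Above-Loop p t) (λ z∈ → sub (Above-mono (T.rootLeast p t) z∈))

      out⇐ : S₁.Sim (forestLabelled P) St.Out
      out⇐ = record
        { R       = λ p C → ⟦ Above p (T.root p) ⟧ ⊆ St.Outer.set C
        ; total   = maximal
        ; forth   = λ { {p} {_} {p′} sub le →
            let C′ , sub′ = maximal p′
                -- Only reachability is wanted here, so the visited states are tracked by the
                -- trivial predicate.
                w , eq , _ = climb≤ {λ _ → ⊤} (p , T.root p) {zero} {code (p′ , T.root p′)} z≤n (λ _ _ → tt)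
            in C′ , (_ , sub (∈⟦⟧⁺ (Above-start p (T.root p))) , _ , sub′ (∈⟦⟧⁺ (Above-start p′ (T.root p′)))
                    , M.Reachable-trans (w , eq) (b ∷ [] , exec (p , T.root p) (p′ , T.root p′) le)) , sub′ }
        ; label-≲ = λ {p} {C} sub → S₀.Sim⇒hom {T.forest p} {Tree.forest (St.innerTree (St.Outer.loop C))}
            (S₀.Sim-trans (inner⇐ sub) (St.innerTree⇐ (St.Outer.loop C)))
        }
        where
        maximal : ∀ p → ∃[ C ] (⟦ Above p (T.root p) ⟧ ⊆ St.Outer.set C)
        maximal p = let C , mx , sub = M.max-above (Above-Loop p (T.root p)) in St.outer mx , sub

  -- The equivalences of both classes of partitions with the forests

  module _ {X : Set} {k : ℕ} (x y : X) (x≢y : y ≢ x) where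

    private
      module S₁ = Simulation (Poset.preorder (𝓣 k))
      open Homomorphic (Poset.preorder (𝓣 k)) using (_≤ₕ_)

      record Presented : Set₁ where
        constructor presented
        field
          {M} : Automaton X
          {L} : Partition k X
          det : InfDetermines M L
        open Structure M L det public using (Out)
        forest : Forest (Tree (Fin k))
        forest = Structure.outerForest M L det x
        forest⇒ : S₁.Sim (forestLabelled forest) Out
        forest⇒ = Structure.outerForest⇒ M L det x
        forest⇐ : S₁.Sim Out (forestLabelled forest)
        forest⇐ = Structure.outerForest⇐ M L det x
      open Presented

      simulate : ∀ (U V : Presented) → L U ≤CA L V → S₁.Sim (Out U) (Out V)
      simulate U V (g , g-cont , eq) = Reduction.outerSim (M U) (M V) (L U) (L V) (det U) (det V) g g-cont eq

      forest-mono : ∀ (U V : Presented) → L U ≤CA L V → forest U ≤ₕ forest V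
      forest-mono U V le = S₁.Sim⇒hom {forest U} {forest V}
        (S₁.Sim-trans (forest⇒ U) (S₁.Sim-trans (simulate U V le) (forest⇐ V)))

      forest-cancel : ∀ (U V : Presented) → forest U ≤ₕ forest V → L U ≤CA L V
      forest-cancel U V le = Strategy.reduction (M U) (M V) (L U) (L V) (det U) (det V)
        (S₁.Sim-trans (forest⇐ U) (S₁.Sim-trans (S₁.hom⇒Sim {forest U} {forest V} le) (forest⇒ V)))

      present : RegularPartition k X → Presented
      present (B , reg) = presented (proj₂ (regular⇒InfDetermines B reg))

      aperiodic⇒regular : AperiodicPartition k X → RegularPartition k X
      aperiodic⇒regular (B , ap) = B , λ i → let M , _ , rec = ap i in M , rec

      module _ (P : Forest (Tree (Fin k))) where
        open Realise x y x≢y P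

        realised : Presented
        realised = presented determines

        realisation : AperiodicPartition k X
        realisation = partition , components

        private
          U : Presented
          U = present (aperiodic⇒regular realisation)

        -- `U` uses a product of the acceptors instead of the automaton just built. The identity is
        -- a reduction between two presentations of one partition, so their orders of loops simulate
        -- each other.
        realisation≤ : forest U ≤ₕ P
        realisation≤ = S₁.Sim⇒hom {forest U} {P}
          (S₁.Sim-trans (forest⇒ U) (S₁.Sim-trans (simulate U realised ≤CA-refl) out⇒))

        realisation≥ : P ≤ₕ forest U
        realisation≥ = S₁.Sim⇒hom {P} {forest U}
          (S₁.Sim-trans out⇐ (S₁.Sim-trans (simulate realised U ≤CA-refl) (forest⇐ U)))

    regular≃forests : Equivalence-of-orders (𝓡 k X) (𝓕𝓣 k)
    regular≃forests = record
      { to       = forest ∘ present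
      ; mono     = λ {B} {B′} → forest-mono (present B) (present B′)
      ; cancel   = λ {B} {B′} → forest-cancel (present B) (present B′)
      ; from     = aperiodic⇒regular ∘ realisation
      ; to-from≤ = realisation≤
      ; to-from≥ = realisation≥
      }

    aperiodic≃forests : Equivalence-of-orders (𝓐 k X) (𝓕𝓣 k)
    aperiodic≃forests = record
      { to       = forest ∘ present ∘ aperiodic⇒regular
      ; mono     = λ {B} {B′} → forest-mono (present (aperiodic⇒regular B)) (present (aperiodic⇒regular B′))
      ; cancel   = λ {B} {B′} → forest-cancel (present (aperiodic⇒regular B)) (present (aperiodic⇒regular B′))
      ; from     = realisation
      ; to-from≤ = realisation≤
      ; to-from≥ = realisation≥
      }

theorem4p1 : ExcludedMiddle 0ℓ →
    (X : Set) (m : ℕ) → X ↔ Fin m → 2 ≤ m →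
    (k : ℕ) → 2 ≤ k →
    (𝓡 k X ≅ 𝓐 k X) × (𝓡 k X ≅ 𝓕𝓣 k) × (𝓐 k X ≅ 𝓕𝓣 k)
theorem4p1 em X (suc (suc m)) X↔Fin (s≤s (s≤s z≤n)) k _ =
  equivalent⇒≅ (through-common R A) , equivalent⇒≅ R , equivalent⇒≅ A
  where
  open Inverse X↔Fin using (to; from; strictlyInverseˡ)
  distinct : from (suc zero) ≢ from zero
  distinct eq with () ← trans (sym (strictlyInverseˡ (suc zero))) (trans (cong to eq) (strictlyInverseˡ zero))
  R : Equivalence-of-orders (𝓡 k X) (𝓕𝓣 k)
  R = regular≃forests em (from zero) (from (suc zero)) distinct
  A : Equivalence-of-orders (𝓐 k X) (𝓕𝓣 k)
  A = aperiodic≃forests em (from zero) (from (suc zero)) distinct
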